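{- Let $\mathbf{C}$ be a finitary adhesive category with a strict initial object $\varnothing$, in which all final pullback complements (FPCs) along monomorphisms exist and monomorphisms are stable under FPCs. Then the SqPO-type rule algebra $\mathcal{R}^{sq}_{\mathbf{C}}=(\mathcal{R}_{\mathbf{C}},\odot_{\mathcal{R}_{\mathbf{C}}})$ is an associative unital algebra, with unit element $R_\varnothing:=\delta(\varnothing\leftarrow\varnothing\rightarrow\varnothing)$.
   Context: A category is adhesive if it has pushouts along monomorphisms, has pullbacks, and pushouts along monomorphisms are van Kampen squares. It is finitary if every object has only finitely many subobjects (monomorphisms into it up to isomorphism). A strict initial object $\varnothing$ is an initial object such that every morphism $X\to\varnothing$ is an isomorphism. FPC: given $a:A\to B$, $c:B\to C$, a pair $(d:D\to C,b:A\to D)$ is an FPC of $(c,a)$ if $c\circ a=d\circ b$, the square is a pullback, and for all $x:E\to B$, $y:E\to F$, $z:F\to C$, $w:E\to A$ with $(E,x,y)$ a pullback of $(c,z)$ and $a\circ w=x$, there is a unique $w^*:F\to D$ with $d\circ w^*=z$, $w^*\circ y=b\circ w$. The assumption means: for every composable pair of monomorphisms $K\xrightarrow{i}I\xrightarrow{m}X$ an FPC of $(m,i)$ exists and consists of monomorphisms. $\mathrm{Lin}(\mathbf{C})$: isomorphism classes of spans of monomorphisms $p=(O\xleftarrow{o}K\xrightarrow{i}I)$. SqPO composition: for $p_j=(O_j\xleftarrow{o_j}K_j\xrightarrow{i_j}I_j)$, $j=1,2$, a span of monomorphisms $\mathbf{m}=(I_2\xleftarrow{m_2}M_{21}\xrightarrow{m_1}O_1)$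 (up to isomorphism of $M_{21}$ compatible with the legs) is an SqPO-admissible match, $\mathbf{m}\in\mathsf{M}_{p_2}(p_1)$, if with $I_2\xrightarrow{n_2}N_{21}\xleftarrow{n_1}O_1$ the pushout of $\mathbf{m}$ there is a pushout complement $K_1\xrightarrow{k_1}\overline{K}_1\xrightarrow{o_1'}N_{21}$ of $K_1\xrightarrow{o_1}O_1\xrightarrow{n_1}N_{21}$. Then take the FPC $(i_2':\overline{K}_2\to N_{21},k_2)$ of $(n_2,i_2)$, the pushouts $O_{21}$ of $O_2\xleftarrow{o_2}K_2\xrightarrow{k_2}\overline{K}_2$ (with $o_2':\overline{K}_2\to O_{21}$) and $I_{21}$ of $I_1\xleftarrow{i_1}K_1\xrightarrow{k_1}\overline{K}_1$ (with $i_1':\overline{K}_1\to I_{21}$), and the pullback $K_{21}$ (with $i_2'',o_1''$) of $\overline{K}_2\xrightarrow{i_2'}N_{21}\xleftarrow{o_1'}\overline{K}_1$; the composite is $p_2{}^{\mathbf{m}}\!\circ p_1:=(O_{21}\xleftarrow{o_2'\circ i_2''}K_{21}\xrightarrow{i_1'\circ o_1''}I_{21})$. Rule algebra: $\mathcal{R}_{\mathbf{C}}$ is the free $\mathbb{R}$-vector space with basis $\{\delta(p)\mid p\in\mathrm{Lin}(\mathbf{C})\}$, $\delta$ a bijection from $\mathrm{Lin}(\mathbf{C})$ onto this basis. The product is defined on basis vectors by $\delta(p_2)\odot_{\mathcal{R}_{\mathbf{C}}}\delta(p_1):=\sum_{\mathbf{m}\in\mathsf{M}_{p_2}(p_1)}\delta(p_2{}^{\mathbf{m}}\!\circ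 p_1)$ and extended bilinearly.
   Formalization: The sets of admissible matches are assumed finite, since finitarity does not ensure that the sum defining the product is finite (e.g. free G-sets with finitely many orbits, G infinite); this finiteness is shown classically when all automorphism groups are finite. -}

module Defs where

open import Level using (Level; _⊔_; suc)
open import Algebra.Bundles using (CommutativeRing)
open import Algebra.Core using (Op₂)
open import Algebra.Module.Bundles using (Module)
open import Algebra.Module.Structures using (IsLeftModule)
open import Algebra.Module.Structures.Biased using (module IsModuleFromLeft)
open import Algebra.Structures using (IsRing)
import Algebra.Properties.CommutativeMonoid.Sum as CommutativeMonoidSum
import Algebra.Properties.Ring as RingProperties
open import Data.Fin.Base using (Fin)
open import Data.List.Base using (List; []; _∷_; _++_; map; concatMap)
open import Data.List.Properties using (++-assoc; ++-identityʳ)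
open import Data.Nat.Base using (ℕ)
open import Data.Product.Base using (Σ; Σ-syntax; _×_; _,_; proj₁; proj₂)
open import Function.Bundles using (Inverse; _⇔_; Equivalence)
open import Relation.Binary.Bundles using (Setoid)
open import Relation.Binary.Core using (Rel)
open import Relation.Binary.Structures using (IsEquivalence)
open import Relation.Binary.PropositionalEquality as ≡ using (_≡_)
import Relation.Binary.Reasoning.Setoid as SetoidReasoning

record Finite {a ℓ} (S : Setoid a ℓ) : Set (a ⊔ ℓ) where
  field
    size        : ℕ
    enumeration : Inverse (≡.setoid (Fin size)) S

  element : Fin size → Setoid.Carrier S
  element = Inverse.to enumeration

record Category (o ℓ e : Level) : Set (suc (o ⊔ ℓ ⊔ e)) where
  infix  4 _≈_ _⇒_
  infixr 9 _∘_
  field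
    Obj       : Set o
    _⇒_       : Rel Obj ℓ
    _≈_       : ∀ {A B} → Rel (A ⇒ B) e
    id        : ∀ {A} → A ⇒ A
    _∘_       : ∀ {A B C} → B ⇒ C → A ⇒ B → A ⇒ C
    assoc     : ∀ {A B C D} {f : A ⇒ B} {g : B ⇒ C} {h : C ⇒ D} →
                (h ∘ g) ∘ f ≈ h ∘ (g ∘ f)
    identityˡ : ∀ {A B} {f : A ⇒ B} → id ∘ f ≈ f
    identityʳ : ∀ {A B} {f : A ⇒ B} → f ∘ id ≈ f
    equiv     : ∀ {A B} → IsEquivalence (_≈_ {A} {B})
    ∘-resp-≈  : ∀ {A B C} {f h : B ⇒ C} {g i : A ⇒ B} →
                f ≈ h → g ≈ i → f ∘ g ≈ h ∘ i

  module Equiv {A B : Obj} = IsEquivalence (equiv {A} {B})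

  hom-setoid : (A B : Obj) → Setoid ℓ e
  hom-setoid A B = record { Carrier = A ⇒ B ; _≈_ = _≈_ ; isEquivalence = equiv }

module CategoryNotions {o ℓ e} (C : Category o ℓ e) where
  open Category C

  private
    variable
      A B D X Y Z : Obj

    ∘-congˡ : {f : B ⇒ D} {g h : A ⇒ B} → g ≈ h → f ∘ g ≈ f ∘ h
    ∘-congˡ = ∘-resp-≈ Equiv.refl

    ∘-congʳ : {f g : B ⇒ D} {h : A ⇒ B} → f ≈ g → f ∘ h ≈ g ∘ h
    ∘-congʳ p = ∘-resp-≈ p Equiv.refl

  Mono : A ⇒ B → Set (o ⊔ ℓ ⊔ e)
  Mono {A} f = ∀ {Z} (g h : Z ⇒ A) → f ∘ g ≈ f ∘ h → g ≈ h

  record IsIso (f : A ⇒ B) : Set (ℓ ⊔ e) where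
    field
      inv  : B ⇒ A
      isoˡ : inv ∘ f ≈ id
      isoʳ : f ∘ inv ≈ id

  infix 4 _≅_
  record _≅_ (A B : Obj) : Set (ℓ ⊔ e) where
    field
      from  : A ⇒ B
      isIso : IsIso from
    open IsIso isIso public renaming (inv to to)

  ≅-refl : A ≅ A
  ≅-refl = record
    { from  = id
    ; isIso = record { inv = id ; isoˡ = identityˡ ; isoʳ = identityˡ } }

  ≅-sym : A ≅ B → B ≅ A
  ≅-sym φ = record
    { from  = φ.to
    ; isIso = record { inv = φ.from ; isoˡ = φ.isoʳ ; isoʳ = φ.isoˡ } }
    where module φ = _≅_ φ

  private
    cancel-middle : {f : B ⇒ D} {g : D ⇒ B} {h : A ⇒ B} →
                    g ∘ f ≈ id → g ∘ (f ∘ h) ≈ h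
    cancel-middle p =
      Equiv.trans (Equiv.sym assoc) (Equiv.trans (∘-congʳ p) identityˡ)

    inverse-∘ : {f : A ⇒ B} {f′ : B ⇒ A} {g : B ⇒ D} {g′ : D ⇒ B} →
                f′ ∘ f ≈ id → g′ ∘ g ≈ id → (f′ ∘ g′) ∘ (g ∘ f) ≈ id
    inverse-∘ p q = Equiv.trans assoc (Equiv.trans (∘-congˡ (cancel-middle q)) p)

  ≅-trans : A ≅ B → B ≅ D → A ≅ D
  ≅-trans φ ψ = record
    { from  = ψ.from ∘ φ.from
    ; isIso = record
      { inv  = φ.to ∘ ψ.to
      ; isoˡ = inverse-∘ φ.isoˡ ψ.isoˡ
      ; isoʳ = inverse-∘ ψ.isoʳ φ.isoʳ } }
    where
    module φ = _≅_ φ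
    module ψ = _≅_ ψ

  --   P --p₂--> Y
  --   |         |
  --   p₁        g
  --   v         v
  --   X --f---> Z
  record IsPullback {P X Y Z : Obj} (p₁ : P ⇒ X) (p₂ : P ⇒ Y)
                    (f : X ⇒ Z) (g : Y ⇒ Z) : Set (o ⊔ ℓ ⊔ e) where
    field
      commute   : f ∘ p₁ ≈ g ∘ p₂
      universal : ∀ {Q} {h₁ : Q ⇒ X} {h₂ : Q ⇒ Y} → f ∘ h₁ ≈ g ∘ h₂ → Q ⇒ P
      p₁∘universal≈h₁ : ∀ {Q} {h₁ : Q ⇒ X} {h₂ : Q ⇒ Y}
                        {eq : f ∘ h₁ ≈ g ∘ h₂} → p₁ ∘ universal eq ≈ h₁
      p₂∘universal≈h₂ : ∀ {Q} {h₁ : Q ⇒ X} {h₂ : Q ⇒ Y}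
                        {eq : f ∘ h₁ ≈ g ∘ h₂} → p₂ ∘ universal eq ≈ h₂
      unique    : ∀ {Q} {h₁ : Q ⇒ X} {h₂ : Q ⇒ Y} {u v : Q ⇒ P} →
                  p₁ ∘ u ≈ h₁ → p₂ ∘ u ≈ h₂ →
                  p₁ ∘ v ≈ h₁ → p₂ ∘ v ≈ h₂ → u ≈ v

  record Pullback {X Y Z : Obj} (f : X ⇒ Z) (g : Y ⇒ Z) : Set (o ⊔ ℓ ⊔ e) where
    field
      {P}        : Obj
      p₁         : P ⇒ X
      p₂         : P ⇒ Y
      isPullback : IsPullback p₁ p₂ f g

  --   A --g---> Y
  --   |         |
  --   f         i₂
  --   v         v
  --   X --i₁--> Q
  record IsPushout {A X Y Q : Obj} (f : A ⇒ X) (g : A ⇒ Y)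
                   (i₁ : X ⇒ Q) (i₂ : Y ⇒ Q) : Set (o ⊔ ℓ ⊔ e) where
    field
      commute   : i₁ ∘ f ≈ i₂ ∘ g
      universal : ∀ {R} {h₁ : X ⇒ R} {h₂ : Y ⇒ R} → h₁ ∘ f ≈ h₂ ∘ g → Q ⇒ R
      universal∘i₁≈h₁ : ∀ {R} {h₁ : X ⇒ R} {h₂ : Y ⇒ R}
                        {eq : h₁ ∘ f ≈ h₂ ∘ g} → universal eq ∘ i₁ ≈ h₁
      universal∘i₂≈h₂ : ∀ {R} {h₁ : X ⇒ R} {h₂ : Y ⇒ R}
                        {eq : h₁ ∘ f ≈ h₂ ∘ g} → universal eq ∘ i₂ ≈ h₂
      unique    : ∀ {R} {h₁ : X ⇒ R} {h₂ : Y ⇒ R} {u v : Q ⇒ R} →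
                  u ∘ i₁ ≈ h₁ → u ∘ i₂ ≈ h₂ →
                  v ∘ i₁ ≈ h₁ → v ∘ i₂ ≈ h₂ → u ≈ v

  record Pushout {A X Y : Obj} (f : A ⇒ X) (g : A ⇒ Y) : Set (o ⊔ ℓ ⊔ e) where
    field
      {Q}       : Obj
      i₁        : X ⇒ Q
      i₂        : Y ⇒ Q
      isPushout : IsPushout f g i₁ i₂

  record PushoutComplement {A X Q : Obj} (f : A ⇒ X) (i₁ : X ⇒ Q)
                           : Set (o ⊔ ℓ ⊔ e) where
    field
      {apex}    : Obj
      g         : A ⇒ apex
      i₂        : apex ⇒ Q
      isPushout : IsPushout f g i₁ i₂

  --   A --a--> B
  --   |        |
  --   b        c
  --   v        v
  --   D --d--> X
  record IsFPC {A B X D : Obj} (c : B ⇒ X) (a : A ⇒ B) (d : D ⇒ X) (b : A ⇒ D)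
               : Set (o ⊔ ℓ ⊔ e) where
    field
      isPullback : IsPullback a b c d
      universal  : ∀ {E F} {x : E ⇒ B} {y : E ⇒ F} {z : F ⇒ X} {w : E ⇒ A} →
                   IsPullback x y c z → a ∘ w ≈ x → F ⇒ D
      d∘universal≈z   : ∀ {E F} {x : E ⇒ B} {y : E ⇒ F} {z : F ⇒ X} {w : E ⇒ A}
                        {pb : IsPullback x y c z} {eq : a ∘ w ≈ x} →
                        d ∘ universal pb eq ≈ z
      universal∘y≈b∘w : ∀ {E F} {x : E ⇒ B} {y : E ⇒ F} {z : F ⇒ X} {w : E ⇒ A}
                        {pb : IsPullback x y c z} {eq : a ∘ w ≈ x} →
                        universal pb eq ∘ y ≈ b ∘ w
      unique     : ∀ {E F} {x : E ⇒ B} {y : E ⇒ F} {z : F ⇒ X} {w : E ⇒ A} →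
                   IsPullback x y c z → a ∘ w ≈ x → {u v : F ⇒ D} →
                   d ∘ u ≈ z → u ∘ y ≈ b ∘ w →
                   d ∘ v ≈ z → v ∘ y ≈ b ∘ w → u ≈ v

  record FPC {A B X : Obj} (c : B ⇒ X) (a : A ⇒ B) : Set (o ⊔ ℓ ⊔ e) where
    field
      {apex} : Obj
      d      : apex ⇒ X
      b      : A ⇒ apex
      isFPC  : IsFPC c a d b

  record HasMonoFPCs : Set (o ⊔ ℓ ⊔ e) where
    field
      fpc    : ∀ {K I X} (m : I ⇒ X) (i : K ⇒ I) → Mono m → Mono i → FPC m i
      d-mono : ∀ {K I X} {m : I ⇒ X} {i : K ⇒ I} (mm : Mono m) (mi : Mono i) →
               Mono (FPC.d (fpc m i mm mi))
      b-mono : ∀ {K I X} {m : I ⇒ X} {i : K ⇒ I} (mm : Mono m) (mi : Mono i) →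
               Mono (FPC.b (fpc m i mm mi))

  -- The given square is the bottom face of the cube; f′, g′, i₁′, i₂′ form the
  -- top face, and α, β, γ, δ are the vertical morphisms.
  IsVanKampen : {A X Y Q : Obj} (f : A ⇒ X) (g : A ⇒ Y)
                (i₁ : X ⇒ Q) (i₂ : Y ⇒ Q) → Set (o ⊔ ℓ ⊔ e)
  IsVanKampen {A} {X} {Y} {Q} f g i₁ i₂ =
    ∀ {A′ X′ Y′ Q′}
    {f′ : A′ ⇒ X′} {g′ : A′ ⇒ Y′} {i₁′ : X′ ⇒ Q′} {i₂′ : Y′ ⇒ Q′}
    {α : A′ ⇒ A} {β : X′ ⇒ X} {γ : Y′ ⇒ Y} {δ : Q′ ⇒ Q} →
    i₁′ ∘ f′ ≈ i₂′ ∘ g′ →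
    i₁ ∘ β ≈ δ ∘ i₁′ →
    i₂ ∘ γ ≈ δ ∘ i₂′ →
    IsPullback α f′ f β →
    IsPullback α g′ g γ →
    IsPushout f′ g′ i₁′ i₂′ ⇔ (IsPullback β i₁′ i₁ δ × IsPullback γ i₂′ i₂ δ)

  record Adhesive : Set (o ⊔ ℓ ⊔ e) where
    field
      pullback  : ∀ {X Y Z} (f : X ⇒ Z) (g : Y ⇒ Z) → Pullback f g
      pushout   : ∀ {A X Y} (f : A ⇒ X) (g : A ⇒ Y) → Mono f → Pushout f g
      vanKampen : ∀ {A X Y Q} {f : A ⇒ X} {g : A ⇒ Y} {i₁ : X ⇒ Q} {i₂ : Y ⇒ Q} →
                  Mono f → IsPushout f g i₁ i₂ → IsVanKampen f g i₁ i₂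

  record StrictInitial : Set (o ⊔ ℓ ⊔ e) where
    field
      ∅        : Obj
      !        : ∀ {X} → ∅ ⇒ X
      !-unique : ∀ {X} (f : ∅ ⇒ X) → ! ≈ f
      strict   : ∀ {X} (f : X ⇒ ∅) → IsIso f

  record Subobject (X : Obj) : Set (o ⊔ ℓ ⊔ e) where
    field
      {dom} : Obj
      arr   : dom ⇒ X
      mono  : Mono arr

  SubobjectSetoid : Obj → Setoid (o ⊔ ℓ ⊔ e) (ℓ ⊔ e)
  SubobjectSetoid X = record
    { Carrier       = Subobject X
    ; _≈_           = λ S T → Σ[ φ ∈ dom S ≅ dom T ] arr T ∘ from φ ≈ arr S
    ; isEquivalence = record
      { refl  = ≅-refl , identityʳ
      ; sym   = λ (φ , p) → ≅-sym φ ,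
                Equiv.trans (∘-congʳ (Equiv.sym p))
                  (Equiv.trans assoc (Equiv.trans (∘-congˡ (isoʳ φ)) identityʳ))
      ; trans = λ (φ , p) (ψ , q) → ≅-trans φ ψ ,
                Equiv.trans (Equiv.sym assoc) (Equiv.trans (∘-congʳ q) p) } }
    where
    open Subobject
    open _≅_

  Finitary : Set (o ⊔ ℓ ⊔ e)
  Finitary = ∀ X → Finite (SubobjectSetoid X)

  AutomorphismSetoid : Obj → Setoid (ℓ ⊔ e) e
  AutomorphismSetoid X = record
    { Carrier       = X ≅ X
    ; _≈_           = λ φ ψ → from φ ≈ from ψ
    ; isEquivalence = record
      { refl = Equiv.refl ; sym = Equiv.sym ; trans = Equiv.trans } }
    where open _≅_

  FiniteAutomorphisms : Set (o ⊔ ℓ ⊔ e)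
  FiniteAutomorphisms = ∀ X → Finite (AutomorphismSetoid X)

  id-mono : Mono (id {A})
  id-mono g h p = Equiv.trans (Equiv.sym identityˡ) (Equiv.trans p identityˡ)

  ∘-mono : {f : B ⇒ D} {g : A ⇒ B} → Mono f → Mono g → Mono (f ∘ g)
  ∘-mono mf mg h k p =
    mg h k (mf _ _ (Equiv.trans (Equiv.sym assoc) (Equiv.trans p assoc)))

  flip-pullback : ∀ {P} {p₁ : P ⇒ X} {p₂ : P ⇒ Y} {f : X ⇒ Z} {g : Y ⇒ Z} →
                  IsPullback p₁ p₂ f g → IsPullback p₂ p₁ g f
  flip-pullback pb = record
    { commute         = Equiv.sym commute
    ; universal       = λ p → universal (Equiv.sym p)
    ; p₁∘universal≈h₁ = p₂∘universal≈h₂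
    ; p₂∘universal≈h₂ = p₁∘universal≈h₁
    ; unique          = λ a b c d → unique b a d c }
    where open IsPullback pb

  flip-pushout : ∀ {Q} {f : A ⇒ X} {g : A ⇒ Y} {i₁ : X ⇒ Q} {i₂ : Y ⇒ Q} →
                 IsPushout f g i₁ i₂ → IsPushout g f i₂ i₁
  flip-pushout po = record
    { commute         = Equiv.sym commute
    ; universal       = λ p → universal (Equiv.sym p)
    ; universal∘i₁≈h₁ = universal∘i₂≈h₂
    ; universal∘i₂≈h₂ = universal∘i₁≈h₁
    ; unique          = λ a b c d → unique b a d c }
    where open IsPushout po

  pullback-p₁-mono : ∀ {P} {p₁ : P ⇒ X} {p₂ : P ⇒ Y} {f : X ⇒ Z} {g : Y ⇒ Z} →
                     IsPullback p₁ p₂ f g → Mono g → Mono p₁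
  pullback-p₁-mono {p₁ = p₁} {p₂} {f} {g} pb mg u v p =
    unique p
      (mg _ _ (Equiv.trans (Equiv.sym (slide u))
                (Equiv.trans (∘-congˡ p) (slide v))))
      Equiv.refl Equiv.refl
    where
    open IsPullback pb
    slide : ∀ {W} (w : W ⇒ _) → f ∘ (p₁ ∘ w) ≈ g ∘ (p₂ ∘ w)
    slide w = Equiv.trans (Equiv.sym assoc) (Equiv.trans (∘-congʳ commute) assoc)

  private
    mono⇒kernel : {f : A ⇒ B} → Mono f → IsPullback id id f f
    mono⇒kernel mf = record
      { commute         = Equiv.refl
      ; universal       = λ {_} {h₁} _ → h₁
      ; p₁∘universal≈h₁ = identityˡ
      ; p₂∘universal≈h₂ = λ {_} {_} {_} {p} → Equiv.trans identityˡ (mf _ _ p)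
      ; unique          = λ p _ q _ → Equiv.trans (Equiv.sym identityˡ)
                            (Equiv.trans (Equiv.trans p (Equiv.sym q)) identityˡ) }

    kernel⇒mono : {f : A ⇒ B} → IsPullback id id f f → Mono f
    kernel⇒mono pb g h p = Equiv.trans (Equiv.sym p₁∘universal≈h₁)
                             (p₂∘universal≈h₂ {eq = p})
      where open IsPullback pb

    id-pullback : {g : A ⇒ B} → IsPullback id g g id
    id-pullback = record
      { commute         = Equiv.trans identityʳ (Equiv.sym identityˡ)
      ; universal       = λ {_} {h₁} _ → h₁
      ; p₁∘universal≈h₁ = identityˡ
      ; p₂∘universal≈h₂ = λ {_} {_} {_} {p} → Equiv.trans p identityˡ
      ; unique          = λ p _ q _ → Equiv.trans (Equiv.sym identityˡ)
                            (Equiv.trans (Equiv.trans p (Equiv.sym q)) identityˡ) }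

    id-pushout : {g : A ⇒ B} → IsPushout id g g id
    id-pushout = record
      { commute         = Equiv.trans identityʳ (Equiv.sym identityˡ)
      ; universal       = λ {_} {_} {h₂} _ → h₂
      ; universal∘i₁≈h₁ = λ {_} {_} {_} {p} →
                            Equiv.trans (Equiv.sym p) identityʳ
      ; universal∘i₂≈h₂ = identityʳ
      ; unique          = λ _ p _ q → Equiv.trans (Equiv.sym identityʳ)
                            (Equiv.trans (Equiv.trans p (Equiv.sym q)) identityʳ) }

  pushout-i₂-mono : Adhesive →
    ∀ {Q} {f : A ⇒ X} {g : A ⇒ Y} {i₁ : X ⇒ Q} {i₂ : Y ⇒ Q} →
    Mono f → IsPushout f g i₁ i₂ → Mono i₂
  pushout-i₂-mono adhesive {f = f} {g} {i₁} {i₂} mf po = kernel⇒mono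
    (proj₂ (Equivalence.to
      (Adhesive.vanKampen adhesive mf po
        {f′ = id} {g′ = g} {i₁′ = g} {i₂′ = id} {α = id} {β = f} {γ = id} {δ = i₂}
        (Equiv.trans identityʳ (Equiv.sym identityˡ))
        (IsPushout.commute po)
        Equiv.refl
        (mono⇒kernel mf)
        id-pullback)
      id-pushout))

-- Formal linear combinations Σₖ rₖ·sₖ, as lists of terms.  The equality is the
-- least congruence that makes them the free R-module on the quotient of S by
-- its setoid equality, with ++ as addition.
module FreeModule {c r} (R : CommutativeRing c r) {a ℓ} (S : Setoid a ℓ) where
  private
    module R = CommutativeRing R
    module S = Setoid S

  Combination : Set (c ⊔ a)
  Combination = List (R.Carrier × S.Carrier)

  infix 4 _∼_
  data _∼_ : Rel Combination (c ⊔ r ⊔ a ⊔ ℓ) where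
    []    : [] ∼ []
    cons  : ∀ {k l s t xs ys} → k R.≈ l → s S.≈ t → xs ∼ ys →
            (k , s) ∷ xs ∼ (l , t) ∷ ys
    swap  : ∀ x y xs → x ∷ y ∷ xs ∼ y ∷ x ∷ xs
    merge : ∀ k l s xs → (k , s) ∷ (l , s) ∷ xs ∼ (k R.+ l , s) ∷ xs
    drop  : ∀ s xs → (R.0# , s) ∷ xs ∼ xs
    sym   : ∀ {xs ys} → xs ∼ ys → ys ∼ xs
    trans : ∀ {xs ys zs} → xs ∼ ys → ys ∼ zs → xs ∼ zs

  δ : S.Carrier → Combination
  δ s = (R.1# , s) ∷ []

  infixr 7 _•_
  _•_ : R.Carrier → Combination → Combination
  k • xs = map (λ (l , s) → k R.* l , s) xs

  neg : Combination → Combination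
  neg = map (λ (l , s) → R.- l , s)

  private
    ∼-refl : ∀ {xs} → xs ∼ xs
    ∼-refl {[]}     = []
    ∼-refl {_ ∷ xs} = cons R.refl S.refl ∼-refl

    ∼-isEquivalence : IsEquivalence _∼_
    ∼-isEquivalence = record { refl = ∼-refl ; sym = sym ; trans = trans }

    ∼-setoid : Setoid (c ⊔ a) (c ⊔ r ⊔ a ⊔ ℓ)
    ∼-setoid = record { isEquivalence = ∼-isEquivalence }

    open SetoidReasoning ∼-setoid

    ≡⇒∼ : ∀ {xs ys} → xs ≡ ys → xs ∼ ys
    ≡⇒∼ ≡.refl = ∼-refl

    skip : ∀ x {xs ys} → xs ∼ ys → x ∷ xs ∼ x ∷ ys
    skip _ = cons R.refl S.refl

    ++-congˡ : ∀ xs {ys zs} → ys ∼ zs → xs ++ ys ∼ xs ++ zs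
    ++-congˡ []       p = p
    ++-congˡ (x ∷ xs) p = skip x (++-congˡ xs p)

    ++-congʳ : ∀ {xs ys} zs → xs ∼ ys → xs ++ zs ∼ ys ++ zs
    ++-congʳ zs []              = ∼-refl
    ++-congʳ zs (cons p q xs)   = cons p q (++-congʳ zs xs)
    ++-congʳ zs (swap x y xs)   = swap x y (xs ++ zs)
    ++-congʳ zs (merge k l s xs) = merge k l s (xs ++ zs)
    ++-congʳ zs (drop s xs)     = drop s (xs ++ zs)
    ++-congʳ zs (sym p)         = sym (++-congʳ zs p)
    ++-congʳ zs (trans p q)     = trans (++-congʳ zs p) (++-congʳ zs q)

    ++-cong : ∀ {xs ys us vs} → xs ∼ ys → us ∼ vs → xs ++ us ∼ ys ++ vs
    ++-cong {ys = ys} {us} p q = trans (++-congʳ us p) (++-congˡ ys q)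

    shift : ∀ x xs ys → xs ++ x ∷ ys ∼ x ∷ xs ++ ys
    shift x []       ys = ∼-refl
    shift x (y ∷ xs) ys = trans (skip y (shift x xs ys)) (swap y x (xs ++ ys))

    ++-comm : ∀ xs ys → xs ++ ys ∼ ys ++ xs
    ++-comm []       ys = ≡⇒∼ (≡.sym (++-identityʳ ys))
    ++-comm (x ∷ xs) ys = trans (skip x (++-comm xs ys)) (sym (shift x ys xs))

    map-cong : (φ : R.Carrier → R.Carrier) →
      (∀ {k l} → k R.≈ l → φ k R.≈ φ l) →
      (∀ k l → φ (k R.+ l) R.≈ φ k R.+ φ l) → φ R.0# R.≈ R.0# →
      ∀ {xs ys} → xs ∼ ys →
      map (λ (l , s) → φ l , s) xs ∼ map (λ (l , s) → φ l , s) ys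
    map-cong φ φ-cong φ-+ φ-0 = go
      where
      go : ∀ {xs ys} → xs ∼ ys → _ ∼ _
      go []               = []
      go (cons p q xs)    = cons (φ-cong p) q (go xs)
      go (swap x y xs)    = swap _ _ _
      go (merge k l s xs) =
        trans (merge _ _ s _) (cons (R.sym (φ-+ k l)) S.refl ∼-refl)
      go (drop s xs)      = trans (cons φ-0 S.refl ∼-refl) (drop s _)
      go (sym p)          = sym (go p)
      go (trans p q)      = trans (go p) (go q)

    neg-cong : ∀ {xs ys} → xs ∼ ys → neg xs ∼ neg ys
    neg-cong = map-cong R.-_ R.-‿cong
      (λ k l → R.sym (RingProperties.-‿+-comm R.ring k l))
      (RingProperties.-0#≈0# R.ring)

    inverseʳ : ∀ xs → xs ++ neg xs ∼ []
    inverseʳ []             = []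
    inverseʳ ((k , s) ∷ xs) = begin
      (k , s) ∷ xs ++ (R.- k , s) ∷ neg xs   ≈⟨ skip _ (shift _ xs _) ⟩
      (k , s) ∷ (R.- k , s) ∷ xs ++ neg xs   ≈⟨ merge k _ s _ ⟩
      (k R.+ R.- k , s) ∷ xs ++ neg xs       ≈⟨ cons (R.-‿inverseʳ k) S.refl (inverseʳ xs) ⟩
      (R.0# , s) ∷ []                        ≈⟨ drop s [] ⟩
      []                                     ∎

    •-congʳ : ∀ {k l} xs → k R.≈ l → k • xs ∼ l • xs
    •-congʳ []       p = []
    •-congʳ (_ ∷ xs) p = cons (R.*-congʳ p) S.refl (•-congʳ xs p)

    •-congˡ : ∀ k {xs ys} → xs ∼ ys → k • xs ∼ k • ys
    •-congˡ k = map-cong (k R.*_) R.*-congˡ (R.distribˡ k) (R.zeroʳ k)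

    •-zeroˡ : ∀ xs → R.0# • xs ∼ []
    •-zeroˡ []             = []
    •-zeroˡ ((k , s) ∷ xs) =
      trans (cons (R.zeroˡ k) S.refl (•-zeroˡ xs)) (drop s [])

    •-distribʳ : ∀ xs k l → (k R.+ l) • xs ∼ k • xs ++ l • xs
    •-distribʳ []             k l = []
    •-distribʳ ((m , s) ∷ xs) k l = begin
      ((k R.+ l) R.* m , s) ∷ (k R.+ l) • xs               ≈⟨ cons (R.distribʳ m k l) S.refl (•-distribʳ xs k l) ⟩
      (k R.* m R.+ l R.* m , s) ∷ k • xs ++ l • xs         ≈⟨ merge _ _ s _ ⟨
      (k R.* m , s) ∷ (l R.* m , s) ∷ k • xs ++ l • xs     ≈⟨ skip _ (shift _ (k • xs) _) ⟨
      (k R.* m , s) ∷ k • xs ++ (l R.* m , s) ∷ l • xs     ∎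

    •-identityˡ : ∀ xs → R.1# • xs ∼ xs
    •-identityˡ []       = []
    •-identityˡ (_ ∷ xs) = cons (R.*-identityˡ _) S.refl (•-identityˡ xs)

    •-assoc : ∀ k l xs → (k R.* l) • xs ∼ k • (l • xs)
    •-assoc k l []       = []
    •-assoc k l (_ ∷ xs) = cons (R.*-assoc k l _) S.refl (•-assoc k l xs)

    •-distribˡ : ∀ k xs ys → k • (xs ++ ys) ∼ k • xs ++ k • ys
    •-distribˡ k []       ys = ∼-refl
    •-distribˡ k (_ ∷ xs) ys = skip _ (•-distribˡ k xs ys)

  isLeftModule : IsLeftModule R.ring _∼_ _++_ [] neg _•_
  isLeftModule = record
    { isLeftSemimodule = record
      { +ᴹ-isCommutativeMonoid = record
        { isMonoid = record
          { isSemigroup = record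
            { isMagma = record
              { isEquivalence = ∼-isEquivalence
              ; ∙-cong        = ++-cong }
            ; assoc = λ xs ys zs → ≡⇒∼ (++-assoc xs ys zs) }
          ; identity = (λ _ → ∼-refl) , (λ xs → ≡⇒∼ (++-identityʳ xs)) }
        ; comm = ++-comm }
      ; isPreleftSemimodule = record
        { *ₗ-cong      = λ {k} {l} {xs} p q → trans (•-congʳ xs p) (•-congˡ l q)
        ; *ₗ-zeroˡ     = •-zeroˡ
        ; *ₗ-distribʳ  = •-distribʳ
        ; *ₗ-identityˡ = •-identityˡ
        ; *ₗ-assoc     = •-assoc
        ; *ₗ-zeroʳ     = λ _ → []
        ; *ₗ-distribˡ  = •-distribˡ } }
    ; -ᴹ‿cong    = neg-cong
    ; -ᴹ‿inverse = (λ xs → trans (++-comm (neg xs) xs) (inverseʳ xs)) , inverseʳ }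

  freeModule : Module R (c ⊔ a) (c ⊔ r ⊔ a ⊔ ℓ)
  freeModule = record
    { isModule = IsModuleFromLeft.isModule {commutativeRing = R}
                   (record { isLeftModule = isLeftModule }) }

  bilinearExtension : (S.Carrier → S.Carrier → Combination) → Op₂ Combination
  bilinearExtension _·_ xs ys =
    concatMap (λ (k , s) → concatMap (λ (l , t) → (k R.* l) • (s · t)) ys) xs

record IsAssociativeUnitalAlgebra
  {c r m ℓm} {R : CommutativeRing c r} (M : Module R m ℓm)
  (_·_ : Op₂ (Module.Carrierᴹ M)) (𝟙 : Module.Carrierᴹ M)
  : Set (c ⊔ r ⊔ m ⊔ ℓm) where
  open Module M
  field
    isRing     : IsRing _≈ᴹ_ _+ᴹ_ _·_ -ᴹ_ 0ᴹ 𝟙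
    *ₗ-·-left  : ∀ k x y → (k *ₗ x) · y ≈ᴹ k *ₗ (x · y)
    *ₗ-·-right : ∀ k x y → x · (k *ₗ y) ≈ᴹ k *ₗ (x · y)

module Rules {o ℓ e} (C : Category o ℓ e) where
  open Category C
  open CategoryNotions C

  record Rule : Set (o ⊔ ℓ ⊔ e) where
    field
      {O K I} : Obj
      out     : K ⇒ O
      inp     : K ⇒ I
      out-mono : Mono out
      inp-mono : Mono inp

  record _≅ᴿ_ (p q : Rule) : Set (ℓ ⊔ e) where
    private
      module p = Rule p
      module q = Rule q
    field
      isoO : p.O ≅ q.O
      isoK : p.K ≅ q.K
      isoI : p.I ≅ q.I
      out-commute : _≅_.from isoO ∘ p.out ≈ q.out ∘ _≅_.from isoK
      inp-commute : _≅_.from isoI ∘ p.inp ≈ q.inp ∘ _≅_.from isoK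

  private
    square-sym : ∀ {A B A′ B′} (φ : A ≅ A′) (ψ : B ≅ B′) {f : A ⇒ B} {g : A′ ⇒ B′} →
                 _≅_.from ψ ∘ f ≈ g ∘ _≅_.from φ →
                 _≅_.to ψ ∘ g ≈ f ∘ _≅_.to φ
    square-sym φ ψ {f} {g} p = begin
      ψ.to ∘ g                            ≈⟨ ∘-resp-≈ Equiv.refl identityʳ ⟨
      ψ.to ∘ (g ∘ id)                     ≈⟨ ∘-resp-≈ Equiv.refl (∘-resp-≈ Equiv.refl φ.isoʳ) ⟨
      ψ.to ∘ (g ∘ (φ.from ∘ φ.to))        ≈⟨ ∘-resp-≈ Equiv.refl assoc ⟨
      ψ.to ∘ ((g ∘ φ.from) ∘ φ.to)        ≈⟨ ∘-resp-≈ Equiv.refl (∘-resp-≈ p Equiv.refl) ⟨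
      ψ.to ∘ ((ψ.from ∘ f) ∘ φ.to)        ≈⟨ ∘-resp-≈ Equiv.refl assoc ⟩
      ψ.to ∘ (ψ.from ∘ (f ∘ φ.to))        ≈⟨ assoc ⟨
      (ψ.to ∘ ψ.from) ∘ (f ∘ φ.to)        ≈⟨ ∘-resp-≈ ψ.isoˡ Equiv.refl ⟩
      id ∘ (f ∘ φ.to)                     ≈⟨ identityˡ ⟩
      f ∘ φ.to                            ∎
      where
      module φ = _≅_ φ
      module ψ = _≅_ ψ
      open SetoidReasoning (hom-setoid _ _)

    square-trans : ∀ {A B A′ B′ A″ B″}
                   {f : A ⇒ B} {g : A′ ⇒ B′} {h : A″ ⇒ B″}
                   {φ : A ⇒ A′} {ψ : B ⇒ B′} {φ′ : A′ ⇒ A″} {ψ′ : B′ ⇒ B″} →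
                   ψ ∘ f ≈ g ∘ φ → ψ′ ∘ g ≈ h ∘ φ′ →
                   (ψ′ ∘ ψ) ∘ f ≈ h ∘ (φ′ ∘ φ)
    square-trans p q =
      Equiv.trans assoc
        (Equiv.trans (∘-resp-≈ Equiv.refl p)
          (Equiv.trans (Equiv.sym assoc)
            (Equiv.trans (∘-resp-≈ q Equiv.refl) assoc)))

    square-refl : ∀ {A B} {f : A ⇒ B} → id ∘ f ≈ f ∘ id
    square-refl = Equiv.trans identityˡ (Equiv.sym identityʳ)

  private
    ≅ᴿ-refl : ∀ {p} → p ≅ᴿ p
    ≅ᴿ-refl = record
      { isoO = ≅-refl ; isoK = ≅-refl ; isoI = ≅-refl
      ; out-commute = square-refl ; inp-commute = square-refl }

    ≅ᴿ-sym : ∀ {p q} → p ≅ᴿ q → q ≅ᴿ p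
    ≅ᴿ-sym φ = record
      { isoO = ≅-sym φ.isoO
      ; isoK = ≅-sym φ.isoK
      ; isoI = ≅-sym φ.isoI
      ; out-commute = square-sym φ.isoK φ.isoO φ.out-commute
      ; inp-commute = square-sym φ.isoK φ.isoI φ.inp-commute }
      where
      module φ = _≅ᴿ_ φ

    ≅ᴿ-trans : ∀ {p q r} → p ≅ᴿ q → q ≅ᴿ r → p ≅ᴿ r
    ≅ᴿ-trans φ ψ = record
      { isoO = ≅-trans φ.isoO ψ.isoO
      ; isoK = ≅-trans φ.isoK ψ.isoK
      ; isoI = ≅-trans φ.isoI ψ.isoI
      ; out-commute = square-trans φ.out-commute ψ.out-commute
      ; inp-commute = square-trans φ.inp-commute ψ.inp-commute }
      where
      module φ = _≅ᴿ_ φ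
      module ψ = _≅ᴿ_ ψ

  -- Setoid equality is isomorphism, so this represents the set Lin(C).
  Lin : Setoid (o ⊔ ℓ ⊔ e) (ℓ ⊔ e)
  Lin = record
    { Carrier       = Rule
    ; _≈_           = _≅ᴿ_
    ; isEquivalence = record
      { refl = ≅ᴿ-refl ; sym = ≅ᴿ-sym ; trans = ≅ᴿ-trans } }

  module _ (initial : StrictInitial) where
    open StrictInitial initial

    emptyRule : Rule
    emptyRule = record
      { out = id {∅} ; inp = id {∅} ; out-mono = id-mono ; inp-mono = id-mono }

  module _ (adhesive : Adhesive) where
    open Adhesive adhesive

    record MatchSpan (p₂ p₁ : Rule) : Set (o ⊔ ℓ ⊔ e) where
      field
        {M}     : Obj
        m₂      : M ⇒ Rule.I p₂
        m₁      : M ⇒ Rule.O p₁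
        m₂-mono : Mono m₂
        m₁-mono : Mono m₁

      open Pushout (pushout m₂ m₁ m₂-mono) public
        renaming (Q to N; i₁ to n₂; i₂ to n₁)

      n₂-mono : Mono n₂
      n₂-mono = pushout-i₂-mono adhesive m₁-mono (flip-pushout isPushout)

    -- An admissible match carries a witness of admissibility, which is ignored
    -- by MatchSetoid; pushout complements of monomorphisms in an adhesive
    -- category are unique up to isomorphism.
    record Match (p₂ p₁ : Rule) : Set (o ⊔ ℓ ⊔ e) where
      field
        span       : MatchSpan p₂ p₁
        complement : PushoutComplement (Rule.out p₁) (MatchSpan.n₁ span)
      open MatchSpan span public

    MatchSetoid : (p₂ p₁ : Rule) → Setoid (o ⊔ ℓ ⊔ e) (ℓ ⊔ e)
    MatchSetoid p₂ p₁ = record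
      { Carrier       = Match p₂ p₁
      ; _≈_           = λ s t → Σ[ φ ∈ M s ≅ M t ]
                          (m₂ t ∘ from φ ≈ m₂ s) × (m₁ t ∘ from φ ≈ m₁ s)
      ; isEquivalence = record
        { refl  = ≅-refl , identityʳ , identityʳ
        ; sym   = λ (φ , p , q) → ≅-sym φ , invert φ p , invert φ q
        ; trans = λ (φ , p , q) (ψ , p′ , q′) → ≅-trans φ ψ ,
                  Equiv.trans (Equiv.sym assoc)
                    (Equiv.trans (∘-resp-≈ p′ Equiv.refl) p) ,
                  Equiv.trans (Equiv.sym assoc)
                    (Equiv.trans (∘-resp-≈ q′ Equiv.refl) q) } }
      where
      open Match
      open _≅_
      invert : ∀ {A B X} (φ : A ≅ B) {f : A ⇒ X} {g : B ⇒ X} →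
               g ∘ from φ ≈ f → f ∘ to φ ≈ g
      invert φ p = Equiv.trans (∘-resp-≈ (Equiv.sym p) Equiv.refl)
        (Equiv.trans assoc
          (Equiv.trans (∘-resp-≈ Equiv.refl (isoʳ φ)) identityʳ))

    -- The sums in the product of the rule algebra range over these sets.  They
    -- are not finite in every finitary category: for an infinite group G, the
    -- free G-sets with finitely many orbits form a finitary adhesive category in
    -- which the spans G ← G → G fall into infinitely many isomorphism classes.
    FiniteMatches : Set (o ⊔ ℓ ⊔ e)
    FiniteMatches = ∀ p₂ p₁ → Finite (MatchSetoid p₂ p₁)

    module _ (fpcs : HasMonoFPCs) where
      open HasMonoFPCs fpcs

      composite : (p₂ p₁ : Rule) → Match p₂ p₁ → Rule
      composite p₂ p₁ m = record
        { out      = o₂′ ∘ i₂″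
        ; inp      = i₁′ ∘ o₁″
        ; out-mono = ∘-mono
            (pushout-i₂-mono adhesive p₂.out-mono (Pushout.isPushout O₂₁-pushout))
            (pullback-p₁-mono (Pullback.isPullback K₂₁-pullback) o₁′-mono)
        ; inp-mono = ∘-mono
            (pushout-i₂-mono adhesive p₁.inp-mono (Pushout.isPushout I₂₁-pushout))
            (pullback-p₁-mono (flip-pullback (Pullback.isPullback K₂₁-pullback))
              (d-mono m.n₂-mono p₂.inp-mono)) }
        where
        module p₁ = Rule p₁
        module p₂ = Rule p₂
        module m  = Match m
        open PushoutComplement m.complement
          using () renaming (g to k₁; i₂ to o₁′; isPushout to K̄₁-isPushout)
        open FPC (fpc m.n₂ p₂.inp m.n₂-mono p₂.inp-mono)
          using () renaming (d to i₂′; b to k₂)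
        O₂₁-pushout = pushout p₂.out k₂ p₂.out-mono
        I₂₁-pushout = pushout p₁.inp k₁ p₁.inp-mono
        K₂₁-pullback = pullback i₂′ o₁′
        open Pushout O₂₁-pushout using () renaming (i₂ to o₂′)
        open Pushout I₂₁-pushout using () renaming (i₂ to i₁′)
        open Pullback K₂₁-pullback using () renaming (p₁ to i₂″; p₂ to o₁″)
        o₁′-mono : Mono o₁′
        o₁′-mono = pushout-i₂-mono adhesive p₁.out-mono K̄₁-isPushout

module RuleAlgebra {o ℓ e c r} (C : Category o ℓ e) (R : CommutativeRing c r) where
  open CategoryNotions C
  open Rules C
  open FreeModule R Lin

  ruleModule : Module R (o ⊔ ℓ ⊔ e ⊔ c) (o ⊔ ℓ ⊔ e ⊔ c ⊔ r)
  ruleModule = freeModule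

  open CommutativeMonoidSum (Module.+ᴹ-commutativeMonoid ruleModule) using (sum)

  product : (adhesive : Adhesive) → HasMonoFPCs → FiniteMatches adhesive →
            Op₂ Combination
  product adhesive fpcs finite = bilinearExtension λ p₂ p₁ →
    sum λ k → δ (composite adhesive fpcs p₂ p₁ (Finite.element (finite p₂ p₁) k))

  R∅ : StrictInitial → Combination
  R∅ initial = δ (emptyRule initial)

{-# OPTIONS --safe #-}

-- In an adhesive category unions of subobjects are computed by pushouts and are
-- stable under pullback, so all squares of monomorphisms can be handled in the
-- distributive lattices of subobjects: a pushout complement of O in X is a
-- subobject that covers X together with O and meets it in K, and an FPC is a
-- Heyting implication.
--
-- A match is the same as a jointly covering cospan I₂ → X ← O₁ that admits a
-- complement of K₁.  Both bracketings of a triple composition amount to the same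
-- "chain": objects X₁ ⊇ O₁, I₂ and X₂ ⊇ O₂, I₃, glued along the FPC W of I₂ ⊇ K₂,
-- such that O₁ has a complement V in X₁ and X₁ = O₁ ∪ I₂ ∪ (W ∩ I₃).  Its result is
-- O₃ +_{K₃} W₃ ← W₃ ∩ W ∩ V → I₁ +_{K₁} V.  For p₃ ∘ (p₂ ∘ p₁) the cospans are
-- recovered as O₁ ∪ I₂ in X₁ and I₃ ∪ (O₂ ∪ D) in X₂, where D = W ∩ (O₁ ∪ I₂); for
-- (p₃ ∘ p₂) ∘ p₁ they are O₂ ∪ I₃ in X₂ and (I₂ ∪ (W ∩ (O₂ ∪ I₃))) ∪ O₁ in X₁.
module Submission where

open import Defs
open import Level using (_⊔_; Lift; lift; lower)
open import Algebra.Bundles using (CommutativeMonoid; CommutativeRing)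
open import Algebra.Module.Bundles using (Module)
import Algebra.Properties.CommutativeMonoid.Sum as CommutativeMonoidSum
import Algebra.Properties.CommutativeSemigroup as CommutativeSemigroupProperties
open import Axiom.ExcludedMiddle using (ExcludedMiddle)
open import Data.Fin.Base using (Fin; zero; suc)
open import Data.List.Base
  using (List; []; _∷_; _++_; concat; concatMap; deduplicate; length; lookup; map; tabulate)
open import Data.List.Properties using (++-assoc; ++-identityʳ; concatMap-++; map-++)
open import Data.List.Membership.Setoid.Properties using (∈-deduplicate⁺)
open import Data.List.Membership.Propositional.Properties using (∈-lookup)
open import Data.List.Relation.Unary.All as All using (All; []; _∷_)
open import Data.List.Relation.Unary.All.Properties as All using (─⁺)
open import Data.List.Relation.Unary.AllPairs using (AllPairs; []; _∷_)
import Data.List.Relation.Unary.AllPairs.Properties as AllPairs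
open import Data.List.Relation.Unary.Any using (Any; here; there; index; tail; _─_)
open import Data.List.Relation.Unary.Any.Properties as Any using (lookup-index)
open import Data.List.Relation.Unary.Unique.DecSetoid.Properties using (deduplicate-!)
open import Data.Nat.Base using (ℕ)
open import Data.Product.Base using (Σ-syntax; ∃-syntax; _×_; _,_; proj₁; proj₂)
open import Data.Sum.Base using (_⊎_; inj₁; inj₂)
open import Function.Bundles using (Inverse; Equivalence)
open import Relation.Binary.Bundles using (DecSetoid; Setoid)
open import Relation.Binary.PropositionalEquality as ≡ using (_≡_)
import Relation.Binary.Reasoning.Setoid as SetoidReasoning
open import Relation.Nullary.Decidable using (Dec; yes; no; map′)
open import Relation.Nullary.Negation using (¬_; contradiction)

-- The obstacle to associativity is bookkeeping: the second match ranges over a set that depends on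
-- the first, the two bracketings choose different pushouts and FPCs, and nothing decides
-- isomorphism of rules. So no bijection between the two index sets is written down. Each bracketing
-- is shown to enumerate the setoid of chains, with pairwise inequivalent entries and without
-- omission, and a chain determines its resulting rule up to isomorphism; the two sums then agree by
-- a general fact on enumerations.
--
-- Inequivalence is tested through overlaps. A match is the intersection of the two legs of its
-- cospan, so it is known once it is known which points of the legs coincide, and this can be
-- compared between cospans with different apexes.
--
-- The bracketings are not mirror images. On the right, `W` can be glued from the complements of the
-- two compositions. On the left, the second composition only has an FPC along the larger object
-- `I₂ ∪ V`, so the FPCs along `I₂` and `I₃` have to be taken afresh and related to it; this is
-- where existence of FPCs enters the comparison.

-- Linear and bilinear extension on a free module

module FreeAlgebra {c r} (R : CommutativeRing c r) {a ℓ} (S : Setoid a ℓ) where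
  open FreeModule R S
  open Module freeModule
    using (≈ᴹ-setoid; ≈ᴹ-refl; +ᴹ-cong; +ᴹ-commutativeMonoid; +ᴹ-isAbelianGroup;
           *ₗ-cong; *ₗ-zeroˡ; *ₗ-distribʳ; *ₗ-identityˡ; *ₗ-assoc; *ₗ-distribˡ; *ₗ-comm)
  open SetoidReasoning ≈ᴹ-setoid
  private
    module R = CommutativeRing R
    module S = Setoid S
    module Interchange = CommutativeSemigroupProperties
      (CommutativeMonoid.commutativeSemigroup +ᴹ-commutativeMonoid)

  linear : (S.Carrier → Combination) → Combination → Combination
  linear f = concatMap λ (k , s) → k • f s

  linear-cong : ∀ {f} → (∀ {s t} → s S.≈ t → f s ∼ f t) →
                ∀ {xs ys} → xs ∼ ys → linear f xs ∼ linear f ys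
  linear-cong f-cong []                  = []
  linear-cong f-cong (cons p q t)        = +ᴹ-cong (*ₗ-cong p (f-cong q)) (linear-cong f-cong t)
  linear-cong {f} f-cong (swap (k , s) (l , t) xs) =
    Interchange.x∙yz≈y∙xz (k • f s) (l • f t) (linear f xs)
  linear-cong {f} f-cong (merge k l s xs) = begin
    k • f s ++ (l • f s ++ linear f xs) ≡⟨ ++-assoc (k • f s) (l • f s) _ ⟨
    (k • f s ++ l • f s) ++ linear f xs ≈⟨ +ᴹ-cong (*ₗ-distribʳ (f s) k l) ≈ᴹ-refl ⟨
    (k R.+ l) • f s ++ linear f xs      ∎
  linear-cong f-cong (drop s xs)         = +ᴹ-cong (*ₗ-zeroˡ _) ≈ᴹ-refl
  linear-cong f-cong (sym p)             = sym (linear-cong f-cong p)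
  linear-cong f-cong (trans p q)         = trans (linear-cong f-cong p) (linear-cong f-cong q)

  linear-ext : ∀ {f g} → (∀ s → f s ∼ g s) → ∀ xs → linear f xs ∼ linear g xs
  linear-ext h []             = []
  linear-ext h ((k , s) ∷ xs) = +ᴹ-cong (*ₗ-cong R.refl (h s)) (linear-ext h xs)

  linear-++ : ∀ f xs ys → linear f (xs ++ ys) ∼ linear f xs ++ linear f ys
  linear-++ f xs ys = Setoid.reflexive ≈ᴹ-setoid (concatMap-++ _ xs ys)

  linear-• : ∀ f k xs → linear f (k • xs) ∼ k • linear f xs
  linear-• f k []             = []
  linear-• f k ((l , s) ∷ xs) = begin
    (k R.* l) • f s ++ linear f (k • xs) ≈⟨ +ᴹ-cong (*ₗ-assoc k l (f s)) (linear-• f k xs) ⟩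
    k • (l • f s) ++ k • linear f xs     ≈⟨ *ₗ-distribˡ k (l • f s) (linear f xs) ⟨
    k • (l • f s ++ linear f xs)         ∎

  linear-∘ : ∀ (f g : S.Carrier → Combination) xs → linear f (linear g xs) ∼ linear (λ s → linear f (g s)) xs
  linear-∘ f g []             = []
  linear-∘ f g ((k , s) ∷ xs) = begin
    linear f (k • g s ++ linear g xs)               ≈⟨ linear-++ f (k • g s) (linear g xs) ⟩
    linear f (k • g s) ++ linear f (linear g xs)    ≈⟨ +ᴹ-cong (linear-• f k (g s)) (linear-∘ f g xs) ⟩
    k • linear f (g s) ++ linear (λ t → linear f (g t)) xs ∎

  linear-δ : ∀ f s → linear f (δ s) ∼ f s
  linear-δ f s = begin
    R.1# • f s ++ [] ≡⟨ ++-identityʳ _ ⟩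
    R.1# • f s       ≈⟨ *ₗ-identityˡ (f s) ⟩
    f s              ∎

  linear-δ-id : ∀ xs → linear δ xs ∼ xs
  linear-δ-id []             = []
  linear-δ-id ((k , s) ∷ xs) = cons (R.*-identityʳ k) S.refl (linear-δ-id xs)

  linear-+ : ∀ (f g : S.Carrier → Combination) xs → linear (λ s → f s ++ g s) xs ∼ linear f xs ++ linear g xs
  linear-+ f g []             = []
  linear-+ f g ((k , s) ∷ xs) = begin
    k • (f s ++ g s) ++ linear (λ t → f t ++ g t) xs          ≈⟨ +ᴹ-cong (*ₗ-distribˡ k (f s) (g s)) (linear-+ f g xs) ⟩
    (k • f s ++ k • g s) ++ (linear f xs ++ linear g xs)      ≈⟨ Interchange.interchange (k • f s) (k • g s) _ _ ⟩
    (k • f s ++ linear f xs) ++ (k • g s ++ linear g xs)      ∎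

  •-linear : ∀ k f xs → linear (λ s → k • f s) xs ∼ k • linear f xs
  •-linear k f []             = []
  •-linear k f ((l , s) ∷ xs) = begin
    l • (k • f s) ++ linear (λ t → k • f t) xs ≈⟨ +ᴹ-cong (*ₗ-comm l k (f s)) (•-linear k f xs) ⟩
    k • (l • f s) ++ k • linear f xs           ≈⟨ *ₗ-distribˡ k (l • f s) _ ⟨
    k • (l • f s ++ linear f xs)               ∎

  linear-0 : ∀ xs → linear (λ _ → []) xs ∼ []
  linear-0 []       = []
  linear-0 (_ ∷ xs) = linear-0 xs

  linear-comm : ∀ (h : S.Carrier → S.Carrier → Combination) xs ys →
    linear (λ s → linear (h s) ys) xs ∼ linear (λ t → linear (λ s → h s t) xs) ys
  linear-comm h []             ys = sym (linear-0 ys)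
  linear-comm h ((k , s) ∷ xs) ys = begin
    k • linear (h s) ys ++ linear (λ s → linear (h s) ys) xs
      ≈⟨ +ᴹ-cong (sym (•-linear k (h s) ys)) (linear-comm h xs ys) ⟩
    linear (λ t → k • h s t) ys ++ linear (λ t → linear (λ s → h s t) xs) ys
      ≈⟨ linear-+ (λ t → k • h s t) (λ t → linear (λ s → h s t) xs) ys ⟨
    linear (λ t → k • h s t ++ linear (λ s → h s t) xs) ys ∎

  module _ (_·_ : S.Carrier → S.Carrier → Combination) where
    private
      _⊙_ : Combination → Combination → Combination
      _⊙_ = bilinearExtension _·_

    -- Splitting each coefficient `k R.* l` into two successive scalings turns the bilinear
    -- extension into nested linear ones, so congruence, associativity and the unit laws reduce to
    -- facts about `linear`.
    bilinear : ∀ xs ys → xs ⊙ ys ∼ linear (λ s → linear (s ·_) ys) xs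
    bilinear []             ys = []
    bilinear ((k , s) ∷ xs) ys = +ᴹ-cong (scale ys) (bilinear xs ys)
      where
      scale : ∀ ys → concatMap (λ (l , t) → (k R.* l) • (s · t)) ys ∼ k • linear (s ·_) ys
      scale []             = []
      scale ((l , t) ∷ ys) = trans (+ᴹ-cong (*ₗ-assoc k l (s · t)) (scale ys))
        (sym (*ₗ-distribˡ k (l • (s · t)) (linear (s ·_) ys)))

    module _ (·-cong : ∀ {s s′ t t′} → s S.≈ s′ → t S.≈ t′ → s · t ∼ s′ · t′)
             (u : S.Carrier) (·-identityˡ : ∀ s → u · s ∼ δ s) (·-identityʳ : ∀ s → s · u ∼ δ s)
             (·-assoc : ∀ s t v → linear (_· v) (s · t) ∼ linear (s ·_) (t · v)) where

      ⊙-cong : ∀ {xs xs′ ys ys′} → xs ∼ xs′ → ys ∼ ys′ → xs ⊙ ys ∼ xs′ ⊙ ys′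
      ⊙-cong {xs} {xs′} {ys} {ys′} p q = begin
        xs ⊙ ys                                  ≈⟨ bilinear xs ys ⟩
        linear (λ s → linear (s ·_) ys) xs       ≈⟨ linear-ext (λ s → linear-cong (·-cong S.refl) q) xs ⟩
        linear (λ s → linear (s ·_) ys′) xs      ≈⟨ linear-cong (λ e → linear-ext (λ t → ·-cong e S.refl) ys′) p ⟩
        linear (λ s → linear (s ·_) ys′) xs′     ≈⟨ bilinear xs′ ys′ ⟨
        xs′ ⊙ ys′                                ∎

      ⊙-assoc : ∀ xs ys zs → (xs ⊙ ys) ⊙ zs ∼ xs ⊙ (ys ⊙ zs)
      ⊙-assoc xs ys zs = begin
        (xs ⊙ ys) ⊙ zs
          ≈⟨ bilinear (xs ⊙ ys) zs ⟩
        linear (λ w → linear (w ·_) zs) (xs ⊙ ys)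
          ≈⟨ linear-cong (λ e → linear-ext (λ v → ·-cong e S.refl) zs) (bilinear xs ys) ⟩
        linear (λ w → linear (w ·_) zs) (linear (λ s → linear (s ·_) ys) xs)
          ≈⟨ linear-∘ _ _ xs ⟩
        linear (λ s → linear (λ w → linear (w ·_) zs) (linear (s ·_) ys)) xs
          ≈⟨ linear-ext inner xs ⟩
        linear (λ s → linear (s ·_) (linear (λ t → linear (t ·_) zs) ys)) xs
          ≈⟨ linear-ext (λ s → linear-cong (·-cong S.refl) (bilinear ys zs)) xs ⟨
        linear (λ s → linear (s ·_) (ys ⊙ zs)) xs
          ≈⟨ bilinear xs (ys ⊙ zs) ⟨
        xs ⊙ (ys ⊙ zs) ∎
        where
        inner : ∀ s → linear (λ w → linear (w ·_) zs) (linear (s ·_) ys) ∼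
                      linear (s ·_) (linear (λ t → linear (t ·_) zs) ys)
        inner s = begin
          linear (λ w → linear (w ·_) zs) (linear (s ·_) ys)
            ≈⟨ linear-∘ _ _ ys ⟩
          linear (λ t → linear (λ w → linear (w ·_) zs) (s · t)) ys
            -- With the sum over `zs` moved outside, the expansion of `s · t` is multiplied by a
            -- single basis vector, which is the form in which `·-assoc` applies.
            ≈⟨ linear-ext (λ t → linear-comm _·_ (s · t) zs) ys ⟩
          linear (λ t → linear (λ v → linear (_· v) (s · t)) zs) ys
            ≈⟨ linear-ext (λ t → linear-ext (·-assoc s t) zs) ys ⟩
          linear (λ t → linear (λ v → linear (s ·_) (t · v)) zs) ys
            ≈⟨ linear-ext (λ t → linear-∘ (s ·_) (t ·_) zs) ys ⟨
          linear (λ t → linear (s ·_) (linear (t ·_) zs)) ys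
            ≈⟨ linear-∘ _ _ ys ⟨
          linear (s ·_) (linear (λ t → linear (t ·_) zs) ys) ∎

      ⊙-identityˡ : ∀ xs → δ u ⊙ xs ∼ xs
      ⊙-identityˡ xs = begin
        δ u ⊙ xs                               ≈⟨ bilinear (δ u) xs ⟩
        linear (λ s → linear (s ·_) xs) (δ u)  ≈⟨ linear-δ (λ s → linear (s ·_) xs) u ⟩
        linear (u ·_) xs                       ≈⟨ linear-ext ·-identityˡ xs ⟩
        linear δ xs                            ≈⟨ linear-δ-id xs ⟩
        xs                                     ∎

      ⊙-identityʳ : ∀ xs → xs ⊙ δ u ∼ xs
      ⊙-identityʳ xs = begin
        xs ⊙ δ u                               ≈⟨ bilinear xs (δ u) ⟩
        linear (λ s → linear (s ·_) (δ u)) xs  ≈⟨ linear-ext (λ s → linear-δ (s ·_) u) xs ⟩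
        linear (_· u) xs                       ≈⟨ linear-ext ·-identityʳ xs ⟩
        linear δ xs                            ≈⟨ linear-δ-id xs ⟩
        xs                                     ∎

      ⊙-distribˡ : ∀ xs ys zs → xs ⊙ (ys ++ zs) ∼ xs ⊙ ys ++ xs ⊙ zs
      ⊙-distribˡ xs ys zs = begin
        xs ⊙ (ys ++ zs)                                      ≈⟨ bilinear xs (ys ++ zs) ⟩
        linear (λ s → linear (s ·_) (ys ++ zs)) xs           ≈⟨ linear-ext (λ s → linear-++ (s ·_) ys zs) xs ⟩
        linear (λ s → linear (s ·_) ys ++ linear (s ·_) zs) xs ≈⟨ linear-+ _ _ xs ⟩
        linear (λ s → linear (s ·_) ys) xs ++ linear (λ s → linear (s ·_) zs) xs
                                                             ≈⟨ +ᴹ-cong (bilinear xs ys) (bilinear xs zs) ⟨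
        xs ⊙ ys ++ xs ⊙ zs                                   ∎

      ⊙-distribʳ : ∀ xs ys zs → (ys ++ zs) ⊙ xs ∼ ys ⊙ xs ++ zs ⊙ xs
      ⊙-distribʳ xs ys zs = Setoid.reflexive ≈ᴹ-setoid (concatMap-++ _ ys zs)

      •-⊙ : ∀ k xs ys → (k • xs) ⊙ ys ∼ k • (xs ⊙ ys)
      •-⊙ k xs ys = begin
        (k • xs) ⊙ ys                               ≈⟨ bilinear (k • xs) ys ⟩
        linear (λ s → linear (s ·_) ys) (k • xs)    ≈⟨ linear-• _ k xs ⟩
        k • linear (λ s → linear (s ·_) ys) xs      ≈⟨ *ₗ-cong R.refl (bilinear xs ys) ⟨
        k • (xs ⊙ ys)                               ∎

      ⊙-• : ∀ k xs ys → xs ⊙ (k • ys) ∼ k • (xs ⊙ ys)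
      ⊙-• k xs ys = begin
        xs ⊙ (k • ys)                               ≈⟨ bilinear xs (k • ys) ⟩
        linear (λ s → linear (s ·_) (k • ys)) xs    ≈⟨ linear-ext (λ s → linear-• (s ·_) k ys) xs ⟩
        linear (λ s → k • linear (s ·_) ys) xs      ≈⟨ •-linear k _ xs ⟩
        k • linear (λ s → linear (s ·_) ys) xs      ≈⟨ *ₗ-cong R.refl (bilinear xs ys) ⟨
        k • (xs ⊙ ys)                               ∎

      isAssociativeUnitalAlgebra : IsAssociativeUnitalAlgebra freeModule _⊙_ (δ u)
      isAssociativeUnitalAlgebra = record
        { isRing     = record
          { +-isAbelianGroup = +ᴹ-isAbelianGroup
          ; *-cong           = ⊙-cong
          ; *-assoc          = ⊙-assoc
          ; *-identity       = ⊙-identityˡ , ⊙-identityʳ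
          ; distrib          = ⊙-distribˡ , ⊙-distribʳ }
        ; *ₗ-·-left  = •-⊙
        ; *ₗ-·-right = ⊙-• }

-- Sums over finite enumerations of a setoid

module Enumerations {c r a ℓ t ℓt v} (R : CommutativeRing c r) (S : Setoid a ℓ)
  (T : Setoid t ℓt) (Value : Setoid.Carrier T → Setoid.Carrier S → Set v)
  (value-unique : ∀ x y {s s′} → Setoid._≈_ T x y → Value x s → Value y s′ → Setoid._≈_ S s s′)
  where
  open FreeModule R S
  open Module freeModule using (≈ᴹ-refl; +ᴹ-cong; +ᴹ-commutativeMonoid)
  open CommutativeMonoidSum +ᴹ-commutativeMonoid using (sum)
  private
    module R = CommutativeRing R
    module S = Setoid S
    module T = Setoid T

  -- The value is attached by a relation rather than computed by a function: for the same chain the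
  -- two bracketings produce different, merely isomorphic rules, and an item records the one
  -- actually produced.
  Item : Set _
  Item = Σ[ x ∈ T.Carrier ] Σ[ s ∈ S.Carrier ] Value x s

  infix 4 _≉_ _∈ᴵ_
  _≉_ : Item → Item → Set _
  x ≉ y = ¬ proj₁ x T.≈ proj₁ y

  _∈ᴵ_ : T.Carrier → List Item → Set _
  z ∈ᴵ xs = Any (λ x → z T.≈ proj₁ x) xs

  value : Item → S.Carrier
  value x = proj₁ (proj₂ x)

  total : List Item → Combination
  total = map λ x → R.1# , value x

  private
    total-remove : ∀ x {ys} (p : proj₁ x ∈ᴵ ys) → total ys ∼ δ (value x) ++ total (ys ─ p)
    total-remove x {y ∷ ys} (here e) =
      cons R.refl (S.sym (value-unique (proj₁ x) (proj₁ y) e (proj₂ (proj₂ x)) (proj₂ (proj₂ y)))) ≈ᴹ-refl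
    total-remove x {y ∷ ys} (there p) =
      trans (cons R.refl S.refl (total-remove x p)) (swap _ _ _)

    remove-distinct : ∀ {z ys} (p : z ∈ᴵ ys) → AllPairs _≉_ ys → AllPairs _≉_ (ys ─ p)
    remove-distinct (here _)  (_ ∷ ds) = ds
    remove-distinct (there p) (d ∷ ds) = ─⁺ p d ∷ remove-distinct p ds

    ∈-remove : ∀ {z w ys} (p : w ∈ᴵ ys) → z ∈ᴵ ys → ¬ z T.≈ w → z ∈ᴵ (ys ─ p)
    ∈-remove (here e)  (here e′) n = contradiction (T.trans e′ (T.sym e)) n
    ∈-remove (here _)  (there q) n = q
    ∈-remove (there p) (here e)  n = here e
    ∈-remove (there p) (there q) n = there (∈-remove p q n)

    remove-∈ : ∀ {z w ys} (p : w ∈ᴵ ys) → z ∈ᴵ (ys ─ p) → z ∈ᴵ ys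
    remove-∈ (here _)  q         = there q
    remove-∈ (there p) (here e)  = here e
    remove-∈ (there p) (there q) = there (remove-∈ p q)

    absent : ∀ {z} {y : Item} {ys} → All (y ≉_) ys → z ∈ᴵ ys → ¬ proj₁ y T.≈ z
    absent (d ∷ ds) (here e)  e′ = d (T.trans e′ e)
    absent {y = y} (d ∷ ds) (there p) e′ = absent {y = y} ds p e′

    removed : ∀ {z w ys} (p : w ∈ᴵ ys) → AllPairs _≉_ ys → z ∈ᴵ (ys ─ p) → ¬ z T.≈ w
    removed {ys = y ∷ _} (here e)  (d ∷ ds) q         e′ = absent {y = y} d q (T.sym (T.trans e′ e))
    removed {ys = y ∷ _} (there p) (d ∷ ds) (here e)  e′ = absent {y = y} d p (T.trans (T.sym e) e′)
    removed (there p) (d ∷ ds) (there q) e′ = removed p ds q e′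

    -- Induction on `xs`: the head is located in `ys` and removed there, and distinctness ensures
    -- that the remainders still represent the same elements. Positions come from membership proofs,
    -- so equality in `T` is never decided.
    total-unique : ∀ xs ys → AllPairs _≉_ xs → AllPairs _≉_ ys →
                   (∀ {z} → z ∈ᴵ xs → z ∈ᴵ ys) → (∀ {z} → z ∈ᴵ ys → z ∈ᴵ xs) →
                   total xs ∼ total ys
    total-unique []       []       _        _  _ _ = []
    total-unique []       (y ∷ ys) _        _  _ g with () ← g (here T.refl)
    total-unique (x ∷ xs) ys       (d ∷ ds) es f g =
      trans (+ᴹ-cong ≈ᴹ-refl (total-unique xs (ys ─ p) ds (remove-distinct p es)
              (λ q → ∈-remove p (f (there q)) λ e → absent {y = x} d q (T.sym e))
              (λ q → tail (removed p es q) (g (remove-∈ p q)))))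
            (sym (total-remove x p))
      where
      p = f (here T.refl)

  IsEnumeration : List Item → Set _
  IsEnumeration xs = AllPairs _≉_ xs × (∀ z → z ∈ᴵ xs)

  enumeration-total : ∀ {xs ys} → IsEnumeration xs → IsEnumeration ys → total xs ∼ total ys
  enumeration-total {xs} {ys} (ds , f) (es , g) =
    total-unique xs ys ds es (λ {z} _ → g z) (λ {z} _ → f z)

  [-]-enumeration : ∀ x → (∀ z → z T.≈ proj₁ x) → IsEnumeration (x ∷ [])
  [-]-enumeration x f = ([] ∷ []) , λ z → here (f z)

  tabulate-enumeration : ∀ {n} (item : Fin n → Item) →
    (∀ {i j} → proj₁ (item i) T.≈ proj₁ (item j) → i ≡ j) →
    (∀ z → ∃[ i ] z T.≈ proj₁ (item i)) → IsEnumeration (tabulate item)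
  tabulate-enumeration item inj surj =
    AllPairs.tabulate⁺ (λ i≢j e → i≢j (inj e)) ,
    λ z → let i , e = surj z in Any.tabulate⁺ i e

  -- The inner range varies with the outer index, as the second match is a match of the composite
  -- formed first. Injectivity is split accordingly: equivalent items lie in the same block, and
  -- within a block at the same place.
  concat-enumeration : ∀ {n} {m : Fin n → ℕ} (item : ∀ i → Fin (m i) → Item) →
    (∀ {i i′ j j′} → proj₁ (item i j) T.≈ proj₁ (item i′ j′) → i ≡ i′) →
    (∀ {i j j′} → proj₁ (item i j) T.≈ proj₁ (item i j′) → j ≡ j′) →
    (∀ z → ∃[ i ] ∃[ j ] z T.≈ proj₁ (item i j)) →
    IsEnumeration (concat (tabulate λ i → tabulate (item i)))
  concat-enumeration item outer inner surj =
    AllPairs.concat⁺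
      (All.tabulate⁺ λ i → AllPairs.tabulate⁺ λ j≢j′ e → j≢j′ (inner e))
      (AllPairs.tabulate⁺ λ i≢i′ → All.tabulate⁺ λ j → All.tabulate⁺ λ j′ e → i≢i′ (outer e)) ,
    λ z → let i , j , e = surj z in Any.concat⁺ (Any.tabulate⁺ i (Any.tabulate⁺ j e))

  total-tabulate : ∀ {n} (item : Fin n → Item) →
                   total (tabulate item) ≡ sum (λ i → δ (value (item i)))
  total-tabulate {ℕ.zero}  item = ≡.refl
  total-tabulate {ℕ.suc n} item = ≡.cong (δ (value (item zero)) ++_) (total-tabulate λ i → item (suc i))

  total-concat : ∀ {n} (xs : Fin n → List Item) →
                 total (concat (tabulate xs)) ≡ sum (λ i → total (xs i))
  total-concat {ℕ.zero}  xs = ≡.refl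
  total-concat {ℕ.suc n} xs = ≡.trans (map-++ _ (xs zero) _)
    (≡.cong (total (xs zero) ++_) (total-concat λ i → xs (suc i)))

-- Finite setoids from complete lists

module _ {a ℓ} (S : Setoid a ℓ) where
  private module S = Setoid S

  lookup-injective : ∀ {xs} → AllPairs (λ x y → ¬ x S.≈ y) xs →
                     ∀ i j → lookup xs i S.≈ lookup xs j → i ≡ j
  lookup-injective (_ ∷ _)  zero    zero    _ = ≡.refl
  lookup-injective (d ∷ _)  zero    (suc j) e = contradiction e (All.lookup d (∈-lookup j))
  lookup-injective (d ∷ _)  (suc i) zero    e = contradiction (S.sym e) (All.lookup d (∈-lookup i))
  lookup-injective (_ ∷ ds) (suc i) (suc j) e = ≡.cong suc (lookup-injective ds i j e)

  listing⇒finite : (∀ x y → Dec (x S.≈ y)) → (xs : List S.Carrier) →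
                   (∀ x → Any (x S.≈_) xs) → Finite S
  listing⇒finite _≟_ xs complete = record
    { size        = length ys
    ; enumeration = record
      { to        = lookup ys
      ; from      = λ x → index (member x)
      ; to-cong   = λ p → S.reflexive (≡.cong (lookup ys) p)
      ; from-cong = λ {x} {y} p → injective _ _
          (S.trans (S.sym (located x)) (S.trans p (located y)))
      ; inverse   = (λ { {x} ≡.refl → S.sym (located x) }) ,
                    (λ {i} {x} p → injective _ _ (S.trans (S.sym (located x)) p)) } }
    where
    decSetoid : DecSetoid _ _
    decSetoid = record
      { isDecEquivalence = record { isEquivalence = S.isEquivalence ; _≟_ = _≟_ } }
    ys = deduplicate _≟_ xs
    member : ∀ x → Any (x S.≈_) ys
    member x = ∈-deduplicate⁺ S _≟_ (λ p q → S.trans q (S.sym p)) (complete x)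
    located : ∀ x → x S.≈ lookup ys (index (member x))
    located x = lookup-index (member x)
    injective : ∀ i j → lookup ys i S.≈ lookup ys j → i ≡ j
    injective = lookup-injective (deduplicate-! decSetoid xs)

module _ {a p} {A : Set a} {P : Set p} where
  whenTrue : Dec P → (P → List A) → List A
  whenTrue (yes p) f = f p
  whenTrue (no _)  f = []

  -- The premise ranges over all proofs of `P` because the list is built from the one stored in the
  -- decision, which may differ from the one at hand.
  whenTrue⁺ : ∀ {q} {Q : A → Set q} (d : Dec P) {f : P → List A} →
              P → (∀ p → Any Q (f p)) → Any Q (whenTrue d f)
  whenTrue⁺ (yes p) _ h = h p
  whenTrue⁺ (no ¬p) p h = contradiction p ¬p

module SqPORewriting {o ℓ e} (C : Category o ℓ e)
                     (adhesive : CategoryNotions.Adhesive C) where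
  open Category C
  open CategoryNotions C
  open Adhesive adhesive
  open Rules C

  -- Morphisms, monomorphisms and pushout squares

  module Morphisms where
    private
      variable
        A B D E X Y Z : Obj

    infixr 5 _∙_
    infix  8 _⁻¹
    infixr 7 _◂_
    infixl 7 _▸_

    _∙_ : {f g h : A ⇒ B} → f ≈ g → g ≈ h → f ≈ h
    _∙_ = Equiv.trans

    _⁻¹ : {f g : A ⇒ B} → f ≈ g → g ≈ f
    _⁻¹ = Equiv.sym

    _◂_ : (f : B ⇒ D) {g h : A ⇒ B} → g ≈ h → f ∘ g ≈ f ∘ h
    f ◂ p = ∘-resp-≈ Equiv.refl p

    _▸_ : {f g : B ⇒ D} → f ≈ g → (h : A ⇒ B) → f ∘ h ≈ g ∘ h
    p ▸ h = ∘-resp-≈ p Equiv.refl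

    pullˡ : {f : A ⇒ B} {g : B ⇒ D} {h : D ⇒ E} {k : B ⇒ E} →
            h ∘ g ≈ k → h ∘ (g ∘ f) ≈ k ∘ f
    pullˡ {f = f} p = assoc ⁻¹ ∙ p ▸ f

    pushˡ : {f : A ⇒ B} {g : B ⇒ D} {h : D ⇒ E} {k : B ⇒ E} →
            k ≈ h ∘ g → k ∘ f ≈ h ∘ (g ∘ f)
    pushˡ {f = f} p = p ▸ f ∙ assoc

    extend : {f : X ⇒ A} {g : A ⇒ B} {h : B ⇒ D} {g′ : A ⇒ E} {h′ : E ⇒ D} →
             h ∘ g ≈ h′ ∘ g′ → h ∘ (g ∘ f) ≈ h′ ∘ (g′ ∘ f)
    extend p = pullˡ p ∙ assoc

    cancelˡ : {f : A ⇒ B} {g : B ⇒ D} {h : D ⇒ B} → h ∘ g ≈ id → h ∘ (g ∘ f) ≈ f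
    cancelˡ p = pullˡ p ∙ identityˡ

    mono-factor : {f : B ⇒ D} {g : A ⇒ B} {h : A ⇒ D} → f ∘ g ≈ h → Mono h → Mono g
    mono-factor {f = f} p mh u v q = mh u v (pushˡ (p ⁻¹) ∙ f ◂ q ∙ pullˡ p)

    infix 4 _∈_
    -- Generalized elements: lattice arguments on subobjects are carried out on points `x`, with the
    -- factorization kept as data.
    _∈_ : Z ⇒ X → A ⇒ X → Set (ℓ ⊔ e)
    _∈_ {Z} {X} {A} x a = Σ[ y ∈ Z ⇒ A ] a ∘ y ≈ x

    ∈-resp : {x x′ : Z ⇒ X} {a : A ⇒ X} → x ≈ x′ → x ∈ a → x′ ∈ a
    ∈-resp p (y , q) = y , q ∙ p

    iso-mono : (φ : A ≅ B) → Mono (_≅_.from φ)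
    iso-mono φ u v p = cancelˡ isoˡ ⁻¹ ∙ to ◂ p ∙ cancelˡ isoˡ
      where open _≅_ φ

    iso-to-mono : (φ : A ≅ B) → Mono (_≅_.to φ)
    iso-to-mono φ = iso-mono (≅-sym φ)

    -- A section of a monomorphism is a two-sided inverse. Hence a subobject is everything as soon
    -- as the identity, the generic point, lies in it.
    mono-∈⇒iso : {f : A ⇒ B} → Mono f → id ∈ f → IsIso f
    mono-∈⇒iso {f = f} mf (s , p) = record
      { inv  = s
      ; isoˡ = mf _ _ (cancelˡ p ∙ identityʳ ⁻¹)
      ; isoʳ = p }

    toIso : {f : A ⇒ B} → Mono f → id ∈ f → A ≅ B
    toIso mf p = record { isIso = mono-∈⇒iso mf p }

    sub-iso : {f : A ⇒ X} {g : B ⇒ X} {u : A ⇒ B} {v : B ⇒ A} → Mono f → Mono g →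
              g ∘ u ≈ f → f ∘ v ≈ g → A ≅ B
    sub-iso {u = u} {v} mf mg p q = record
      { from  = u
      ; isIso = record
        { inv  = v
        ; isoˡ = mf _ _ (pullˡ q ∙ p ∙ identityʳ ⁻¹)
        ; isoʳ = mg _ _ (pullˡ p ∙ q ∙ identityʳ ⁻¹) } }

    flip-triangle : (φ : A ≅ B) {f : A ⇒ X} {g : B ⇒ X} →
                    g ∘ _≅_.from φ ≈ f → f ∘ _≅_.to φ ≈ g
    flip-triangle φ {f} {g} p =
      pushˡ (p ⁻¹) ∙ g ◂ isoʳ ∙ identityʳ
      where open _≅_ φ

    flip-cotriangle : (φ : A ≅ B) {f : X ⇒ A} {g : X ⇒ B} →
                      _≅_.from φ ∘ f ≈ g → _≅_.to φ ∘ g ≈ f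
    flip-cotriangle φ {f} {g} p = to ◂ p ⁻¹ ∙ cancelˡ isoˡ
      where open _≅_ φ

    flip-square : ∀ {A B A′ B′} (φ : A ≅ A′) (ψ : B ≅ B′) {f : A ⇒ B} {g : A′ ⇒ B′} →
                  _≅_.from ψ ∘ f ≈ g ∘ _≅_.from φ → _≅_.to ψ ∘ g ≈ f ∘ _≅_.to φ
    flip-square φ ψ p = flip-cotriangle ψ (assoc ⁻¹ ∙ flip-triangle φ (p ⁻¹))

    ∈-∘ : {x : Z ⇒ X} {a : A ⇒ X} {z : Y ⇒ Z} → x ∈ a → x ∘ z ∈ a
    ∈-∘ {z = z} (y , p) = y ∘ z , pullˡ p

    pullback-∈ : ∀ {P} {p₁ : P ⇒ X} {p₂ : P ⇒ Y} {f : X ⇒ Z} {g : Y ⇒ Z} {Q} →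
                 IsPullback p₁ p₂ f g → {a : Q ⇒ X} {b : Q ⇒ Y} → f ∘ a ≈ g ∘ b →
                 Σ[ s ∈ Q ⇒ P ] p₁ ∘ s ≈ a × p₂ ∘ s ≈ b
    pullback-∈ pb q = universal q , p₁∘universal≈h₁ , p₂∘universal≈h₂
      where open IsPullback pb

    pullback-p₂-mono : ∀ {P} {p₁ : P ⇒ X} {p₂ : P ⇒ Y} {f : X ⇒ Z} {g : Y ⇒ Z} →
                       IsPullback p₁ p₂ f g → Mono f → Mono p₂
    pullback-p₂-mono pb = pullback-p₁-mono (flip-pullback pb)

    pushout-unique : ∀ {Q R} {f : A ⇒ X} {g : A ⇒ Y} {i₁ : X ⇒ Q} {i₂ : Y ⇒ Q} →
                     IsPushout f g i₁ i₂ → {u v : Q ⇒ R} →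
                     u ∘ i₁ ≈ v ∘ i₁ → u ∘ i₂ ≈ v ∘ i₂ → u ≈ v
    pushout-unique po p q = IsPushout.unique po p q Equiv.refl Equiv.refl

    pushout-resp : ∀ {Q} {f f′ : A ⇒ X} {g g′ : A ⇒ Y} {i₁ i₁′ : X ⇒ Q} {i₂ i₂′ : Y ⇒ Q} →
                   f ≈ f′ → g ≈ g′ → i₁ ≈ i₁′ → i₂ ≈ i₂′ →
                   IsPushout f g i₁ i₂ → IsPushout f′ g′ i₁′ i₂′
    pushout-resp {f = f} {f′} {g} {g′} p q r s po = record
      { commute         = ∘-resp-≈ (r ⁻¹) (p ⁻¹) ∙ commute ∙ ∘-resp-≈ s q
      ; universal       = λ t → universal (adjust t)
      ; universal∘i₁≈h₁ = _ ◂ r ⁻¹ ∙ universal∘i₁≈h₁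
      ; universal∘i₂≈h₂ = _ ◂ s ⁻¹ ∙ universal∘i₂≈h₂
      ; unique          = λ a b c d →
          unique (_ ◂ r ∙ a) (_ ◂ s ∙ b) (_ ◂ r ∙ c) (_ ◂ s ∙ d) }
      where
      open IsPushout po
      adjust : ∀ {R} {h₁ : _ ⇒ R} {h₂ : _ ⇒ R} → h₁ ∘ f′ ≈ h₂ ∘ g′ → h₁ ∘ f ≈ h₂ ∘ g
      adjust {_} {h₁} {h₂} t = h₁ ◂ p ∙ t ∙ h₂ ◂ q ⁻¹

    -- A --f--> X --h--> X′
    -- |g       |        |
    -- Y ------> Q -----> Q′
    paste-pushout : ∀ {X′ Q Q′} {f : A ⇒ X} {g : A ⇒ Y} {i₁ : X ⇒ Q} {i₂ : Y ⇒ Q}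
                    {h : X ⇒ X′} {j₁ : X′ ⇒ Q′} {j₂ : Q ⇒ Q′} →
                    IsPushout f g i₁ i₂ → IsPushout h i₁ j₁ j₂ →
                    IsPushout (h ∘ f) g j₁ (j₂ ∘ i₂)
    paste-pushout {f = f} {g} {i₁} {i₂} {h} {j₁} {j₂} l r = record
      { commute         = extend r.commute ∙ j₂ ◂ l.commute ∙ assoc ⁻¹
      ; universal       = λ t → r.universal (inner t)
      ; universal∘i₁≈h₁ = r.universal∘i₁≈h₁
      ; universal∘i₂≈h₂ = pullˡ r.universal∘i₂≈h₂ ∙ l.universal∘i₂≈h₂
      ; unique          = λ a b c d → pushout-unique r (a ∙ c ⁻¹)
          (pushout-unique l
            (assoc ∙ _ ◂ r.commute ⁻¹ ∙ pullˡ (a ∙ c ⁻¹) ∙ assoc ∙ _ ◂ r.commute ∙ assoc ⁻¹)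
            (assoc ∙ b ∙ d ⁻¹ ∙ assoc ⁻¹)) }
      where
      module l = IsPushout l
      module r = IsPushout r
      inner : ∀ {R} {h₁ : _ ⇒ R} {h₂ : _ ⇒ R} (t : h₁ ∘ (h ∘ f) ≈ h₂ ∘ g) →
              h₁ ∘ h ≈ l.universal (assoc ∙ t) ∘ i₁
      inner t = l.universal∘i₁≈h₁ ⁻¹

    cancel-pushout : ∀ {X′ Q Q′} {f : A ⇒ X} {g : A ⇒ Y} {i₁ : X ⇒ Q} {i₂ : Y ⇒ Q}
                     {h : X ⇒ X′} {j₁ : X′ ⇒ Q′} {j₂ : Q ⇒ Q′} {k : Y ⇒ Q′} →
                     IsPushout f g i₁ i₂ → IsPushout (h ∘ f) g j₁ k →
                     j₁ ∘ h ≈ j₂ ∘ i₁ → j₂ ∘ i₂ ≈ k → IsPushout h i₁ j₁ j₂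
    cancel-pushout {f = f} {g} {i₁} {i₂} {h} {j₁} {j₂} l out p q = record
      { commute         = p
      ; universal       = λ t → out.universal (outer t)
      ; universal∘i₁≈h₁ = out.universal∘i₁≈h₁
      ; universal∘i₂≈h₂ = λ {_} {_} {_} {t} → pushout-unique l
          (assoc ∙ _ ◂ p ⁻¹ ∙ pullˡ out.universal∘i₁≈h₁ ∙ t)
          (assoc ∙ _ ◂ q ∙ out.universal∘i₂≈h₂)
      ; unique          = λ a b c d → pushout-unique out (a ∙ c ⁻¹)
          (_ ◂ q ⁻¹ ∙ pullˡ (b ∙ d ⁻¹) ∙ assoc ∙ _ ◂ q) }
      where
      module l = IsPushout l
      module out = IsPushout out
      outer : ∀ {R} {h₁ : _ ⇒ R} {h₂ : _ ⇒ R} → h₁ ∘ h ≈ h₂ ∘ i₁ →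
              h₁ ∘ (h ∘ f) ≈ (h₂ ∘ i₂) ∘ g
      outer t = extend t ∙ _ ◂ l.commute ∙ assoc ⁻¹

    pushout-iso : ∀ {A A′ X X′ Y Y′ Q Q′} {f : A ⇒ X} {g : A ⇒ Y} {i₁ : X ⇒ Q} {i₂ : Y ⇒ Q}
                  {f′ : A′ ⇒ X′} {g′ : A′ ⇒ Y′} {i₁′ : X′ ⇒ Q′} {i₂′ : Y′ ⇒ Q′} →
                  IsPushout f g i₁ i₂ → IsPushout f′ g′ i₁′ i₂′ →
                  (α : A ≅ A′) (β : X ≅ X′) (γ : Y ≅ Y′) →
                  _≅_.from β ∘ f ≈ f′ ∘ _≅_.from α →
                  _≅_.from γ ∘ g ≈ g′ ∘ _≅_.from α →
                  Σ[ δ ∈ Q ≅ Q′ ] _≅_.from δ ∘ i₁ ≈ i₁′ ∘ _≅_.from β ×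
                                  _≅_.from δ ∘ i₂ ≈ i₂′ ∘ _≅_.from γ
    pushout-iso {f = f} {g} {i₁} {i₂} {f′} {g′} {i₁′} {i₂′} po po′ α β γ p q =
      record
        { from  = to-Q′
        ; isIso = record
          { inv  = to-Q
          ; isoˡ = pushout-unique po
              (assoc ∙ to-Q ◂ po.universal∘i₁≈h₁ ∙ pullˡ po′.universal∘i₁≈h₁ ∙ assoc ∙
                i₁ ◂ β.isoˡ ∙ identityʳ ∙ identityˡ ⁻¹)
              (assoc ∙ to-Q ◂ po.universal∘i₂≈h₂ ∙ pullˡ po′.universal∘i₂≈h₂ ∙ assoc ∙
                i₂ ◂ γ.isoˡ ∙ identityʳ ∙ identityˡ ⁻¹)
          ; isoʳ = pushout-unique po′
              (assoc ∙ to-Q′ ◂ po′.universal∘i₁≈h₁ ∙ pullˡ po.universal∘i₁≈h₁ ∙ assoc ∙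
                i₁′ ◂ β.isoʳ ∙ identityʳ ∙ identityˡ ⁻¹)
              (assoc ∙ to-Q′ ◂ po′.universal∘i₂≈h₂ ∙ pullˡ po.universal∘i₂≈h₂ ∙ assoc ∙
                i₂′ ◂ γ.isoʳ ∙ identityʳ ∙ identityˡ ⁻¹) } } ,
      po.universal∘i₁≈h₁ , po.universal∘i₂≈h₂
      where
      module po = IsPushout po
      module po′ = IsPushout po′
      module α = _≅_ α
      module β = _≅_ β
      module γ = _≅_ γ
      to-Q′ : _ ⇒ _
      to-Q′ = po.universal {h₁ = i₁′ ∘ β.from} {h₂ = i₂′ ∘ γ.from}
        (assoc ∙ i₁′ ◂ p ∙ extend po′.commute ∙ i₂′ ◂ q ⁻¹ ∙ assoc ⁻¹)
      to-Q : _ ⇒ _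
      to-Q = po′.universal {h₁ = i₁ ∘ β.to} {h₂ = i₂ ∘ γ.to}
        (assoc ∙ i₁ ◂ flip-square α β p ∙ extend po.commute ∙
          i₂ ◂ flip-square α γ q ⁻¹ ∙ assoc ⁻¹)

  open Morphisms

  -- Unions and implications of subobjects

  module AdhesiveLogic where
    private
      variable
        A B D K O V W X Y Z U : Obj

    -- The sieve S holds locally on Y: it may be used to prove that a morphism
    -- out of Y lies in a subobject, or that two morphisms out of Y agree.  This
    -- is how unions of subobjects are eliminated.
    record Locally {Y : Obj} (S : ∀ {Z} → Z ⇒ Y → Set (ℓ ⊔ e)) : Set (o ⊔ ℓ ⊔ e) where
      no-eta-equality
      field
        mem : ∀ {T W} {t : T ⇒ W} → Mono t → (g : Y ⇒ W) →
              (∀ {Z} (z : Z ⇒ Y) → S z → g ∘ z ∈ t) → g ∈ t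
        eq  : ∀ {Q} {f g : Y ⇒ Q} →
              (∀ {Z} (z : Z ⇒ Y) → S z → f ∘ z ≈ g ∘ z) → f ≈ g

    open Locally public

    module _ {Y : Obj} {S S′ : ∀ {Z} → Z ⇒ Y → Set (ℓ ⊔ e)} where
      -- Transitivity of covering; it permits case distinctions nested inside one another.
      locally-bind : Locally S → (∀ {Z} (z : Z ⇒ Y) → S z → Locally λ w → S′ (z ∘ w)) →
                     Locally S′
      locally-bind s k = record
        { mem = λ mt g h → mem s mt g λ z p → mem (k z p) mt (g ∘ z) λ w q →
            ∈-resp (assoc ⁻¹) (h (z ∘ w) q)
        ; eq  = λ h → eq s λ z p → eq (k z p) λ w q → assoc ∙ h (z ∘ w) q ∙ assoc ⁻¹ }

      locally-map : Locally S → (∀ {Z} (z : Z ⇒ Y) → S z → S′ z) → Locally S′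
      locally-map s k = record
        { mem = λ mt g h → mem s mt g λ z p → h z (k z p)
        ; eq  = λ h → eq s λ z p → h z (k z p) }

    locally-all : {Y : Obj} {S : ∀ {Z} → Z ⇒ Y → Set (ℓ ⊔ e)} →
                  (∀ {Z} (z : Z ⇒ Y) → S z) → Locally S
    locally-all k = record
      { mem = λ mt g h → ∈-resp identityʳ (h id (k id))
      ; eq  = λ h → identityʳ ⁻¹ ∙ h id (k id) ∙ identityʳ }

    -- Quantifying over all points `x` builds stability under pullback into the notion of a union.
    Cover : A ⇒ X → B ⇒ X → Set (o ⊔ ℓ ⊔ e)
    Cover {X = X} a b = ∀ {Y} (x : Y ⇒ X) → Locally λ z → x ∘ z ∈ a ⊎ x ∘ z ∈ b

    -- Pull the pushout square back along x by the van Kampen property.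
    pushout-cover : ∀ {Q} {f : A ⇒ X} {g : A ⇒ Y} {i₁ : X ⇒ Q} {i₂ : Y ⇒ Q} →
                    Mono f → IsPushout f g i₁ i₂ → Cover i₁ i₂
    pushout-cover {A} {X} {Y} {f = f} {g} {i₁} {i₂} mf po {R} x = record
      { mem = λ {_} {_} {t} mt h s →
          let t₁ , p₁ = s X′.p₂ (inj₁ (X′.p₁ , X′.commute))
              t₂ , p₂ = s Y′.p₂ (inj₂ (Y′.p₁ , Y′.commute))
              compat = mt _ _ (pullˡ p₁ ∙ assoc ∙ h ◂ top ∙ assoc ⁻¹ ∙ pullˡ p₂ ⁻¹)
          in po′.universal compat ,
             pushout-unique po′ (assoc ∙ t ◂ po′.universal∘i₁≈h₁ ∙ p₁)
                                (assoc ∙ t ◂ po′.universal∘i₂≈h₂ ∙ p₂)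
      ; eq  = λ s → pushout-unique po′
          (s X′.p₂ (inj₁ (X′.p₁ , X′.commute)))
          (s Y′.p₂ (inj₂ (Y′.p₁ , Y′.commute))) }
      where
      module po = IsPushout po
      module X′ where
        open Pullback (pullback i₁ x) public
        open IsPullback isPullback public
      module Y′ where
        open Pullback (pullback i₂ x) public
        open IsPullback isPullback public
      module A′ where
        open Pullback (pullback f X′.p₁) public
        open IsPullback isPullback public
      corner : i₂ ∘ (g ∘ A′.p₁) ≈ x ∘ (X′.p₂ ∘ A′.p₂)
      corner = extend (po.commute ⁻¹) ∙ i₁ ◂ A′.commute ∙ extend X′.commute
      g′ : A′.P ⇒ Y′.P
      g′ = Y′.universal corner
      top : X′.p₂ ∘ A′.p₂ ≈ Y′.p₂ ∘ g′
      top = Y′.p₂∘universal≈h₂ ⁻¹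
      left : g ∘ A′.p₁ ≈ Y′.p₁ ∘ g′
      left = Y′.p₁∘universal≈h₁ ⁻¹
      lift-X : ∀ {Q} {h₁ : Q ⇒ A} {h₂ : Q ⇒ Y′.P} → g ∘ h₁ ≈ Y′.p₁ ∘ h₂ →
               i₁ ∘ (f ∘ h₁) ≈ x ∘ (Y′.p₂ ∘ h₂)
      lift-X p = extend po.commute ∙ i₂ ◂ p ∙ extend Y′.commute
      -- `A′` is the pullback of `x` along the diagonal `i₁ ∘ f ≈ i₂ ∘ g`, so it is also a pullback
      -- over `g`; this is the second back face of the cube.
      g-pullback : IsPullback A′.p₁ g′ g Y′.p₁
      g-pullback = record
        { commute         = left
        ; universal       = λ p → A′.universal (X′.p₁∘universal≈h₁ {eq = lift-X p} ⁻¹)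
        ; p₁∘universal≈h₁ = A′.p₁∘universal≈h₁
        ; p₂∘universal≈h₂ = λ {_} {_} {_} {p} → Y′.unique
            (extend (left ⁻¹) ∙ g ◂ A′.p₁∘universal≈h₁ ∙ p)
            (extend (top ⁻¹) ∙ X′.p₂ ◂ A′.p₂∘universal≈h₂ ∙ X′.p₂∘universal≈h₂)
            Equiv.refl Equiv.refl
        ; unique          = λ a b c d → A′.unique a
            (X′.unique (extend (A′.commute ⁻¹) ∙ f ◂ a) (extend top ∙ Y′.p₂ ◂ b)
                       (extend (A′.commute ⁻¹) ∙ f ◂ c) (extend top ∙ Y′.p₂ ◂ d))
            c Equiv.refl }
      po′ : IsPushout A′.p₂ g′ X′.p₂ Y′.p₂
      po′ = Equivalence.from
        (vanKampen mf po top X′.commute Y′.commute A′.isPullback g-pullback)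
        (X′.isPullback , Y′.isPullback)
      module po′ = IsPushout po′

    -- The van Kampen property is applied to a degenerate cube: its top is the trivial pushout of
    -- `id` along `g`, its vertical maps are `id`, `f`, `id` and `i₂`, and its face over `i₁` is the
    -- given square.
    pushout⇒pullback : ∀ {Q} {f : A ⇒ X} {g : A ⇒ Y} {i₁ : X ⇒ Q} {i₂ : Y ⇒ Q} →
                       Mono f → IsPushout f g i₁ i₂ → IsPullback f g i₁ i₂
    pushout⇒pullback {f = f} {g} {i₁} {i₂} mf po = proj₁ (Equivalence.to
      (vanKampen mf po {f′ = id} {g′ = g} {i₁′ = g} {i₂′ = id} {α = id} {β = f} {γ = id} {δ = i₂}
        (identityʳ ∙ identityˡ ⁻¹) (IsPushout.commute po) Equiv.refl kernel id-pullback)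
      id-pushout)
      where
      kernel : IsPullback id id f f
      kernel = record
        { commute         = Equiv.refl
        ; universal       = λ {_} {h₁} _ → h₁
        ; p₁∘universal≈h₁ = identityˡ
        ; p₂∘universal≈h₂ = λ {_} {_} {_} {p} → identityˡ ∙ mf _ _ p
        ; unique          = λ p _ q _ → identityˡ ⁻¹ ∙ (p ∙ q ⁻¹) ∙ identityˡ }
      id-pullback : IsPullback id g g id
      id-pullback = record
        { commute         = identityʳ ∙ identityˡ ⁻¹
        ; universal       = λ {_} {h₁} _ → h₁
        ; p₁∘universal≈h₁ = identityˡ
        ; p₂∘universal≈h₂ = λ {_} {_} {_} {p} → p ∙ identityˡ
        ; unique          = λ p _ q _ → identityˡ ⁻¹ ∙ (p ∙ q ⁻¹) ∙ identityˡ }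
      id-pushout : IsPushout id g g id
      id-pushout = record
        { commute         = identityʳ ∙ identityˡ ⁻¹
        ; universal       = λ {_} {_} {h₂} _ → h₂
        ; universal∘i₁≈h₁ = λ {_} {_} {_} {p} → p ⁻¹ ∙ identityʳ
        ; universal∘i₂≈h₂ = identityʳ
        ; unique          = λ _ p _ q → identityʳ ⁻¹ ∙ (p ∙ q ⁻¹) ∙ identityʳ }

    -- Injectivity is checked locally: two points with the same image lie either in one part, on
    -- which `u` is already mono, or in different parts, where `meet` makes them agree.
    cover-mono : {a : A ⇒ U} {b : B ⇒ U} {u : U ⇒ X} → Cover a b →
                 Mono (u ∘ a) → Mono (u ∘ b) →
                 (∀ {Z} {x : Z ⇒ A} {y : Z ⇒ B} → (u ∘ a) ∘ x ≈ (u ∘ b) ∘ y → a ∘ x ≈ b ∘ y) →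
                 Mono u
    cover-mono {A = A} {U} {B} {a = a} {b} {u} cov ma mb meet f g p =
      eq (cov f) λ z c → eq (cov (g ∘ z)) λ w d →
        same (restrict c) d (extend (extend p))
      where
      restrict : ∀ {Y Z} {x : Y ⇒ U} {w : Z ⇒ Y} → x ∈ a ⊎ x ∈ b → x ∘ w ∈ a ⊎ x ∘ w ∈ b
      restrict (inj₁ p) = inj₁ (∈-∘ p)
      restrict (inj₂ p) = inj₂ (∈-∘ p)
      move : ∀ {Z K L} {h k : Z ⇒ U} {c : K ⇒ U} {d : L ⇒ U} {x : Z ⇒ K} {y : Z ⇒ L} →
             c ∘ x ≈ h → d ∘ y ≈ k → u ∘ h ≈ u ∘ k → (u ∘ c) ∘ x ≈ (u ∘ d) ∘ y
      move q r s = assoc ∙ u ◂ q ∙ s ∙ u ◂ r ⁻¹ ∙ assoc ⁻¹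
      same : ∀ {Z} {h k : Z ⇒ U} → h ∈ a ⊎ h ∈ b → k ∈ a ⊎ k ∈ b → u ∘ h ≈ u ∘ k → h ≈ k
      same (inj₁ (x , q)) (inj₁ (y , r)) s = q ⁻¹ ∙ a ◂ ma _ _ (move q r s) ∙ r
      same (inj₁ (x , q)) (inj₂ (y , r)) s = q ⁻¹ ∙ meet (move q r s) ∙ r
      same (inj₂ (x , q)) (inj₁ (y , r)) s = q ⁻¹ ∙ meet (move r q (s ⁻¹)) ⁻¹ ∙ r
      same (inj₂ (x , q)) (inj₂ (y , r)) s = q ⁻¹ ∙ b ◂ mb _ _ (move q r s) ∙ r

    mono-resp : {f g : A ⇒ B} → f ≈ g → Mono f → Mono g
    mono-resp p mf u v q = mf u v (p ▸ u ∙ q ∙ p ⁻¹ ▸ v)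

    pushout-∘-iso : ∀ {Q Q′} {f : A ⇒ X} {g : A ⇒ Y} {i₁ : X ⇒ Q} {i₂ : Y ⇒ Q} →
                    IsPushout f g i₁ i₂ → (φ : Q ≅ Q′) →
                    IsPushout f g (_≅_.from φ ∘ i₁) (_≅_.from φ ∘ i₂)
    pushout-∘-iso po φ = record
      { commute         = assoc ∙ from ◂ po.commute ∙ assoc ⁻¹
      ; universal       = λ p → po.universal p ∘ to
      ; universal∘i₁≈h₁ = assoc ∙ _ ◂ cancelˡ isoˡ ∙ po.universal∘i₁≈h₁
      ; universal∘i₂≈h₂ = assoc ∙ _ ◂ cancelˡ isoˡ ∙ po.universal∘i₂≈h₂
      ; unique          = λ a b c d → iso-cancel (pushout-unique po
          (assoc ∙ (a ∙ c ⁻¹) ∙ assoc ⁻¹) (assoc ∙ (b ∙ d ⁻¹) ∙ assoc ⁻¹)) }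
      where
      open _≅_ φ
      module po = IsPushout po
      iso-cancel : ∀ {R} {u v : _ ⇒ R} → u ∘ from ≈ v ∘ from → u ≈ v
      iso-cancel p = identityʳ ⁻¹ ∙ _ ◂ isoʳ ⁻¹ ∙ pullˡ p ∙ assoc ∙ _ ◂ isoʳ ∙ identityʳ

    -- A pushout of monomorphisms read as a union: `O` and `V` cover `X` and meet in `K`. Both
    -- readings are kept side by side, since `biPO` starts from the pushout and `cover⇒biPO` from
    -- the lattice data.
    record BiPO {K O V X} (f : K ⇒ O) (g : K ⇒ V) (i : O ⇒ X) (j : V ⇒ X)
                : Set (o ⊔ ℓ ⊔ e) where
      no-eta-equality
      field
        f-mono    : Mono f
        g-mono    : Mono g
        i-mono    : Mono i
        j-mono    : Mono j
        isPushout : IsPushout f g i j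
        meet      : ∀ {Z} {x : Z ⇒ O} {y : Z ⇒ V} → i ∘ x ≈ j ∘ y →
                    Σ[ s ∈ Z ⇒ K ] f ∘ s ≈ x × g ∘ s ≈ y
        cover     : Cover i j
      open IsPushout isPushout public

      isPullback : IsPullback f g i j
      isPullback = pushout⇒pullback f-mono isPushout

    biPO : {f : K ⇒ O} {g : K ⇒ V} {i : O ⇒ X} {j : V ⇒ X} →
           Mono f → Mono g → IsPushout f g i j → BiPO f g i j
    biPO mf mg po = record
      { f-mono    = mf
      ; g-mono    = mg
      ; i-mono    = pushout-i₂-mono adhesive mg (flip-pushout po)
      ; j-mono    = pushout-i₂-mono adhesive mf po
      ; isPushout = po
      ; meet      = pullback-∈ (pushout⇒pullback mf po)
      ; cover     = pushout-cover mf po }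

    flip-biPO : {f : K ⇒ O} {g : K ⇒ V} {i : O ⇒ X} {j : V ⇒ X} →
                BiPO f g i j → BiPO g f j i
    flip-biPO po = biPO g-mono f-mono (flip-pushout isPushout)
      where open BiPO po

    -- Unions of subobjects are effective.
    cover⇒biPO : {f : K ⇒ O} {g : K ⇒ V} {i : O ⇒ X} {j : V ⇒ X} →
                 Mono f → Mono g → Mono i → Mono j → i ∘ f ≈ j ∘ g →
                 (∀ {Z} {x : Z ⇒ O} {y : Z ⇒ V} → i ∘ x ≈ j ∘ y →
                  Σ[ s ∈ Z ⇒ K ] f ∘ s ≈ x × g ∘ s ≈ y) →
                 Cover i j → BiPO f g i j
    cover⇒biPO {f = f} {g} {i} {j} mf mg mi mj p meet cov = record
      { f-mono    = mf
      ; g-mono    = mg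
      ; i-mono    = mi
      ; j-mono    = mj
      ; isPushout = pushout-resp Equiv.refl Equiv.refl po.universal∘i₁≈h₁ po.universal∘i₂≈h₂
                      (pushout-∘-iso po.isPushout (toIso u-mono (mem (cov id) u-mono id λ z →
                        λ { (inj₁ (x , q)) → po.i₁ ∘ x , pullˡ po.universal∘i₁≈h₁ ∙ q
                          ; (inj₂ (x , q)) → po.i₂ ∘ x , pullˡ po.universal∘i₂≈h₂ ∙ q })))
      ; meet      = meet
      ; cover     = cov }
      where
      module po where
        open Pushout (pushout f g mf) public
        open IsPushout isPushout public
      u : po.Q ⇒ _
      u = po.universal p
      u-mono : Mono u
      u-mono = cover-mono (pushout-cover mf po.isPushout)
        (mono-resp (po.universal∘i₁≈h₁ ⁻¹) mi) (mono-resp (po.universal∘i₂≈h₂ ⁻¹) mj)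
        λ q → let s , a , b = meet (po.universal∘i₁≈h₁ ⁻¹ ▸ _ ∙ q ∙ po.universal∘i₂≈h₂ ▸ _)
              in po.i₁ ◂ a ⁻¹ ∙ extend po.commute ∙ po.i₂ ◂ b

    biPO-resp : {f f′ : K ⇒ O} {g g′ : K ⇒ V} {i i′ : O ⇒ X} {j j′ : V ⇒ X} →
                f ≈ f′ → g ≈ g′ → i ≈ i′ → j ≈ j′ → BiPO f g i j → BiPO f′ g′ i′ j′
    biPO-resp p q r s po = biPO (mono-resp p f-mono) (mono-resp q g-mono)
      (pushout-resp p q r s isPushout)
      where open BiPO po

    paste : ∀ {O′ X′} {f : K ⇒ O} {g : K ⇒ V} {i : O ⇒ X} {j : V ⇒ X}
            {h : O ⇒ O′} {i′ : O′ ⇒ X′} {k : X ⇒ X′} →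
            BiPO f g i j → BiPO h i i′ k → BiPO (h ∘ f) g i′ (k ∘ j)
    paste l r = biPO (∘-mono r.f-mono l.f-mono) l.g-mono (paste-pushout l.isPushout r.isPushout)
      where
      module l = BiPO l
      module r = BiPO r

    cancel : ∀ {O′ X′} {f : K ⇒ O} {g : K ⇒ V} {i : O ⇒ X} {j : V ⇒ X}
             {h : O ⇒ O′} {i′ : O′ ⇒ X′} {k : X ⇒ X′} {m : V ⇒ X′} →
             BiPO f g i j → BiPO (h ∘ f) g i′ m → Mono h →
             i′ ∘ h ≈ k ∘ i → k ∘ j ≈ m → BiPO h i i′ k
    cancel l r mh p q = biPO mh l.i-mono (cancel-pushout l.isPushout r.isPushout p q)
      where
      module l = BiPO l
      module r = BiPO r

    -- The FPC of (m, i) is the Heyting implication m ⇒ m ∘ i of subobjects.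
    record Implication {K I X D} (m : I ⇒ X) (i : K ⇒ I) (d : D ⇒ X) : Set (o ⊔ ℓ ⊔ e) where
      no-eta-equality
      field
        m-mono : Mono m
        i-mono : Mono i
        d-mono : Mono d
        intro  : ∀ {Z} {z : Z ⇒ X} →
                 (∀ {Y} {y : Y ⇒ Z} {a : Y ⇒ I} → z ∘ y ≈ m ∘ a → a ∈ i) → z ∈ d
        elim   : ∀ {Z} {y : Z ⇒ D} {a : Z ⇒ I} → d ∘ y ≈ m ∘ a → a ∈ i

    -- The points of `z` that lie in `m` all factor through the pullback of `m` and `z`, so the
    -- premise of `intro` need only be used at that generic point, which is where the FPC property
    -- asks for it.
    fpc⇒implication : ∀ {D} {m : O ⇒ X} {i : K ⇒ O} {d : D ⇒ X} {b : K ⇒ D} →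
                      Mono m → Mono i → Mono d → IsFPC m i d b → Implication m i d
    fpc⇒implication {m = m} {i} {d} mm mi md isFPC = record
      { m-mono = mm
      ; i-mono = mi
      ; d-mono = md
      ; intro  = λ {_} {z} h →
          let open Pullback (pullback m z) renaming (isPullback to pb)
              w , p = h (IsPullback.commute pb ⁻¹)
          in universal pb p , d∘universal≈z
      ; elim   = λ p → let w , q , _ = pullback-∈ isPullback (p ⁻¹) in w , q }
      where open IsFPC isFPC

  open AdhesiveLogic

  -- Stability and uniqueness of complements and implications

  module Complements where
    private
      variable
        D I K K′ N O O′ V V′ W X X′ : Obj

    module _ {f : K ⇒ O} {g : K ⇒ V} {g′ : K ⇒ V′} {n : O ⇒ N} {i : O ⇒ X}
             {v : V ⇒ N} {v′ : V′ ⇒ X} {ν : N ⇒ X} (ν-mono : Mono ν) (νn : ν ∘ n ≈ i)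
             (po : BiPO f g n v) (po′ : BiPO f g′ i v′) where
      private
        module po = BiPO po
        module po′ = BiPO po′

      -- Distributivity: `V` is the union of its intersections with `O` and `V′`, and the former is
      -- `K`, which lies in `V′`.
      complement-∈ : ν ∘ v ∈ v′
      complement-∈ = mem (po′.cover (ν ∘ v)) po′.j-mono (ν ∘ v) λ z →
        λ { (inj₁ (a , p)) →
              let s , q , r = po.meet (ν-mono _ _ (pullˡ νn ∙ p ∙ assoc))
              in g′ ∘ s , extend (po′.commute ⁻¹) ∙ i ◂ q ∙ p
          ; (inj₂ b) → b }

      -- The same argument with the roles exchanged: inside `N`, a point of `V′` that falls into `O`
      -- is in `K`, hence in `V`. Together with `complement-∈` this identifies `V` with `N ∩ V′`.
      complement-∋ : ∀ {Z} {x : Z ⇒ N} {y : Z ⇒ V′} → ν ∘ x ≈ v′ ∘ y → x ∈ v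
      complement-∋ {x = x} p = mem (po.cover x) po.j-mono x λ z →
        λ { (inj₁ (a , q)) →
              let s , r , _ = po′.meet (νn ⁻¹ ▸ a ∙ assoc ∙ ν ◂ q ∙ extend p)
              in g ∘ s , extend (po.commute ⁻¹) ∙ n ◂ r ∙ q
          ; (inj₂ b) → b }

    module _ {i : K ⇒ I} {n : I ⇒ N} {m : I ⇒ X} {d : D ⇒ N} {d′ : W ⇒ X} {ν : N ⇒ X}
             (νn : ν ∘ n ≈ m) (imp : Implication n i d) (imp′ : Implication m i d′) where
      private
        module imp = Implication imp
        module imp′ = Implication imp′

      -- With `implication-∋` this says that Heyting implication is stable under restriction: `D` is
      -- `N ∩ W`.
      implication-∈ : Mono ν → ν ∘ d ∈ d′
      implication-∈ ν-mono = imp′.intro λ p →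
        imp.elim (ν-mono _ _ (assoc ⁻¹ ∙ p ∙ pushˡ (νn ⁻¹)))

      implication-∋ : ∀ {Z} {x : Z ⇒ N} {y : Z ⇒ W} → ν ∘ x ≈ d′ ∘ y → x ∈ d
      implication-∋ p = imp.intro λ q →
        imp′.elim (pullˡ (p ⁻¹) ∙ assoc ∙ ν ◂ q ∙ pullˡ νn)

    module _ (χ : X ≅ X′) where
      private module χ = _≅_ χ

      -- Uniqueness of pushout complements, obtained from `complement-∈` along `χ` and along its
      -- inverse.
      complement-iso : {f : K ⇒ O} {g : K ⇒ V} {g′ : K ⇒ V′} {i : O ⇒ X} {i′ : O ⇒ X′}
                       {v : V ⇒ X} {v′ : V′ ⇒ X′} → χ.from ∘ i ≈ i′ →
                       BiPO f g i v → BiPO f g′ i′ v′ →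
                       Σ[ φ ∈ V ≅ V′ ] v′ ∘ _≅_.from φ ≈ χ.from ∘ v × _≅_.from φ ∘ g ≈ g′
      complement-iso p po po′ =
        sub-iso (∘-mono (iso-mono χ) po.j-mono) po′.j-mono (proj₂ forth)
          (assoc ∙ χ.from ◂ proj₂ back ∙ cancelˡ χ.isoʳ) ,
        proj₂ forth ,
        po′.j-mono _ _ (pullˡ (proj₂ forth) ∙ assoc ∙ χ.from ◂ po.commute ⁻¹ ∙
                        pullˡ p ∙ po′.commute)
        where
        module po = BiPO po
        module po′ = BiPO po′
        forth : χ.from ∘ _ ∈ _
        forth = complement-∈ (iso-mono χ) p po po′
        back : χ.to ∘ _ ∈ _
        back = complement-∈ (iso-to-mono χ) (flip-cotriangle χ p) po′ po

      implication-iso : {i : K ⇒ I} {m : I ⇒ X} {m′ : I ⇒ X′} {d : D ⇒ X} {d′ : W ⇒ X′}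
                        {k : K ⇒ D} {k′ : K ⇒ W} → χ.from ∘ m ≈ m′ →
                        d ∘ k ≈ m ∘ i → d′ ∘ k′ ≈ m′ ∘ i →
                        Implication m i d → Implication m′ i d′ →
                        Σ[ φ ∈ D ≅ W ] d′ ∘ _≅_.from φ ≈ χ.from ∘ d × _≅_.from φ ∘ k ≈ k′
      implication-iso p q q′ imp imp′ =
        sub-iso (∘-mono (iso-mono χ) imp.d-mono) imp′.d-mono (proj₂ forth)
          (assoc ∙ χ.from ◂ proj₂ back ∙ cancelˡ χ.isoʳ) ,
        proj₂ forth ,
        imp′.d-mono _ _ (pullˡ (proj₂ forth) ∙ assoc ∙ χ.from ◂ q ∙ pullˡ p ∙ q′ ⁻¹)
        where
        module imp = Implication imp
        module imp′ = Implication imp′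
        forth : χ.from ∘ _ ∈ _
        forth = implication-∈ p imp imp′ (iso-mono χ)
        back : χ.to ∘ _ ∈ _
        back = implication-∈ (flip-cotriangle χ p) imp′ imp (iso-to-mono χ)

    biPO-iso : ∀ {V V′ Q Q′} {f : K ⇒ O} {g : K ⇒ V} {g′ : K ⇒ V′} {i : O ⇒ Q} {i′ : O ⇒ Q′}
               {j : V ⇒ Q} {j′ : V′ ⇒ Q′} → BiPO f g i j → BiPO f g′ i′ j′ →
               (φ : V ≅ V′) → _≅_.from φ ∘ g ≈ g′ →
               Σ[ δ ∈ Q ≅ Q′ ] _≅_.from δ ∘ i ≈ i′ × _≅_.from δ ∘ j ≈ j′ ∘ _≅_.from φ
    biPO-iso po po′ φ p =
      let δ , q , r = pushout-iso (BiPO.isPushout po) (BiPO.isPushout po′) ≅-refl ≅-refl φ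
                        (identityˡ ∙ identityʳ ⁻¹) (p ∙ identityʳ ⁻¹)
      in δ , q ∙ identityʳ , r

    biPO-reindex : ∀ {K K′ O O′ V X} (α : K ≅ K′) (β : O ≅ O′) {f : K ⇒ O} {f′ : K′ ⇒ O′}
                   {g : K′ ⇒ V} {i : O′ ⇒ X} {j : V ⇒ X} →
                   _≅_.from β ∘ f ≈ f′ ∘ _≅_.from α → Mono f → BiPO f′ g i j →
                   BiPO f (g ∘ _≅_.from α) (i ∘ _≅_.from β) j
    biPO-reindex α β {f} {f′} {g} {i} {j} p mf po = cover⇒biPO
      mf (∘-mono po.g-mono (iso-mono α)) (∘-mono po.i-mono (iso-mono β)) po.j-mono
      (assoc ∙ i ◂ p ∙ extend po.commute)
      (λ q → let s , r , t = po.meet (assoc ⁻¹ ∙ q)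
             in α.to ∘ s , pullˡ (flip-square α β p ⁻¹) ∙ assoc ∙ flip-cotriangle β (r ⁻¹) ,
                assoc ∙ g ◂ cancelˡ α.isoʳ ∙ t)
      λ x → locally-map (po.cover x) λ
        { _ (inj₁ (a , q)) → inj₁ (β.to ∘ a , assoc ∙ i ◂ cancelˡ β.isoʳ ∙ q)
        ; _ (inj₂ b) → inj₂ b }
      where
      module po = BiPO po
      module α = _≅_ α
      module β = _≅_ β

  open Complements

  -- Compositions presented by cospans

  module Compositions where
    -- All universal constructions are arbitrary rather than the chosen ones, so that composites
    -- transported along rule isomorphisms and the explicit composites with the empty rule are
    -- covered by the same record.
    record Composition (p₂ p₁ : Rule) : Set (o ⊔ ℓ ⊔ e) where
      no-eta-equality
      module p₂ = Rule p₂
      module p₁ = Rule p₁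
      field
        {X V D Q R K} : Obj
        n₂ : p₂.I ⇒ X
        n₁ : p₁.O ⇒ X
        cover : Cover n₂ n₁
        k₁ : p₁.K ⇒ V
        v  : V ⇒ X
        complement : BiPO p₁.out k₁ n₁ v
        k₂ : p₂.K ⇒ D
        d  : D ⇒ X
        implication : Implication n₂ p₂.inp d
        d∘k₂ : d ∘ k₂ ≈ n₂ ∘ p₂.inp
        qO : p₂.O ⇒ Q
        qD : D ⇒ Q
        outputs : BiPO p₂.out k₂ qO qD
        qI : p₁.I ⇒ R
        qV : V ⇒ R
        inputs : BiPO p₁.inp k₁ qI qV
        πD : K ⇒ D
        πV : K ⇒ V
        context : IsPullback πD πV d v
        out-mono : Mono (qD ∘ πD)
        inp-mono : Mono (qV ∘ πV)
      module complement = BiPO complement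
      module implication = Implication implication
      module outputs = BiPO outputs
      module inputs = BiPO inputs
      module context = IsPullback context

      πD-mono : Mono πD
      πD-mono = pullback-p₁-mono context complement.j-mono

      πV-mono : Mono πV
      πV-mono = pullback-p₂-mono context implication.d-mono

      result : Rule
      result = record
        { out = qD ∘ πD ; inp = qV ∘ πV ; out-mono = out-mono ; inp-mono = inp-mono }

    module _ {p₂ p₁ : Rule} (c c′ : Composition p₂ p₁) where
      private
        module c = Composition c
        module c′ = Composition c′

      -- The cospan determines the complement and the implication, and these determine the two
      -- pushouts and the pullback, all up to isomorphism.
      result-iso : (χ : c.X ≅ c′.X) → _≅_.from χ ∘ c.n₂ ≈ c′.n₂ → _≅_.from χ ∘ c.n₁ ≈ c′.n₁ →
                   c.result ≅ᴿ c′.result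
      result-iso χ p₂ p₁ = record
        { isoO = proj₁ δO
        ; isoK = sub-iso (∘-mono (∘-mono (iso-mono χ) c.implication.d-mono) c.πD-mono)
            (∘-mono c′.implication.d-mono c′.πD-mono)
            (assoc ∙ c′.d ◂ proj₁ (proj₂ forth) ∙ pullˡ dφ)
            (assoc ∙ dφ ⁻¹ ▸ _ ∙ assoc ∙ c′.d ◂ (φD.from ◂ proj₁ (proj₂ back) ∙ cancelˡ φD.isoʳ))
        ; isoI = proj₁ δI
        ; out-commute = pullˡ (proj₂ (proj₂ δO)) ∙ assoc ∙ c′.qD ◂ proj₁ (proj₂ forth) ⁻¹ ∙ assoc ⁻¹
        ; inp-commute = pullˡ (proj₂ (proj₂ δI)) ∙ assoc ∙ c′.qV ◂ proj₂ (proj₂ forth) ⁻¹ ∙ assoc ⁻¹ }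
        where
        V-iso = complement-iso χ p₁ c.complement c′.complement
        D-iso = implication-iso χ p₂ c.d∘k₂ c′.d∘k₂ c.implication c′.implication
        module φV = _≅_ (proj₁ V-iso)
        module φD = _≅_ (proj₁ D-iso)
        vφ = proj₁ (proj₂ V-iso)
        dφ = proj₁ (proj₂ D-iso)
        δO = biPO-iso c.outputs c′.outputs (proj₁ D-iso) (proj₂ (proj₂ D-iso))
        δI = biPO-iso c.inputs c′.inputs (proj₁ V-iso) (proj₂ (proj₂ V-iso))
        module χ = _≅_ χ
        forth : Σ[ s ∈ c.K ⇒ c′.K ] c′.πD ∘ s ≈ φD.from ∘ c.πD × c′.πV ∘ s ≈ φV.from ∘ c.πV
        forth = pullback-∈ c′.context
          (pullˡ dφ ∙ assoc ∙ χ.from ◂ c.context.commute ∙ assoc ⁻¹ ∙ pushˡ (vφ ⁻¹))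
        back : Σ[ s ∈ c′.K ⇒ c.K ] c.πD ∘ s ≈ φD.to ∘ c′.πD × c.πV ∘ s ≈ φV.to ∘ c′.πV
        back = pullback-∈ c.context (iso-mono χ _ _
          (pullˡ (dφ ⁻¹) ∙ assoc ∙ c′.d ◂ cancelˡ φD.isoʳ ∙ c′.context.commute ∙
            c′.v ◂ cancelˡ φV.isoʳ ⁻¹ ∙ extend vφ))

    -- Exhibits the cospan of `c` as the union of `i` and `j` inside a possibly larger `X`; by
    -- `ν-iso` it is all of `X` when `i` and `j` cover.
    record Embeds {p₂ p₁ X} (c : Composition p₂ p₁) (i : Rule.I p₂ ⇒ X) (j : Rule.O p₁ ⇒ X)
                  : Set (o ⊔ ℓ ⊔ e) where
      no-eta-equality
      private module c = Composition c
      field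
        ν      : c.X ⇒ X
        ν∘n₂   : ν ∘ c.n₂ ≈ i
        ν∘n₁   : ν ∘ c.n₁ ≈ j
        ν-mono : Mono ν

      ν-iso : Cover i j → c.X ≅ X
      ν-iso cov = toIso ν-mono (mem (cov id) ν-mono id λ z → λ
        { (inj₁ (x , p)) → c.n₂ ∘ x , pullˡ ν∘n₂ ∙ p
        ; (inj₂ (x , p)) → c.n₁ ∘ x , pullˡ ν∘n₁ ∙ p })

  open Compositions

  -- Matches and jointly covering cospans

  module Matches where
    cover-∘-iso : ∀ {A A′ B B′ X} {a : A ⇒ X} {b : B ⇒ X} (φ : A′ ≅ A) (ψ : B′ ≅ B) →
                  Cover a b → Cover (a ∘ _≅_.from φ) (b ∘ _≅_.from ψ)
    cover-∘-iso {a = a} {b} φ ψ cov x = locally-map (cov x) λ _ → replace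
      where
      module φ = _≅_ φ
      module ψ = _≅_ ψ
      replace : ∀ {Z} {w : Z ⇒ _} → w ∈ a ⊎ w ∈ b → w ∈ a ∘ φ.from ⊎ w ∈ b ∘ ψ.from
      replace (inj₁ (y , p)) = inj₁ (φ.to ∘ y , assoc ∙ a ◂ cancelˡ φ.isoʳ ∙ p)
      replace (inj₂ (y , p)) = inj₂ (ψ.to ∘ y , assoc ∙ b ◂ cancelˡ ψ.isoʳ ∙ p)

    implication-reindex : ∀ {K K′ I I′ X D} (α : K ≅ K′) (β : I ≅ I′)
                          {i : K ⇒ I} {i′ : K′ ⇒ I′} {m : I′ ⇒ X} {d : D ⇒ X} →
                          _≅_.from β ∘ i ≈ i′ ∘ _≅_.from α → Mono i →
                          Implication m i′ d → Implication (m ∘ _≅_.from β) i d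
    implication-reindex α β {i} {i′} {m} p mi imp = record
      { m-mono = ∘-mono imp.m-mono (iso-mono β)
      ; i-mono = mi
      ; d-mono = imp.d-mono
      ; intro  = λ h → imp.intro λ q →
          let s , r = h (q ∙ m ◂ cancelˡ β.isoʳ ⁻¹ ∙ assoc ⁻¹)
          in α.from ∘ s , pullˡ (p ⁻¹) ∙ assoc ∙ β.from ◂ r ∙ cancelˡ β.isoʳ
      ; elim   = λ q →
          let s , r = imp.elim (q ∙ assoc)
          in α.to ∘ s , pullˡ (flip-square α β p ⁻¹) ∙ assoc ∙ flip-cotriangle β (r ⁻¹) }
      where
      module imp = Implication imp
      module α = _≅_ α
      module β = _≅_ β

    reindex : ∀ {p₂ p₁ q₂ q₁} → p₂ ≅ᴿ q₂ → p₁ ≅ᴿ q₁ → Composition q₂ q₁ → Composition p₂ p₁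
    reindex {p₂} {p₁} φ₂ φ₁ c = record
      { n₂          = c.n₂ ∘ _≅_.from φ₂.isoI
      ; n₁          = c.n₁ ∘ _≅_.from φ₁.isoO
      ; cover       = cover-∘-iso φ₂.isoI φ₁.isoO c.cover
      ; complement  = biPO-reindex φ₁.isoK φ₁.isoO φ₁.out-commute (Rule.out-mono p₁) c.complement
      ; implication = implication-reindex φ₂.isoK φ₂.isoI φ₂.inp-commute (Rule.inp-mono p₂)
                        c.implication
      ; d∘k₂        = pullˡ c.d∘k₂ ∙ assoc ∙ c.n₂ ◂ φ₂.inp-commute ⁻¹ ∙ assoc ⁻¹
      ; outputs     = biPO-reindex φ₂.isoK φ₂.isoO φ₂.out-commute (Rule.out-mono p₂) c.outputs
      ; inputs      = biPO-reindex φ₁.isoK φ₁.isoI φ₁.inp-commute (Rule.inp-mono p₁) c.inputs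
      ; context     = c.context
      ; out-mono    = c.out-mono
      ; inp-mono    = c.inp-mono }
      where
      module c = Composition c
      module φ₂ = _≅ᴿ_ φ₂
      module φ₁ = _≅ᴿ_ φ₁

    module _ {p₂ p₁ : Rule} where
      private
        module p₂ = Rule p₂
        module p₁ = Rule p₁

      gluing : (m : Match adhesive p₂ p₁) →
               BiPO (Match.m₂ m) (Match.m₁ m) (Match.n₂ m) (Match.n₁ m)
      gluing m = biPO m.m₂-mono m.m₁-mono m.isPushout
        where module m = Match m

      -- The pushout square of a match is also a pullback, so `M` is the object of pairs of points
      -- of `I` and `O` that are identified, and equal identifications give isomorphic spans.
      match-≈ : (m m′ : Match adhesive p₂ p₁) →
        (∀ {Z} {x : Z ⇒ p₂.I} {y : Z ⇒ p₁.O} →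
          Match.n₂ m ∘ x ≈ Match.n₁ m ∘ y → Match.n₂ m′ ∘ x ≈ Match.n₁ m′ ∘ y) →
        (∀ {Z} {x : Z ⇒ p₂.I} {y : Z ⇒ p₁.O} →
          Match.n₂ m′ ∘ x ≈ Match.n₁ m′ ∘ y → Match.n₂ m ∘ x ≈ Match.n₁ m ∘ y) →
        Setoid._≈_ (MatchSetoid adhesive p₂ p₁) m m′
      match-≈ m m′ to from =
        let s , p , q = BiPO.meet (gluing m′) (to m.commute)
            t , r , _ = BiPO.meet (gluing m) (from m′.commute)
        in sub-iso m.m₂-mono m′.m₂-mono p r , p , q
        where
        module m where
          open Match m public
          open IsPushout isPushout public using (commute)
        module m′ where
          open Match m′ public
          open IsPushout isPushout public using (commute)

      record Realizes {X : Obj} (m : Match adhesive p₂ p₁) (i : p₂.I ⇒ X) (j : p₁.O ⇒ X)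
                      : Set (o ⊔ ℓ ⊔ e) where
        no-eta-equality
        field
          ν      : Match.N m ⇒ X
          ν∘n₂   : ν ∘ Match.n₂ m ≈ i
          ν∘n₁   : ν ∘ Match.n₁ m ≈ j
          ν-mono : Mono ν

      module _ {X V : Obj} {i : p₂.I ⇒ X} {o : p₁.O ⇒ X} {k : p₁.K ⇒ V} {v : V ⇒ X}
               (i-mono : Mono i) (po : BiPO p₁.out k o v) where
        private
          module po = BiPO po

        -- The match is the intersection of `i` and `o` in `X`. Its pushout `N` is their union, and
        -- `N ∩ V` serves as the complement there.
        realize : ∃[ m ] Realizes m i o
        realize = m , record { ν = ν ; ν∘n₂ = ν∘n₂ ; ν∘n₁ = ν∘n₁ ; ν-mono = ν-mono }
          where
          module P = Pullback (pullback i o)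
          module pb = IsPullback P.isPullback
          span : MatchSpan adhesive p₂ p₁
          span = record
            { m₂      = P.p₁
            ; m₁      = P.p₂
            ; m₂-mono = pullback-p₁-mono P.isPullback po.i-mono
            ; m₁-mono = pullback-p₂-mono P.isPullback i-mono }
          module span = MatchSpan span
          open BiPO (biPO span.m₂-mono span.m₁-mono span.isPushout) using
            (universal; universal∘i₁≈h₁; universal∘i₂≈h₂; commute; cover)
            renaming (j-mono to n₁-mono)
          ν : span.N ⇒ X
          ν = universal pb.commute
          ν∘n₂ : ν ∘ span.n₂ ≈ i
          ν∘n₂ = universal∘i₁≈h₁
          ν∘n₁ : ν ∘ span.n₁ ≈ o
          ν∘n₁ = universal∘i₂≈h₂
          ν-mono : Mono ν
          ν-mono = cover-mono cover (mono-resp (ν∘n₂ ⁻¹) i-mono) (mono-resp (ν∘n₁ ⁻¹) po.i-mono)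
            λ q → let s , a , b = pullback-∈ P.isPullback (ν∘n₂ ⁻¹ ▸ _ ∙ q ∙ ν∘n₁ ▸ _)
                  in span.n₂ ◂ a ⁻¹ ∙ extend commute ∙ span.n₁ ◂ b
          module V′ where
            open Pullback (pullback ν v) public
            open IsPullback isPullback public
          k′ : Σ[ s ∈ _ ⇒ _ ] V′.p₁ ∘ s ≈ span.n₁ ∘ p₁.out × V′.p₂ ∘ s ≈ k
          k′ = pullback-∈ V′.isPullback (pullˡ ν∘n₁ ∙ po.commute)
          restricted : BiPO p₁.out (proj₁ k′) span.n₁ V′.p₁
          restricted = cover⇒biPO p₁.out-mono
            (mono-factor (proj₂ (proj₂ k′)) po.g-mono)
            n₁-mono (pullback-p₁-mono V′.isPullback po.j-mono) (proj₁ (proj₂ k′) ⁻¹)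
            (λ {_} {x} {y} q →
              let s , a , b = po.meet (ν∘n₁ ⁻¹ ▸ x ∙ assoc ∙ ν ◂ q ∙ extend V′.commute)
              in s , a , V′.unique
                   (pullˡ (proj₁ (proj₂ k′)) ∙ assoc ∙ span.n₁ ◂ a ∙ q)
                   (pullˡ (proj₂ (proj₂ k′)) ∙ b)
                   Equiv.refl Equiv.refl)
            λ x → locally-map (po.cover (ν ∘ x)) λ _ → reflect
            where
            reflect : ∀ {Y Z} {x : Y ⇒ span.N} {z : Z ⇒ Y} →
                      (ν ∘ x) ∘ z ∈ o ⊎ (ν ∘ x) ∘ z ∈ v → x ∘ z ∈ span.n₁ ⊎ x ∘ z ∈ V′.p₁
            reflect (inj₁ (y , p)) = inj₁ (y , ν-mono _ _ (pullˡ ν∘n₁ ∙ p ∙ assoc))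
            reflect (inj₂ (y , p)) =
              let s , a , _ = pullback-∈ V′.isPullback (assoc ⁻¹ ∙ p ⁻¹) in inj₂ (s , a)
          m : Match adhesive p₂ p₁
          m = record { span = span ; complement = record { isPushout = BiPO.isPushout restricted } }

      realizes-resp : ∀ {X} {m m′ : Match adhesive p₂ p₁} {i : p₂.I ⇒ X} {o : p₁.O ⇒ X} →
        Setoid._≈_ (MatchSetoid adhesive p₂ p₁) m′ m → Realizes m i o → Realizes m′ i o
      realizes-resp {m = m} {m′} (φ , p , q) r =
        let δ , a , b = pushout-iso (Match.isPushout m′) (Match.isPushout m) φ ≅-refl ≅-refl
                          (identityˡ ∙ p ⁻¹) (identityˡ ∙ q ⁻¹)
        in record
          { ν      = r.ν ∘ _≅_.from δ
          ; ν∘n₂   = assoc ∙ r.ν ◂ (a ∙ identityʳ) ∙ r.ν∘n₂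
          ; ν∘n₁   = assoc ∙ r.ν ◂ (b ∙ identityʳ) ∙ r.ν∘n₁
          ; ν-mono = ∘-mono r.ν-mono (iso-mono δ) }
        where module r = Realizes r

    module _ (fpcs : HasMonoFPCs) where
      open HasMonoFPCs fpcs

      composition : ∀ p₂ p₁ → Match adhesive p₂ p₁ → Composition p₂ p₁
      composition p₂ p₁ m = record
        { cover       = BiPO.cover (gluing m)
        ; complement  = biPO p₁.out-mono k₁-mono (isPushout complement)
        ; implication = fpc⇒implication m.n₂-mono p₂.inp-mono (d-mono m.n₂-mono p₂.inp-mono)
                          F.isFPC
        ; d∘k₂        = IsPullback.commute (IsFPC.isPullback F.isFPC) ⁻¹
        ; outputs     = biPO p₂.out-mono (b-mono m.n₂-mono p₂.inp-mono)
                          (Pushout.isPushout (pushout p₂.out F.b p₂.out-mono))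
        ; inputs      = biPO p₁.inp-mono k₁-mono
                          (Pushout.isPushout (pushout p₁.inp (g complement) p₁.inp-mono))
        ; context     = Pullback.isPullback (pullback F.d (i₂ complement))
        -- Taking these proofs from `composite` makes the result definitionally equal to that rule.
        ; out-mono    = Rule.out-mono (composite adhesive fpcs p₂ p₁ m)
        ; inp-mono    = Rule.inp-mono (composite adhesive fpcs p₂ p₁ m) }
        where
        module p₂ = Rule p₂
        module p₁ = Rule p₁
        module m = Match m
        open m using (complement)
        open PushoutComplement
        module F = FPC (fpc m.n₂ p₂.inp m.n₂-mono p₂.inp-mono)
        k₁-mono : Mono (g complement)
        k₁-mono = mono-factor (IsPushout.commute (isPushout complement) ⁻¹)
          (∘-mono (BiPO.j-mono (gluing m)) p₁.out-mono)

  open Matches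

  -- Chains and their results

  module Chains where
    -- A threefold composition, independent of the bracketing: p₁ is applied
    -- backwards to X₁ at o₁, leaving V; p₂ is applied forwards to X₁ at i₂,
    -- leaving W, with outcome X₂; and p₃ is to be applied to X₂ at i₃.
    record Chain (p₃ p₂ p₁ : Rule) : Set (o ⊔ ℓ ⊔ e) where
      no-eta-equality
      module p₁ = Rule p₁
      module p₂ = Rule p₂
      module p₃ = Rule p₃
      field
        {X₁ X₂ V W} : Obj
        o₁ : p₁.O ⇒ X₁
        i₂ : p₂.I ⇒ X₁
        k₁ : p₁.K ⇒ V
        v₁ : V ⇒ X₁
        complement : BiPO p₁.out k₁ o₁ v₁
        k₂ : p₂.K ⇒ W
        w₁ : W ⇒ X₁
        implication : Implication i₂ p₂.inp w₁
        w₁∘k₂ : w₁ ∘ k₂ ≈ i₂ ∘ p₂.inp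
        o₂ : p₂.O ⇒ X₂
        w₂ : W ⇒ X₂
        outcome : BiPO p₂.out k₂ o₂ w₂
        i₃ : p₃.I ⇒ X₂
        i₃-mono : Mono i₃
        cover : ∀ {Y} (x : Y ⇒ X₁) → Locally λ z →
                (x ∘ z ∈ o₁ ⊎ x ∘ z ∈ i₂) ⊎ (Σ[ w ∈ _ ⇒ W ] w₁ ∘ w ≈ x ∘ z × w₂ ∘ w ∈ i₃)
      module complement = BiPO complement
      module implication = Implication implication
      module outcome = BiPO outcome

    -- A single `ω` has to match `W` inside both `X₁` and `X₂`, which ties `χ₁` to `χ₂`. The
    -- isomorphism of the complements `V` is recovered from their uniqueness.
    record _≈ᶜ_ {p₃ p₂ p₁} (t t′ : Chain p₃ p₂ p₁) : Set (ℓ ⊔ e) where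
      no-eta-equality
      private
        module t = Chain t
        module t′ = Chain t′
      field
        χ₁ : t.X₁ ≅ t′.X₁
        χ₂ : t.X₂ ≅ t′.X₂
        ω  : t.W ≅ t′.W
      module χ₁ = _≅_ χ₁
      module χ₂ = _≅_ χ₂
      module ω = _≅_ ω
      field
        χ₁∘o₁ : χ₁.from ∘ t.o₁ ≈ t′.o₁
        χ₁∘i₂ : χ₁.from ∘ t.i₂ ≈ t′.i₂
        χ₂∘o₂ : χ₂.from ∘ t.o₂ ≈ t′.o₂
        χ₂∘i₃ : χ₂.from ∘ t.i₃ ≈ t′.i₃
        χ₁∘w₁ : χ₁.from ∘ t.w₁ ≈ t′.w₁ ∘ ω.from
        χ₂∘w₂ : χ₂.from ∘ t.w₂ ≈ t′.w₂ ∘ ω.from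

    module _ {p₃ p₂ p₁ : Rule} where
      ≈ᶜ-refl : {t : Chain p₃ p₂ p₁} → t ≈ᶜ t
      ≈ᶜ-refl = record
        { χ₁ = ≅-refl ; χ₂ = ≅-refl ; ω = ≅-refl
        ; χ₁∘o₁ = identityˡ ; χ₁∘i₂ = identityˡ ; χ₂∘o₂ = identityˡ ; χ₂∘i₃ = identityˡ
        ; χ₁∘w₁ = identityˡ ∙ identityʳ ⁻¹ ; χ₂∘w₂ = identityˡ ∙ identityʳ ⁻¹ }

      ≈ᶜ-sym : {t t′ : Chain p₃ p₂ p₁} → t ≈ᶜ t′ → t′ ≈ᶜ t
      ≈ᶜ-sym φ = record
        { χ₁ = ≅-sym φ.χ₁ ; χ₂ = ≅-sym φ.χ₂ ; ω = ≅-sym φ.ω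
        ; χ₁∘o₁ = flip-cotriangle φ.χ₁ φ.χ₁∘o₁ ; χ₁∘i₂ = flip-cotriangle φ.χ₁ φ.χ₁∘i₂
        ; χ₂∘o₂ = flip-cotriangle φ.χ₂ φ.χ₂∘o₂ ; χ₂∘i₃ = flip-cotriangle φ.χ₂ φ.χ₂∘i₃
        ; χ₁∘w₁ = flip-square φ.ω φ.χ₁ φ.χ₁∘w₁ ; χ₂∘w₂ = flip-square φ.ω φ.χ₂ φ.χ₂∘w₂ }
        where module φ = _≈ᶜ_ φ

      ≈ᶜ-trans : {t t′ t″ : Chain p₃ p₂ p₁} → t ≈ᶜ t′ → t′ ≈ᶜ t″ → t ≈ᶜ t″
      ≈ᶜ-trans φ ψ = record
        { χ₁ = ≅-trans φ.χ₁ ψ.χ₁ ; χ₂ = ≅-trans φ.χ₂ ψ.χ₂ ; ω = ≅-trans φ.ω ψ.ω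
        ; χ₁∘o₁ = assoc ∙ _ ◂ φ.χ₁∘o₁ ∙ ψ.χ₁∘o₁ ; χ₁∘i₂ = assoc ∙ _ ◂ φ.χ₁∘i₂ ∙ ψ.χ₁∘i₂
        ; χ₂∘o₂ = assoc ∙ _ ◂ φ.χ₂∘o₂ ∙ ψ.χ₂∘o₂ ; χ₂∘i₃ = assoc ∙ _ ◂ φ.χ₂∘i₃ ∙ ψ.χ₂∘i₃
        ; χ₁∘w₁ = assoc ∙ _ ◂ φ.χ₁∘w₁ ∙ extend ψ.χ₁∘w₁
        ; χ₂∘w₂ = assoc ∙ _ ◂ φ.χ₂∘w₂ ∙ extend ψ.χ₂∘w₂ }
        where
        module φ = _≈ᶜ_ φ
        module ψ = _≈ᶜ_ ψ

    chainSetoid : (p₃ p₂ p₁ : Rule) → Setoid (o ⊔ ℓ ⊔ e) (ℓ ⊔ e)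
    chainSetoid p₃ p₂ p₁ = record
      { Carrier       = Chain p₃ p₂ p₁
      ; _≈_           = _≈ᶜ_
      ; isEquivalence = record { refl = ≈ᶜ-refl ; sym = ≈ᶜ-sym ; trans = ≈ᶜ-trans } }

    -- A characterization instead of a construction: each bracketing shows that its own rule
    -- satisfies it, and `chain-result-iso` shows that it fixes the rule.
    record IsResult {p₃ p₂ p₁} (t : Chain p₃ p₂ p₁) (r : Rule) : Set (o ⊔ ℓ ⊔ e) where
      no-eta-equality
      open Chain t
      module r = Rule r
      field
        {W₃} : Obj
        k₃ : p₃.K ⇒ W₃
        d₃ : W₃ ⇒ X₂
        final : Implication i₃ p₃.inp d₃
        d₃∘k₃ : d₃ ∘ k₃ ≈ i₃ ∘ p₃.inp
        e₃ : r.K ⇒ W₃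
        eW : r.K ⇒ W
        eV : r.K ⇒ V
        d₃∘e₃ : d₃ ∘ e₃ ≈ w₂ ∘ eW
        w₁∘eW : w₁ ∘ eW ≈ v₁ ∘ eV
        -- Membership in `eW` is enough for a limit, because `d₃` and `v₁` are mono and force the
        -- other two components.
        limit : ∀ {Z} {x : Z ⇒ W₃} {y : Z ⇒ W} {z : Z ⇒ V} →
                d₃ ∘ x ≈ w₂ ∘ y → w₁ ∘ y ≈ v₁ ∘ z → y ∈ eW
        qO : p₃.O ⇒ r.O
        qW : W₃ ⇒ r.O
        outputs : BiPO p₃.out k₃ qO qW
        out-factor : r.out ≈ qW ∘ e₃
        qI : p₁.I ⇒ r.I
        qV : V ⇒ r.I
        inputs : BiPO p₁.inp k₁ qI qV
        inp-factor : r.inp ≈ qV ∘ eV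
      module final = Implication final

      eW-mono : Mono eW
      eW-mono = mono-factor (d₃∘e₃ ⁻¹)
        (∘-mono final.d-mono (mono-factor (out-factor ⁻¹) r.out-mono))

    module _ {p₃ p₂ p₁} (t t′ : Chain p₃ p₂ p₁) {r r′ : Rule} where
      private
        module t = Chain t
        module t′ = Chain t′

      chain-result-iso : t ≈ᶜ t′ → IsResult t r → IsResult t′ r′ → r ≅ᴿ r′
      chain-result-iso φ res res′ = record
        { isoO = proj₁ δO
        ; isoK = sub-iso (∘-mono (iso-mono ω) res.eW-mono) res′.eW-mono (proj₂ forth)
                   (assoc ∙ ω.from ◂ proj₂ back ∙ cancelˡ ω.isoʳ)
        ; isoI = proj₁ δI
        ; out-commute = _ ◂ res.out-factor ∙ extend (proj₂ (proj₂ δO)) ∙ res′.qW ◂ e₃-compat ⁻¹ ∙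
                        assoc ⁻¹ ∙ res′.out-factor ⁻¹ ▸ _
        ; inp-commute = _ ◂ res.inp-factor ∙ extend (proj₂ (proj₂ δI)) ∙ res′.qV ◂ eV-compat ⁻¹ ∙
                        assoc ⁻¹ ∙ res′.inp-factor ⁻¹ ▸ _ }
        where
        open _≈ᶜ_ φ
        module res = IsResult res
        module res′ = IsResult res′
        V-iso = complement-iso χ₁ χ₁∘o₁ t.complement t′.complement
        W-iso = implication-iso χ₂ χ₂∘i₃ res.d₃∘k₃ res′.d₃∘k₃ res.final res′.final
        module φV = _≅_ (proj₁ V-iso)
        module φW = _≅_ (proj₁ W-iso)
        vφ : t′.v₁ ∘ φV.from ≈ χ₁.from ∘ t.v₁
        vφ = proj₁ (proj₂ V-iso)
        dφ : res′.d₃ ∘ φW.from ≈ χ₂.from ∘ res.d₃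
        dφ = proj₁ (proj₂ W-iso)
        δO = biPO-iso res.outputs res′.outputs (proj₁ W-iso) (proj₂ (proj₂ W-iso))
        δI = biPO-iso res.inputs res′.inputs (proj₁ V-iso) (proj₂ (proj₂ V-iso))
        forth : ω.from ∘ res.eW ∈ res′.eW
        forth = res′.limit
          (pullˡ dφ ∙ assoc ∙ χ₂.from ◂ res.d₃∘e₃ ∙ extend χ₂∘w₂)
          (extend (χ₁∘w₁ ⁻¹) ∙ χ₁.from ◂ res.w₁∘eW ∙ extend (vφ ⁻¹))
        back : ω.to ∘ res′.eW ∈ res.eW
        back = res.limit
          (iso-mono χ₂ _ _ (extend (dφ ⁻¹) ∙ res′.d₃ ◂ cancelˡ φW.isoʳ ∙ res′.d₃∘e₃ ∙
            t′.w₂ ◂ cancelˡ ω.isoʳ ⁻¹ ∙ extend (χ₂∘w₂ ⁻¹)))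
          (iso-mono χ₁ _ _ (extend χ₁∘w₁ ∙ t′.w₁ ◂ cancelˡ ω.isoʳ ∙ res′.w₁∘eW ∙
            t′.v₁ ◂ cancelˡ φV.isoʳ ⁻¹ ∙ extend vφ))
        e₃-compat : res′.e₃ ∘ proj₁ forth ≈ φW.from ∘ res.e₃
        e₃-compat = res′.final.d-mono _ _ (extend res′.d₃∘e₃ ∙ t′.w₂ ◂ proj₂ forth ∙
          extend (χ₂∘w₂ ⁻¹) ∙ χ₂.from ◂ res.d₃∘e₃ ⁻¹ ∙ extend (dφ ⁻¹))
        eV-compat : res′.eV ∘ proj₁ forth ≈ φV.from ∘ res.eV
        eV-compat = t′.complement.j-mono _ _ (extend (res′.w₁∘eW ⁻¹) ∙ t′.w₁ ◂ proj₂ forth ∙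
          extend (χ₁∘w₁ ⁻¹) ∙ χ₁.from ◂ res.w₁∘eW ∙ extend (vφ ⁻¹))

  open Chains

  -- The composite p₃ ∘ (p₂ ∘ p₁).
  module RightNested where

    -- Right bracketing: from nested compositions to chains

    module ToChain {p₃ p₂ p₁ : Rule} (c : Composition p₂ p₁)
                   (c′ : Composition p₃ (Composition.result c)) where
      private
        module c = Composition c
        module c′ = Composition c′
        module p₁ = Rule p₁
        module p₂ = Rule p₂

      -- Inside `X₂` this is the union of `c.D` and the complement `c′.V`, which meet in the context
      -- `c.K`; `X₁` then glues `c.X` to it along `c.D`.
      module W where
        open Pushout (pushout c.πD c′.k₁ c.πD-mono) public
        po : BiPO c.πD c′.k₁ i₁ i₂
        po = biPO c.πD-mono c′.complement.g-mono isPushout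
        open BiPO po public

      w₂ : W.Q ⇒ c′.X
      w₂ = W.universal {h₁ = c′.n₁ ∘ c.qD} {h₂ = c′.v} (assoc ∙ c′.complement.commute)

      w₂∘i₁ : w₂ ∘ W.i₁ ≈ c′.n₁ ∘ c.qD
      w₂∘i₁ = W.universal∘i₁≈h₁

      w₂∘i₂ : w₂ ∘ W.i₂ ≈ c′.v
      w₂∘i₂ = W.universal∘i₂≈h₂

      middle : BiPO c.qD W.i₁ c′.n₁ w₂
      middle = cancel W.po c′.complement c.outputs.j-mono (w₂∘i₁ ⁻¹) w₂∘i₂
      module middle = BiPO middle

      module X₁ where
        open Pushout (pushout c.d W.i₁ c.implication.d-mono) public
          renaming (i₁ to ν; i₂ to w₁)
        po : BiPO c.d W.i₁ ν w₁
        po = biPO c.implication.d-mono W.i-mono isPushout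
        open BiPO po public
      open X₁ using (ν; w₁)

      module V where
        open Pushout (pushout c.πV c′.k₁ c.πV-mono) public
        po : BiPO c.πV c′.k₁ i₁ i₂
        po = biPO c.πV-mono c′.complement.g-mono isPushout
        open BiPO po public

      v₁ : V.Q ⇒ X₁.Q
      v₁ = V.universal {h₁ = ν ∘ c.v} {h₂ = w₁ ∘ W.i₂}
        (assoc ∙ ν ◂ c.context.commute ⁻¹ ∙ extend X₁.commute ∙ w₁ ◂ W.commute ∙ assoc ⁻¹)

      v₁∘i₁ : v₁ ∘ V.i₁ ≈ ν ∘ c.v
      v₁∘i₁ = V.universal∘i₁≈h₁

      v₁∘i₂ : v₁ ∘ V.i₂ ≈ w₁ ∘ W.i₂
      v₁∘i₂ = V.universal∘i₂≈h₂

      V-square : BiPO c.v V.i₁ ν v₁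
      V-square = cancel V.po
        (biPO-resp c.context.commute Equiv.refl Equiv.refl Equiv.refl (paste W.po X₁.po))
        c.complement.j-mono (v₁∘i₁ ⁻¹) v₁∘i₂

      complement : BiPO p₁.out (V.i₁ ∘ c.k₁) (ν ∘ c.n₁) v₁
      complement = flip-biPO (paste (flip-biPO c.complement) (flip-biPO V-square))

      -- `I₂` lies in `c.X`, and `W` meets `c.X` exactly in `c.D`; so on `c.X` the question is the
      -- one answered by `c.implication`, and the rest of `X₁` is in `W` anyway.
      implication : Implication (ν ∘ c.n₂) p₂.inp w₁
      implication = record
        { m-mono = ∘-mono X₁.i-mono c.implication.m-mono
        ; i-mono = p₂.inp-mono
        ; d-mono = X₁.j-mono
        ; intro  = λ {_} {z} h → mem (X₁.cover z) X₁.j-mono z λ y → λ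
            { (inj₁ (u , p)) →
                let s , q = c.implication.intro λ r →
                      h (assoc ⁻¹ ∙ p ⁻¹ ▸ _ ∙ assoc ∙ ν ◂ r ∙ assoc ⁻¹)
                in W.i₁ ∘ s , extend (X₁.commute ⁻¹) ∙ ν ◂ q ∙ p
            ; (inj₂ b) → b }
        ; elim   = λ p →
            let s , q , _ = X₁.meet (assoc ⁻¹ ∙ p ⁻¹) in c.implication.elim q }

      in-ν : ∀ {Y Z} {u : Y ⇒ c.X} {z : Z ⇒ Y} {x : Z ⇒ X₁.Q} → ν ∘ (u ∘ z) ≈ x →
             u ∘ z ∈ c.n₂ ⊎ u ∘ z ∈ c.n₁ → x ∈ ν ∘ c.n₁ ⊎ x ∈ ν ∘ c.n₂
      in-ν p (inj₁ (a , q)) = inj₂ (a , assoc ∙ ν ◂ q ∙ p)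
      in-ν p (inj₂ (a , q)) = inj₁ (a , assoc ∙ ν ◂ q ∙ p)

      chain : Chain p₃ p₂ p₁
      chain = record
        { complement  = complement
        ; implication = implication
        ; w₁∘k₂       = pullˡ (X₁.commute ⁻¹) ∙ assoc ∙ ν ◂ c.d∘k₂ ∙ assoc ⁻¹
        ; outcome     = flip-biPO (paste (flip-biPO c.outputs) (flip-biPO middle))
        ; i₃          = c′.n₂
        ; i₃-mono     = c′.implication.m-mono
        ; cover       = λ x → locally-bind (X₁.cover x) λ
          { z (inj₁ (u , p)) → locally-map (c.cover u) λ y d → inj₁ (in-ν (extend p) d)
          ; z (inj₂ (w , p)) → locally-bind (c′.cover (w₂ ∘ w)) λ
            { y (inj₁ (a , q)) → locally-all λ y′ →
                inj₂ (w ∘ (y ∘ y′) , extend p , a ∘ y′ , pullˡ q ∙ assoc ∙ assoc)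
            ; y (inj₂ (a , q)) →
                -- A point of `W` that falls into `c.Q` comes from `c.D`, hence from `c.X`, which
                -- `I₂` and `O₁` cover.
                let s , _ , r = middle.meet (q ∙ assoc)
                in locally-map (c.cover (c.d ∘ s)) λ y′ d →
                  inj₁ (in-ν (ν ◂ assoc ∙ extend X₁.commute ∙ w₁ ◂ (pullˡ r ∙ assoc) ∙ extend p) d) } } }

      isResult : IsResult chain c′.result
      isResult = record
        { final      = c′.implication
        ; d₃∘k₃      = c′.d∘k₂
        ; e₃         = c′.πD
        ; eW         = W.i₂ ∘ c′.πV
        ; eV         = V.i₂ ∘ c′.πV
        ; d₃∘e₃      = c′.context.commute ∙ pushˡ (w₂∘i₂ ⁻¹)
        ; w₁∘eW      = extend (v₁∘i₂ ⁻¹)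
        ; limit      = limit
        ; outputs    = c′.outputs
        ; out-factor = Equiv.refl
        ; inputs     = flip-biPO (paste (flip-biPO c.inputs) (flip-biPO V-inputs))
        ; inp-factor = pushˡ (q∘i₂ ⁻¹) }
        where
        q : V.Q ⇒ c′.R
        q = V.universal {h₁ = c′.qI ∘ c.qV} {h₂ = c′.qV} (assoc ∙ c′.inputs.commute)
        q∘i₁ : q ∘ V.i₁ ≈ c′.qI ∘ c.qV
        q∘i₁ = V.universal∘i₁≈h₁
        q∘i₂ : q ∘ V.i₂ ≈ c′.qV
        q∘i₂ = V.universal∘i₂≈h₂
        V-inputs : BiPO c.qV V.i₁ c′.qI q
        V-inputs = cancel V.po c′.inputs c.inputs.j-mono (q∘i₁ ⁻¹) q∘i₂
        -- `V` and `W` meet in `c′.V` only: a common point that comes from `c.V` is also in `c.D`,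
        -- hence in `c.K`, and this lies in `c′.V`.
        V∩W : ∀ {Z} {y : Z ⇒ W.Q} {z : Z ⇒ V.Q} → w₁ ∘ y ≈ v₁ ∘ z → y ∈ W.i₂
        V∩W {y = y} {z} p = mem (V.cover z) W.j-mono y λ u → λ
          { (inj₁ (a , r)) →
              let s , t , t′ = X₁.meet {y = y ∘ u} (pullˡ (v₁∘i₁ ⁻¹) ∙ assoc ∙ v₁ ◂ r ∙ extend (p ⁻¹))
                  f , g , g′ = pullback-∈ c.context t
              in c′.k₁ ∘ f , extend (W.commute ⁻¹) ∙ W.i₁ ◂ g ∙ t′
          ; (inj₂ (b , r)) → b , X₁.j-mono _ _
              (extend (v₁∘i₂ ⁻¹) ∙ v₁ ◂ r ∙ extend (p ⁻¹)) }
        limit : ∀ {Z} {x : Z ⇒ c′.D} {y : Z ⇒ W.Q} {z : Z ⇒ V.Q} →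
                c′.d ∘ x ≈ w₂ ∘ y → w₁ ∘ y ≈ v₁ ∘ z → y ∈ W.i₂ ∘ c′.πV
        limit {y = y} p q =
          let a , r = V∩W q
              s , _ , t = pullback-∈ c′.context (p ∙ w₂ ◂ r ⁻¹ ∙ pullˡ w₂∘i₂)
          in s , assoc ∙ W.i₂ ◂ t ∙ r

  -- Right bracketing: the chain determines both matches

  module RightNestedInjective where
    open RightNested

    module _ {p₃ p₂ p₁ : Rule} where
      -- The inner cospan sits in `X₁` by the monomorphism `ν`, so its overlap can be read off from
      -- `i₂` and `o₁`.
      inner-overlap : (c b : Composition p₂ p₁)
        {c′ : Composition p₃ (Composition.result c)} {b′ : Composition p₃ (Composition.result b)} →
        RightNested.ToChain.chain c c′ ≈ᶜ RightNested.ToChain.chain b b′ →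
        ∀ {Z} {x : Z ⇒ Rule.I p₂} {y : Z ⇒ Rule.O p₁} →
        Composition.n₂ c ∘ x ≈ Composition.n₁ c ∘ y → Composition.n₂ b ∘ x ≈ Composition.n₁ b ∘ y
      inner-overlap c b {c′} {b′} φ {x = x} {y} p = ToChain.X₁.i-mono b b′ _ _
        (assoc ⁻¹ ∙ χ₁∘i₂ ⁻¹ ▸ x ∙ assoc ∙ χ₁.from ◂ (assoc ∙ ToChain.X₁.ν c c′ ◂ p ∙ assoc ⁻¹) ∙
          pullˡ χ₁∘o₁ ∙ assoc)
        where
        open _≈ᶜ_ φ

      -- Once the inner composition is fixed, the chain isomorphism respects `c.X` in `X₁` because
      -- `I₂` and `O₁` cover it, therefore `c.D` in `W`, and therefore `c.Q` in `X₂`.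
      outer-overlap : (c : Composition p₂ p₁) (c′ b′ : Composition p₃ (Composition.result c)) →
        RightNested.ToChain.chain c c′ ≈ᶜ RightNested.ToChain.chain c b′ →
        ∀ {Z} {x : Z ⇒ Rule.I p₃} {y : Z ⇒ Composition.Q c} →
        Composition.n₂ c′ ∘ x ≈ Composition.n₁ c′ ∘ y →
        Composition.n₂ b′ ∘ x ≈ Composition.n₁ b′ ∘ y
      outer-overlap c c′ b′ φ {x = x} {y} p =
        χ₂∘i₃ ⁻¹ ▸ x ∙ assoc ∙ χ₂.from ◂ p ∙ pullˡ χ₂∘n₁
        where
        open _≈ᶜ_ φ
        module c = Composition c
        χ₁∘ν : χ₁.from ∘ ToChain.X₁.ν c c′ ≈ ToChain.X₁.ν c b′
        χ₁∘ν = eq (c.cover id) λ z → λ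
          { (inj₁ (a , q)) → through χ₁∘i₂ a (q ∙ identityˡ)
          ; (inj₂ (a , q)) → through χ₁∘o₁ a (q ∙ identityˡ) }
          where
          through : ∀ {Z D} {n : D ⇒ c.X} {z : Z ⇒ c.X} →
                    χ₁.from ∘ (ToChain.X₁.ν c c′ ∘ n) ≈ ToChain.X₁.ν c b′ ∘ n → (a : Z ⇒ D) → n ∘ a ≈ z →
                    (χ₁.from ∘ ToChain.X₁.ν c c′) ∘ z ≈ ToChain.X₁.ν c b′ ∘ z
          through r a q = _ ◂ q ⁻¹ ∙ pullˡ (assoc ∙ r) ∙ assoc ∙ _ ◂ q
        ω∘i₁ : ω.from ∘ ToChain.W.i₁ c c′ ≈ ToChain.W.i₁ c b′
        ω∘i₁ = ToChain.X₁.j-mono c b′ _ _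
          (extend (χ₁∘w₁ ⁻¹) ∙ χ₁.from ◂ ToChain.X₁.commute c c′ ⁻¹ ∙ pullˡ χ₁∘ν ∙ ToChain.X₁.commute c b′)
        χ₂∘n₁ : χ₂.from ∘ Composition.n₁ c′ ≈ Composition.n₁ b′
        χ₂∘n₁ = pushout-unique c.outputs.isPushout
          (assoc ∙ χ₂∘o₂)
          (assoc ∙ χ₂.from ◂ ToChain.w₂∘i₁ c c′ ⁻¹ ∙ extend χ₂∘w₂ ∙ ToChain.w₂ c b′ ◂ ω∘i₁ ∙ ToChain.w₂∘i₁ c b′)

  -- Right bracketing: every chain arises

  module RightNestedSurjective where
    open RightNested

    module FromChain {p₃ p₂ p₁ : Rule} (t : Chain p₃ p₂ p₁) (c : Composition p₂ p₁)
                     (ρ : Embeds c (Chain.i₂ t) (Chain.o₁ t)) where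
      open Embeds ρ
      private
        module c = Composition c
        module t = Chain t

      j : c.D ⇒ t.W
      j = proj₁ (implication-∈ ν∘n₂ c.implication t.implication ν-mono)

      w₁∘j : t.w₁ ∘ j ≈ ν ∘ c.d
      w₁∘j = proj₂ (implication-∈ ν∘n₂ c.implication t.implication ν-mono)

      ν∩W : ∀ {Z} {x : Z ⇒ c.X} {y : Z ⇒ t.W} → ν ∘ x ≈ t.w₁ ∘ y →
            Σ[ s ∈ Z ⇒ c.D ] c.d ∘ s ≈ x × j ∘ s ≈ y
      ν∩W p =
        let s , q = implication-∋ ν∘n₂ c.implication t.implication p
        in s , q , t.implication.d-mono _ _ (extend w₁∘j ∙ ν ◂ q ∙ p)

      ν∘v∈v₁ : ν ∘ c.v ∈ t.v₁
      ν∘v∈v₁ = complement-∈ ν-mono ν∘n₁ c.complement t.complement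

      ν∩V : ∀ {Z} {x : Z ⇒ c.X} {y : Z ⇒ t.V} → ν ∘ x ≈ t.v₁ ∘ y → x ∈ c.v
      ν∩V = complement-∋ ν-mono ν∘n₁ c.complement t.complement

      j∘k₂ : j ∘ c.k₂ ≈ t.k₂
      j∘k₂ = t.implication.d-mono _ _
        (extend w₁∘j ∙ ν ◂ c.d∘k₂ ∙ pullˡ ν∘n₂ ∙ t.w₁∘k₂ ⁻¹)

      n : c.Q ⇒ t.X₂
      n = c.outputs.universal {h₁ = t.o₂} {h₂ = t.w₂ ∘ j}
        (t.outcome.commute ∙ t.w₂ ◂ j∘k₂ ⁻¹ ∙ assoc ⁻¹)

      n∘qO : n ∘ c.qO ≈ t.o₂
      n∘qO = c.outputs.universal∘i₁≈h₁

      n∘qD : n ∘ c.qD ≈ t.w₂ ∘ j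
      n∘qD = c.outputs.universal∘i₂≈h₂

      j-mono : Mono j
      j-mono = mono-factor w₁∘j (∘-mono ν-mono c.implication.d-mono)

      middle : BiPO c.qD j n t.w₂
      middle = flip-biPO (cancel (flip-biPO c.outputs)
        (biPO-resp (j∘k₂ ⁻¹) Equiv.refl Equiv.refl Equiv.refl (flip-biPO t.outcome))
        j-mono (n∘qD ⁻¹) n∘qO)
      module middle = BiPO middle

      module A where
        open Pullback (pullback t.v₁ t.w₁) public
        open IsPullback isPullback public

      v : A.P ⇒ t.X₂
      v = t.w₂ ∘ A.p₂

      k : Σ[ s ∈ c.K ⇒ A.P ] A.p₁ ∘ s ≈ proj₁ ν∘v∈v₁ ∘ c.πV × A.p₂ ∘ s ≈ j ∘ c.πD
      k = pullback-∈ A.isPullback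
        (pullˡ (proj₂ ν∘v∈v₁) ∙ assoc ∙ ν ◂ c.context.commute ⁻¹ ∙ extend (w₁∘j ⁻¹))

      w∈o₁⇒∈j : ∀ {Z} {y : Z ⇒ t.W} → t.w₁ ∘ y ∈ t.o₁ → y ∈ j
      w∈o₁⇒∈j (a , p) =
        let s , _ , q = ν∩W (pullˡ ν∘n₁ ∙ p) in s , q

      w∈i₂⇒∈j : ∀ {Z} {y : Z ⇒ t.W} → t.w₁ ∘ y ∈ t.i₂ → y ∈ j
      w∈i₂⇒∈j (a , p) =
        let s , _ , q = ν∩W (pullˡ ν∘n₂ ∙ p) in s , q

      ∈j⇒∈n : ∀ {Z} {y : Z ⇒ t.W} {x : Z ⇒ t.X₂} → t.w₂ ∘ y ≈ x → y ∈ j → x ∈ n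
      ∈j⇒∈n p (a , q) = c.qD ∘ a , extend n∘qD ∙ t.w₂ ◂ q ∙ p

      ∈o₂⇒∈n : ∀ {Z} {x : Z ⇒ t.X₂} → x ∈ t.o₂ → x ∈ n
      ∈o₂⇒∈n (a , p) = c.qO ∘ a , pullˡ n∘qO ∙ p

      -- The complement of the inner composite's output in `X₂` is `V ∩ W`: a point of `W` lies in
      -- `V` or in `O₁`, and in the latter case in `c.X ∩ W`, which is `c.D`.
      complement : BiPO (c.qD ∘ c.πD) (proj₁ k) n v
      complement = cover⇒biPO c.out-mono
        (mono-factor (proj₂ (proj₂ k)) (∘-mono j-mono c.πD-mono))
        middle.i-mono (∘-mono middle.j-mono A-mono)
        (extend n∘qD ∙ t.w₂ ◂ proj₂ (proj₂ k) ⁻¹ ∙ assoc ⁻¹)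
        meet
        λ x → locally-bind (t.outcome.cover x) λ
          { z (inj₁ p) → locally-all λ y → inj₁ (∈-resp assoc (∈-∘ (∈o₂⇒∈n p)))
          ; z (inj₂ (w , p)) → locally-map (t.complement.cover (t.w₁ ∘ w)) λ
            { y (inj₁ q) → inj₁ (∈j⇒∈n (extend p) (w∈o₁⇒∈j (∈-resp assoc q)))
            ; y (inj₂ (a , q)) →
                let s , _ , r = pullback-∈ A.isPullback (q ∙ assoc)
                in inj₂ (s , assoc ∙ t.w₂ ◂ r ∙ extend p) } }
        where
        A-mono : Mono A.p₂
        A-mono = pullback-p₂-mono A.isPullback t.complement.j-mono
        meet : ∀ {Z} {x : Z ⇒ c.Q} {y : Z ⇒ A.P} → n ∘ x ≈ v ∘ y →
               Σ[ s ∈ Z ⇒ c.K ] (c.qD ∘ c.πD) ∘ s ≈ x × proj₁ k ∘ s ≈ y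
        meet {x = x} {y} p = first (middle.meet (p ∙ assoc))
          where
          second : {a : _ ⇒ c.D} → c.qD ∘ a ≈ x → j ∘ a ≈ A.p₂ ∘ y → c.d ∘ a ∈ c.v →
                   Σ[ s ∈ _ ⇒ c.K ] (c.qD ∘ c.πD) ∘ s ≈ x × proj₁ k ∘ s ≈ y
          second q r (b , b′) =
            let s , u , _ = pullback-∈ c.context (b′ ⁻¹)
            in s , assoc ∙ c.qD ◂ u ∙ q ,
               A-mono _ _ (pullˡ (proj₂ (proj₂ k)) ∙ assoc ∙ j ◂ u ∙ r)
          first : Σ[ a ∈ _ ⇒ c.D ] c.qD ∘ a ≈ x × j ∘ a ≈ A.p₂ ∘ y →
                  Σ[ s ∈ _ ⇒ c.K ] (c.qD ∘ c.πD) ∘ s ≈ x × proj₁ k ∘ s ≈ y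
          first (a , q , r) = second q r
            (ν∩V (extend (w₁∘j ⁻¹) ∙ t.w₁ ◂ r ∙ extend (A.commute ⁻¹)))

      -- The third clause of `Chain.cover` is what makes this hold: a point of `W` in `O₁` or `I₂`
      -- comes from `c.D`, and locally any other one is in `I₃`.
      cover : Cover t.i₃ n
      cover x = locally-bind (t.outcome.cover x) λ
        { z (inj₁ p) → locally-all λ y → inj₂ (∈-resp assoc (∈-∘ (∈o₂⇒∈n p)))
        ; z (inj₂ (w , p)) → locally-map (t.cover (t.w₁ ∘ w)) λ
          { y (inj₁ (inj₁ q)) → inj₂ (∈j⇒∈n (extend p) (w∈o₁⇒∈j (∈-resp assoc q)))
          ; y (inj₁ (inj₂ q)) → inj₂ (∈j⇒∈n (extend p) (w∈i₂⇒∈j (∈-resp assoc q)))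
          ; y (inj₂ (w′ , q , a , r)) → inj₁ (a , r ∙
              t.w₂ ◂ t.implication.d-mono _ _ (q ∙ assoc) ∙ extend p) } }

      ν-square : BiPO c.d j ν t.w₁
      ν-square = cover⇒biPO c.implication.d-mono j-mono ν-mono t.implication.d-mono (w₁∘j ⁻¹) ν∩W
        λ x → locally-map (t.cover x) λ
          { z (inj₁ (inj₁ (a , p))) → inj₁ (c.n₁ ∘ a , pullˡ ν∘n₁ ∙ p)
          ; z (inj₁ (inj₂ (a , p))) → inj₁ (c.n₂ ∘ a , pullˡ ν∘n₂ ∙ p)
          ; z (inj₂ (w , p , _)) → inj₂ (w , p) }

      chain-≈ : (c′ : Composition p₃ c.result) (ξ : Composition.X c′ ≅ t.X₂) →
                _≅_.from ξ ∘ Composition.n₂ c′ ≈ t.i₃ → _≅_.from ξ ∘ Composition.n₁ c′ ≈ n →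
                RightNested.ToChain.chain c c′ ≈ᶜ t
      chain-≈ c′ ξ p q = record
        { χ₁ = proj₁ δ ; χ₂ = ξ ; ω = proj₁ φ
        ; χ₁∘o₁ = pullˡ (proj₁ (proj₂ δ)) ∙ ν∘n₁
        ; χ₁∘i₂ = pullˡ (proj₁ (proj₂ δ)) ∙ ν∘n₂
        ; χ₂∘o₂ = pullˡ q ∙ n∘qO
        ; χ₂∘i₃ = p
        ; χ₁∘w₁ = proj₂ (proj₂ δ)
        ; χ₂∘w₂ = proj₁ (proj₂ φ) ⁻¹ }
        where
        φ = complement-iso ξ q (ToChain.middle c c′) middle
        δ = biPO-iso (ToChain.X₁.po c c′) ν-square (proj₁ φ) (proj₂ (proj₂ φ))

  -- Finite families of compositions

  module CompositionSetoid where
    module _ {p₂ p₁ : Rule} where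
      infix 4 _≈ᵇ_
      _≈ᵇ_ : (c c′ : Composition p₂ p₁) → Set (ℓ ⊔ e)
      c ≈ᵇ c′ = Σ[ χ ∈ c.X ≅ c′.X ] _≅_.from χ ∘ c.n₂ ≈ c′.n₂ × _≅_.from χ ∘ c.n₁ ≈ c′.n₁
        where
        module c = Composition c
        module c′ = Composition c′

      overlap-resp : {c c′ : Composition p₂ p₁} → c ≈ᵇ c′ →
        ∀ {Z} {x : Z ⇒ Rule.I p₂} {y : Z ⇒ Rule.O p₁} →
        Composition.n₂ c ∘ x ≈ Composition.n₁ c ∘ y →
        Composition.n₂ c′ ∘ x ≈ Composition.n₁ c′ ∘ y
      overlap-resp (χ , p , q) {x = x} {y} r = p ⁻¹ ▸ x ∙ assoc ∙ _ ◂ r ∙ pullˡ q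

    compositionSetoid : (p₂ p₁ : Rule) → Setoid (o ⊔ ℓ ⊔ e) (ℓ ⊔ e)
    compositionSetoid p₂ p₁ = record
      { Carrier       = Composition p₂ p₁
      ; _≈_           = _≈ᵇ_
      ; isEquivalence = record
        { refl  = ≅-refl , identityˡ , identityˡ
        ; sym   = λ (χ , p , q) → ≅-sym χ , flip-cotriangle χ p , flip-cotriangle χ q
        ; trans = λ (χ , p , q) (ψ , p′ , q′) →
            ≅-trans χ ψ , assoc ∙ _ ◂ p ∙ p′ , assoc ∙ _ ◂ q ∙ q′ } }

    reindex-cong : ∀ {p₂ p₁ q₂ q₁} (φ₂ : p₂ ≅ᴿ q₂) (φ₁ : p₁ ≅ᴿ q₁) {c c′ : Composition q₂ q₁} →
                   c ≈ᵇ c′ → reindex φ₂ φ₁ c ≈ᵇ reindex φ₂ φ₁ c′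
    reindex-cong φ₂ φ₁ (χ , p , q) = χ , pullˡ p , pullˡ q

    module _ {p₂ p₁ q₂ q₁} (φ₂ : p₂ ≅ᴿ q₂) (φ₁ : p₁ ≅ᴿ q₁)
             (ψ₂ : q₂ ≅ᴿ p₂) (ψ₁ : q₁ ≅ᴿ p₁) where
      reindex-inverse :
        _≅_.from (_≅ᴿ_.isoI φ₂) ∘ _≅_.from (_≅ᴿ_.isoI ψ₂) ≈ id →
        _≅_.from (_≅ᴿ_.isoO φ₁) ∘ _≅_.from (_≅ᴿ_.isoO ψ₁) ≈ id →
        (c : Composition q₂ q₁) → reindex ψ₂ ψ₁ (reindex φ₂ φ₁ c) ≈ᵇ c
      reindex-inverse p q c = ≅-refl ,
        identityˡ ∙ assoc ∙ _ ◂ p ∙ identityʳ , identityˡ ∙ assoc ∙ _ ◂ q ∙ identityʳ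

    -- A finite family of compositions, one for each admissible match.
    record Family (p₂ p₁ : Rule) : Set (o ⊔ ℓ ⊔ e) where
      no-eta-equality
      field
        size      : ℕ
        at        : Fin size → Composition p₂ p₁
        injective : ∀ {i j} →
          (∀ {Z} {x : Z ⇒ Rule.I p₂} {y : Z ⇒ Rule.O p₁} →
            Composition.n₂ (at i) ∘ x ≈ Composition.n₁ (at i) ∘ y →
            Composition.n₂ (at j) ∘ x ≈ Composition.n₁ (at j) ∘ y) →
          (∀ {Z} {x : Z ⇒ Rule.I p₂} {y : Z ⇒ Rule.O p₁} →
            Composition.n₂ (at j) ∘ x ≈ Composition.n₁ (at j) ∘ y →
            Composition.n₂ (at i) ∘ x ≈ Composition.n₁ (at i) ∘ y) →
          i ≡ j
        -- The legs need not cover `X`: for the inner composition a chain only offers the larger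
        -- object `X₁` or `X₂`.
        embed     : ∀ {X V} {i : Rule.I p₂ ⇒ X} {j : Rule.O p₁ ⇒ X}
                    {k : Rule.K p₁ ⇒ V} {v : V ⇒ X} → Mono i → BiPO (Rule.out p₁) k j v →
                    ∃[ n ] Embeds (at n) i j

      resultAt : Fin size → Rule
      resultAt n = Composition.result (at n)

      locate : (c : Composition p₂ p₁) → ∃[ n ] at n ≈ᵇ c
      locate c = let n , r = embed c.implication.m-mono c.complement in
        n , Embeds.ν-iso r c.cover , Embeds.ν∘n₂ r , Embeds.ν∘n₁ r
        where module c = Composition c

      at-injective : ∀ {i j} → at i ≈ᵇ at j → i ≡ j
      at-injective {i} {j} p = injective
        (overlap-resp {c = at i} {at j} p)
        (overlap-resp {c = at j} {at i} (Setoid.sym (compositionSetoid p₂ p₁) {at i} {at j} p))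

    matchFamily : HasMonoFPCs → FiniteMatches adhesive → (p₂ p₁ : Rule) → Family p₂ p₁
    matchFamily fpcs finite p₂ p₁ = record
      { size      = Finite.size (finite p₂ p₁)
      ; at        = λ n → composition fpcs p₂ p₁ (Finite.element (finite p₂ p₁) n)
      ; injective = λ {i} {j} to from → element-injective
          (match-≈ (Finite.element (finite p₂ p₁) i) (Finite.element (finite p₂ p₁) j) to from)
      ; embed     = λ mi po → select (realize mi po) }
      where
      module enumeration = Inverse (Finite.enumeration (finite p₂ p₁))
      element-injective : ∀ {i j} → Setoid._≈_ (MatchSetoid adhesive p₂ p₁)
        (Finite.element (finite p₂ p₁) i) (Finite.element (finite p₂ p₁) j) → i ≡ j
      element-injective {i} {j} p = ≡.trans (≡.sym (enumeration.strictlyInverseʳ i))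
        (≡.trans (enumeration.from-cong p) (enumeration.strictlyInverseʳ j))
      select : ∀ {X} {i : Rule.I p₂ ⇒ X} {j : Rule.O p₁ ⇒ X} → ∃[ m ] Realizes m i j →
               ∃[ n ] Embeds (composition fpcs p₂ p₁ (Finite.element (finite p₂ p₁) n)) i j
      select {i = i} {j} (m , r) = enumeration.from m ,
        record { ν = ν r′ ; ν∘n₂ = ν∘n₂ r′ ; ν∘n₁ = ν∘n₁ r′ ; ν-mono = ν-mono r′ }
        where
        open Realizes
        r′ : Realizes (Finite.element (finite p₂ p₁) (enumeration.from m)) i j
        r′ = realizes-resp (enumeration.strictlyInverseˡ m) r

    id-biPO : ∀ {A B} {f : A ⇒ B} → Mono f → BiPO f id id f
    id-biPO mf = cover⇒biPO mf id-mono id-mono mf (identityˡ ∙ identityʳ ⁻¹)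
      (λ {_} {x} {y} p → y , p ⁻¹ ∙ identityˡ , identityˡ)
      λ x → locally-all λ z → inj₁ (x ∘ z , identityˡ)

    -- The empty rule as unit

    module Units (initial : StrictInitial) where
      open StrictInitial initial

      -- Strictness makes `u` invertible, so `Z` is itself initial. The same reason lets `∅-elim`
      -- discharge a case whose domain maps to `∅`.
      ∅-subterminal : ∀ {Z} (u v : Z ⇒ ∅) → u ≈ v
      ∅-subterminal u v =
        identityˡ ⁻¹ ∙ (!-unique id ⁻¹ ∙ !-unique (v ∘ inv)) ▸ u ∙ assoc ∙ v ◂ isoˡ ∙ identityʳ
        where open IsIso (strict u)

      !-mono : ∀ {X} → Mono (! {X})
      !-mono u v _ = ∅-subterminal u v

      !-biPO : ∀ {X} → BiPO id (! {X}) ! id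
      !-biPO = flip-biPO (id-biPO !-mono)

      ∅-elim : ∀ {Z A X} → Z ⇒ ∅ → (z : Z ⇒ X) (a : A ⇒ X) → z ∈ a
      ∅-elim u z a = ! ∘ u , assoc ⁻¹ ∙
        (!-unique (a ∘ !) ⁻¹ ∙ !-unique (z ∘ inv)) ▸ u ∙ assoc ∙ z ◂ isoˡ ∙ identityʳ
        where open IsIso (strict u)

      module _ (p : Rule) where
        private module p = Rule p

        -- The cospan is `∅ → O ← O`; implication from the empty subobject is the whole of `O`.
        left : Composition (emptyRule initial) p
        left = record
          { n₂          = !
          ; n₁          = id
          ; cover       = λ x → locally-all λ z → inj₂ (x ∘ z , identityˡ)
          ; complement  = id-biPO p.out-mono
          ; d           = id
          ; implication = record
            { m-mono = !-mono
            ; i-mono = id-mono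
            ; d-mono = id-mono
            ; intro  = λ _ → _ , identityˡ
            ; elim   = λ _ → _ , identityˡ }
          ; d∘k₂        = identityˡ ∙ identityʳ ⁻¹
          ; outputs     = !-biPO
          ; inputs      = id-biPO p.inp-mono
          ; context     = flip-pullback (BiPO.isPullback (flip-biPO (id-biPO p.out-mono)))
          ; out-mono    = ∘-mono id-mono p.out-mono
          ; inp-mono    = ∘-mono p.inp-mono id-mono }

        left-result : Composition.result left ≅ᴿ p
        left-result = record
          { isoO = ≅-refl ; isoK = ≅-refl ; isoI = ≅-refl
          ; out-commute = identityˡ ∙ identityˡ ∙ identityʳ ⁻¹ ; inp-commute = identityˡ }

        -- The leg out of `∅` contributes nothing to the cover, so the monomorphism `c.n₁` must be
        -- invertible.
        left-unique : (c : Composition (emptyRule initial) p) → left ≈ᵇ c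
        left-unique c = toIso c.complement.i-mono (mem (c.cover id) c.complement.i-mono id λ z → λ
            { (inj₁ (a , _)) → ∅-elim a _ _
            ; (inj₂ q) → q }) ,
          !-unique _ ⁻¹ ∙ !-unique c.n₂ , identityʳ
          where module c = Composition c

        -- The cospan is `I → I ← ∅`; implication from the whole of `I` returns `inp` itself.
        right : Composition p (emptyRule initial)
        right = record
          { n₂          = id
          ; n₁          = !
          ; cover       = λ x → locally-all λ z → inj₁ (x ∘ z , identityˡ)
          ; complement  = !-biPO
          ; implication = record
            { m-mono = id-mono
            ; i-mono = p.inp-mono
            ; d-mono = p.inp-mono
            ; intro  = λ h → h (identityʳ ∙ identityˡ ⁻¹)
            ; elim   = λ q → _ , q ∙ identityˡ }
          ; d∘k₂        = identityʳ ∙ identityˡ ⁻¹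
          ; outputs     = id-biPO p.out-mono
          ; inputs      = !-biPO
          ; context     = BiPO.isPullback (flip-biPO (id-biPO p.inp-mono))
          ; out-mono    = ∘-mono p.out-mono id-mono
          ; inp-mono    = ∘-mono id-mono p.inp-mono }

        right-result : Composition.result right ≅ᴿ p
        right-result = record
          { isoO = ≅-refl ; isoK = ≅-refl ; isoI = ≅-refl
          ; out-commute = identityˡ ; inp-commute = identityˡ ∙ identityˡ ∙ identityʳ ⁻¹ }

        right-unique : (c : Composition p (emptyRule initial)) → right ≈ᵇ c
        right-unique c = toIso c.implication.m-mono (mem (c.cover id) c.implication.m-mono id λ z → λ
            { (inj₁ q) → q
            ; (inj₂ (a , _)) → ∅-elim a _ _ }) ,
          identityʳ , !-unique _ ⁻¹ ∙ !-unique c.n₁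
          where module c = Composition c

  open CompositionSetoid public

  -- Finiteness of the set of matches

  module _ (finitary : Finitary) where
    module _ (em : ExcludedMiddle (o ⊔ ℓ ⊔ e)) (automorphisms : FiniteAutomorphisms)
             (p₂ p₁ : Rule) where
      private
        module p₂ = Rule p₂
        module p₁ = Rule p₁
        module I = Finite (finitary p₂.I)
        module O = Finite (finitary p₁.O)
        module Aut A = Finite (automorphisms A)
        module M = Setoid (MatchSetoid adhesive p₂ p₁)
        open Subobject

        decide : (P : Set (ℓ ⊔ e)) → Dec P
        decide P = map′ lower lift (em {Lift o P})

        spanAt : (S : Subobject p₂.I) (T : Subobject p₁.O) → dom S ≅ dom T →
                 MatchSpan adhesive p₂ p₁
        spanAt S T φ = record
          { m₂      = arr S
          ; m₁      = arr T ∘ _≅_.from φ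
          ; m₂-mono = mono S
          ; m₁-mono = ∘-mono (mono T) (iso-mono φ) }

        matchesAt : MatchSpan adhesive p₂ p₁ → List M.Carrier
        matchesAt s = whenTrue (em {PushoutComplement p₁.out (MatchSpan.n₁ s)}) λ k →
          record { span = s ; complement = k } ∷ []

        -- A span of monomorphisms amounts to a subobject on each side and an isomorphism of their
        -- domains. If one such isomorphism exists, the others differ from it by an automorphism of
        -- `dom S`.
        spansAt : (S : Subobject p₂.I) (T : Subobject p₁.O) → List M.Carrier
        spansAt S T = whenTrue (decide (dom S ≅ dom T)) λ φ →
          concat (tabulate λ k → matchesAt (spanAt S T (≅-trans (Aut.element (dom S) k) φ)))

        matches : List M.Carrier
        matches = concat (tabulate λ i → concat (tabulate λ j →
          spansAt (I.element i) (O.element j)))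

        matchesAt-complete : ∀ s m → (φ : MatchSpan.M s ≅ Match.M m) →
          Match.m₂ m ∘ _≅_.from φ ≈ MatchSpan.m₂ s → Match.m₁ m ∘ _≅_.from φ ≈ MatchSpan.m₁ s →
          Any (m M.≈_) (matchesAt s)
        matchesAt-complete s m φ p q = whenTrue⁺ em complement λ k →
          here (M.sym {record { span = s ; complement = k }} {m} (φ , p , q))
          where
          module m = Match m
          module s = MatchSpan s
          δ : Σ[ δ ∈ m.N ≅ s.N ] _≅_.from δ ∘ m.n₂ ≈ s.n₂ ∘ id × _≅_.from δ ∘ m.n₁ ≈ s.n₁ ∘ id
          δ = pushout-iso m.isPushout s.isPushout (≅-sym φ) ≅-refl ≅-refl
            (identityˡ ∙ flip-triangle φ p ⁻¹) (identityˡ ∙ flip-triangle φ q ⁻¹)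
          complement : PushoutComplement p₁.out s.n₁
          complement = record
            { isPushout = pushout-resp Equiv.refl Equiv.refl
                (proj₂ (proj₂ δ) ∙ identityʳ) Equiv.refl
                (pushout-∘-iso (PushoutComplement.isPushout m.complement) (proj₁ δ)) }

        spansAt-complete : ∀ S T m (φ : dom S ≅ Match.M m) (ψ : dom T ≅ Match.M m) →
          Match.m₂ m ∘ _≅_.from φ ≈ arr S → Match.m₁ m ∘ _≅_.from ψ ≈ arr T →
          Any (m M.≈_) (spansAt S T)
        spansAt-complete S T m φ ψ p q =
          whenTrue⁺ (decide (dom S ≅ dom T)) (≅-trans φ (≅-sym ψ)) λ θ →
            Any.concat⁺ (Any.tabulate⁺ (position θ)
              (matchesAt-complete (spanAt S T (≅-trans (Aut.element (dom S) (position θ)) θ)) m φ p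
                (through θ)))
          where
          module ψ = _≅_ ψ
          -- The stored `θ` may differ from the isomorphism that `m` induces between the domains;
          -- this automorphism, followed by `θ`, gives the latter back.
          automorphism : dom S ≅ dom T → dom S ≅ dom S
          automorphism θ = ≅-trans (≅-trans φ (≅-sym ψ)) (≅-sym θ)
          position : dom S ≅ dom T → Fin (Aut.size (dom S))
          position θ = Inverse.from (Aut.enumeration (dom S)) (automorphism θ)
          through : ∀ θ → Match.m₁ m ∘ _≅_.from φ ≈
                    arr T ∘ (_≅_.from θ ∘ _≅_.from (Aut.element (dom S) (position θ)))
          through θ = Match.m₁ m ◂ cancelˡ ψ.isoʳ ⁻¹ ∙ pullˡ q ∙
            arr T ◂ (cancelˡ θ.isoʳ ⁻¹ ∙
              θ.from ◂ Inverse.strictlyInverseˡ (Aut.enumeration (dom S)) (automorphism θ) ⁻¹)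
            where module θ = _≅_ θ

        matches-complete : ∀ m → Any (m M.≈_) matches
        matches-complete m = Any.concat⁺ (Any.tabulate⁺ i (Any.concat⁺ (Any.tabulate⁺ j
          (spansAt-complete (I.element i) (O.element j) m (proj₁ φ) (proj₁ ψ) (proj₂ φ) (proj₂ ψ)))))
          where
          module m = Match m
          S : Subobject p₂.I
          S = record { arr = m.m₂ ; mono = m.m₂-mono }
          T : Subobject p₁.O
          T = record { arr = m.m₁ ; mono = m.m₁-mono }
          i = Inverse.from I.enumeration S
          j = Inverse.from O.enumeration T
          φ = Inverse.strictlyInverseˡ I.enumeration S
          ψ = Inverse.strictlyInverseˡ O.enumeration T

      finiteMatches : Finite (MatchSetoid adhesive p₂ p₁)
      finiteMatches = listing⇒finite (MatchSetoid adhesive p₂ p₁)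
        (λ m m′ → decide (m M.≈ m′)) matches matches-complete

  module _ (fpcs : HasMonoFPCs) where
    open HasMonoFPCs fpcs

    -- The composite (p₃ ∘ p₂) ∘ p₁.
    module LeftNested where

      -- Left bracketing: from nested compositions to chains

      module ToChain {p₃ p₂ p₁ : Rule} (c : Composition p₃ p₂)
                     (c′ : Composition (Composition.result c) p₁) where
        private
          module c = Composition c
          module c′ = Composition c′
          module p₂ = Rule p₂
          module p₃ = Rule p₃

        i₂ : p₂.I ⇒ c′.X
        i₂ = c′.n₂ ∘ c.qI

        i₂-mono : Mono i₂
        i₂-mono = ∘-mono c′.implication.m-mono c.inputs.i-mono

        -- `c′.implication` is taken along all of `c.R`, the union of `I₂` and `c.V`; the
        -- implication along `I₂` alone is taken anew and contains `c′.D` by `d∈w₁`.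
        module W where
          open FPC (fpc i₂ p₂.inp i₂-mono p₂.inp-mono) public renaming (d to w₁; b to k₂)
          implication : Implication i₂ p₂.inp w₁
          implication = fpc⇒implication i₂-mono p₂.inp-mono (d-mono i₂-mono p₂.inp-mono) isFPC
          open Implication implication public
          w₁∘k₂ : w₁ ∘ k₂ ≈ i₂ ∘ p₂.inp
          w₁∘k₂ = IsPullback.commute (IsFPC.isPullback isFPC) ⁻¹
        open W using (w₁; k₂)

        f∈ : c′.n₂ ∘ c.qV ∈ w₁
        f∈ = W.intro λ p →
          let s , q , _ = c.inputs.meet (c′.implication.m-mono _ _ (assoc ⁻¹ ∙ p ∙ assoc) ⁻¹)
          in s , q

        f : c.V ⇒ W.apex
        f = proj₁ f∈

        w₁∘f : w₁ ∘ f ≈ c′.n₂ ∘ c.qV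
        w₁∘f = proj₂ f∈

        f∘k : f ∘ c.k₁ ≈ k₂
        f∘k = W.d-mono _ _
          (extend w₁∘f ∙ c′.n₂ ◂ c.inputs.commute ⁻¹ ∙ assoc ⁻¹ ∙ W.w₁∘k₂ ⁻¹)

        f-mono : Mono f
        f-mono = mono-factor w₁∘f (∘-mono c′.implication.m-mono c.inputs.j-mono)

        module X₂ where
          open Pushout (pushout c.v f c.complement.j-mono) public
            renaming (i₁ to ξ; i₂ to w₂)
          po : BiPO c.v f ξ w₂
          po = biPO c.complement.j-mono f-mono isPushout
          open BiPO po public
        open X₂ using (ξ; w₂)

        outcome : BiPO p₂.out k₂ (ξ ∘ c.n₁) w₂
        outcome = biPO-resp Equiv.refl f∘k Equiv.refl Equiv.refl
          (flip-biPO (paste (flip-biPO c.complement) (flip-biPO X₂.po)))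

        chain : Chain p₃ p₂ p₁
        chain = record
          { complement  = c′.complement
          ; implication = W.implication
          ; w₁∘k₂       = W.w₁∘k₂
          ; outcome     = outcome
          ; i₃          = ξ ∘ c.n₂
          ; i₃-mono     = ∘-mono X₂.i-mono c.implication.m-mono
          ; cover       = λ x → locally-bind (c′.cover x) λ
            { z (inj₂ (a , p)) → locally-all λ y → inj₁ (inj₁ (a ∘ y , extend p))
            ; z (inj₁ (a , p)) → locally-bind (c.inputs.cover a) λ
              { y (inj₁ (b , q)) → locally-all λ y′ →
                  inj₁ (inj₂ (b ∘ y′ , assoc ∙ c′.n₂ ◂ (pullˡ q ∙ assoc) ∙ extend p))
              -- A point of `c.V` is split inside `c.X`. In `I₃` it satisfies the third clause; in
              -- `O₂` it lies in `K₂`, and hence in `I₂`.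
              ; y (inj₂ (b , q)) → locally-map (c.cover (c.v ∘ b)) λ
                { y′ (inj₁ (u , r)) → inj₂ (f ∘ (b ∘ y′) ,
                    extend w₁∘f ∙ c′.n₂ ◂ (pullˡ q ∙ assoc) ∙ extend p ,
                    u , assoc ∙ ξ ◂ (r ∙ assoc) ∙ extend X₂.commute)
                ; y′ (inj₂ (u , r)) → inj₁ (inj₂ (in-i₂ (c.complement.meet (r ∙ assoc))
                    (c′.n₂ ◂ (pullˡ q ∙ assoc) ∙ extend p))) } } } }
          where
          in-i₂ : ∀ {Z} {u : Z ⇒ p₂.O} {b : Z ⇒ c.V} {x : Z ⇒ c′.X} →
                  Σ[ s ∈ Z ⇒ p₂.K ] p₂.out ∘ s ≈ u × c.k₁ ∘ s ≈ b →
                  c′.n₂ ∘ (c.qV ∘ b) ≈ x → x ∈ i₂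
          in-i₂ (s , _ , q) p =
            p₂.inp ∘ s , assoc ∙ c′.n₂ ◂ (extend c.inputs.commute ∙ c.qV ◂ q) ∙ p
        module chain = Chain chain

        module W₃ where
          open FPC (fpc chain.i₃ p₃.inp chain.i₃-mono p₃.inp-mono) public renaming (d to d₃; b to k₃)
          implication : Implication chain.i₃ p₃.inp d₃
          implication = fpc⇒implication chain.i₃-mono p₃.inp-mono
            (d-mono chain.i₃-mono p₃.inp-mono) isFPC
          open Implication implication public
          d₃∘k₃ : d₃ ∘ k₃ ≈ chain.i₃ ∘ p₃.inp
          d₃∘k₃ = IsPullback.commute (IsFPC.isPullback isFPC) ⁻¹
        open W₃ using (d₃; k₃)

        -- `c.R` is the union of `I₂` and `c.V`, and a point of `I₂` in `W` lies in `K₂`, thus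
        -- already in `c.V`. So `c.R ∩ W` is `c.V`.
        I∩W : ∀ {Z} {b : Z ⇒ c.R} {y : Z ⇒ W.apex} → w₁ ∘ y ≈ c′.n₂ ∘ b →
              Σ[ s ∈ Z ⇒ c.V ] c.qV ∘ s ≈ b × f ∘ s ≈ y
        I∩W {b = b} {y} p = also-f (mem (c.inputs.cover b) c.inputs.j-mono b λ z → λ
          { (inj₁ (a , q)) →
              in-qV q (W.elim (extend p ∙ c′.n₂ ◂ q ⁻¹ ∙ assoc ⁻¹))
          ; (inj₂ r) → r })
          where
          in-qV : ∀ {Z} {a : Z ⇒ p₂.I} {x : Z ⇒ c.R} → c.qI ∘ a ≈ x → a ∈ p₂.inp → x ∈ c.qV
          in-qV q (u , r) = c.k₁ ∘ u , extend (c.inputs.commute ⁻¹) ∙ c.qI ◂ r ∙ q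
          also-f : b ∈ c.qV → Σ[ s ∈ _ ⇒ c.V ] c.qV ∘ s ≈ b × f ∘ s ≈ y
          also-f (s , q) = s , q , W.d-mono _ _ (extend w₁∘f ∙ c′.n₂ ◂ q ∙ p ⁻¹)

        d∈w₁ : c′.d ∈ w₁
        d∈w₁ = W.intro λ p → case (c′.implication.elim (p ∙ assoc))
          where
          case : ∀ {Z} {a : Z ⇒ p₂.I} → c.qI ∘ a ∈ c.qV ∘ c.πV → a ∈ p₂.inp
          case (s , q) = let u , r , _ = c.inputs.meet (q ⁻¹ ∙ assoc) in u , r

        g₁ : c′.D ⇒ W.apex
        g₁ = proj₁ d∈w₁

        w₁∘g₁ : w₁ ∘ g₁ ≈ c′.d
        w₁∘g₁ = proj₂ d∈w₁

        g₁-mono : Mono g₁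
        g₁-mono = mono-factor w₁∘g₁ c′.implication.d-mono

        -- A point of both `c′.D` and `I₃` lies in `c.X ∩ W`, which is `c.V`, a part of `c.R`. There
        -- `c′.D` is cut down to `c.K`, which lies in `c.D`, and `c.D` meets `I₃` in `K₃`.
        w₂∘g₁∈d₃ : w₂ ∘ g₁ ∈ d₃
        w₂∘g₁∈d₃ = W₃.intro λ p → case (X₂.meet (assoc ⁻¹ ∙ p ⁻¹ ∙ assoc))
          where
          in-πV : ∀ {Z} {y : Z ⇒ c′.D} {s : Z ⇒ c.V} → f ∘ s ≈ g₁ ∘ y → s ∈ c.πV
          in-πV {y = y} q =
            let u , t = c′.implication.elim (w₁∘g₁ ⁻¹ ▸ y ∙ assoc ∙ w₁ ◂ q ⁻¹ ∙ extend w₁∘f)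
            in u , c.inputs.j-mono _ _ (assoc ⁻¹ ∙ t)
          in-inp : ∀ {Z} {a : Z ⇒ p₃.I} {s : Z ⇒ c.V} → c.v ∘ s ≈ c.n₂ ∘ a →
                   s ∈ c.πV → a ∈ p₃.inp
          in-inp p (u , q) = c.implication.elim (extend c.context.commute ∙ c.v ◂ q ∙ p)
          case : ∀ {Z} {y : Z ⇒ c′.D} {a : Z ⇒ p₃.I} →
                 Σ[ s ∈ Z ⇒ c.V ] c.v ∘ s ≈ c.n₂ ∘ a × f ∘ s ≈ g₁ ∘ y → a ∈ p₃.inp
          case (s , p , q) = in-inp p (in-πV q)

        g₃ : c′.D ⇒ W₃.apex
        g₃ = proj₁ w₂∘g₁∈d₃

        d₃∘g₃ : d₃ ∘ g₃ ≈ w₂ ∘ g₁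
        d₃∘g₃ = proj₂ w₂∘g₁∈d₃

        g₃-mono : Mono g₃
        g₃-mono = mono-factor d₃∘g₃ (∘-mono X₂.j-mono g₁-mono)

        ξ∘d∈d₃ : ξ ∘ c.d ∈ d₃
        ξ∘d∈d₃ = implication-∈ Equiv.refl c.implication W₃.implication X₂.i-mono

        h : c.D ⇒ W₃.apex
        h = proj₁ ξ∘d∈d₃

        d₃∘h : d₃ ∘ h ≈ ξ ∘ c.d
        d₃∘h = proj₂ ξ∘d∈d₃

        h-mono : Mono h
        h-mono = mono-factor d₃∘h (∘-mono X₂.i-mono c.implication.d-mono)

        h∘k₂ : h ∘ c.k₂ ≈ k₃
        h∘k₂ = W₃.d-mono _ _ (extend d₃∘h ∙ ξ ◂ c.d∘k₂ ∙ assoc ⁻¹ ∙ W₃.d₃∘k₃ ⁻¹)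

        ξ∩W₃ : ∀ {Z} {x : Z ⇒ c.X} {y : Z ⇒ W₃.apex} → ξ ∘ x ≈ d₃ ∘ y → x ∈ c.d
        ξ∩W₃ = implication-∋ Equiv.refl c.implication W₃.implication

        -- The intersection is `c′.D`, tested with `intro` on the points in `c.R`: these are in
        -- `c.R ∩ W`, which is `c.V`, while `W₃` restricts to `c.D` on `c.X`, and `c.V ∩ c.D` is
        -- `c.K`.
        W∩W₃ : ∀ {Z} {y : Z ⇒ W.apex} {x : Z ⇒ W₃.apex} → w₂ ∘ y ≈ d₃ ∘ x → y ∈ g₁
        W∩W₃ {y = y} {x} p = lift-w₁ (c′.implication.intro λ q →
          through-v (I∩W (assoc ⁻¹ ∙ q)))
          where
          lift-w₁ : w₁ ∘ y ∈ c′.d → y ∈ g₁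
          lift-w₁ (s , q) = s , W.d-mono _ _ (pullˡ w₁∘g₁ ∙ q)
          in-πV : ∀ {Z} {s : Z ⇒ c.V} → c.v ∘ s ∈ c.d → s ∈ c.πV
          in-πV (u , q) = let a , _ , r = pullback-∈ c.context q in a , r
          finish : ∀ {Z} {b : Z ⇒ c.R} {s : Z ⇒ c.V} → c.qV ∘ s ≈ b → s ∈ c.πV → b ∈ c.qV ∘ c.πV
          finish p (a , q) = a , assoc ∙ c.qV ◂ q ∙ p
          through-v : ∀ {Z} {z : Z ⇒ _} {b : Z ⇒ c.R} →
                      Σ[ s ∈ Z ⇒ c.V ] c.qV ∘ s ≈ b × f ∘ s ≈ y ∘ z → b ∈ c.qV ∘ c.πV
          through-v (s , q , r) =
            finish q (in-πV (ξ∩W₃ (extend X₂.commute ∙ w₂ ◂ r ∙ extend p)))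

        g₁∘k₂ : g₁ ∘ c′.k₂ ≈ f ∘ c.πV
        g₁∘k₂ = W.d-mono _ _ (pullˡ w₁∘g₁ ∙ c′.d∘k₂ ∙ extend (w₁∘f ⁻¹))

        -- `W₃` is decomposed along the cover of `X₂` by `c.X` and `W`, which it meets in `c.D` and
        -- `c′.D`. Pasting with the outputs of `c` then presents the final output as a single
        -- pushout over `W₃`.
        W₃-square : BiPO c.πD c′.k₂ h g₃
        W₃-square = cover⇒biPO c.πD-mono c′.outputs.g-mono h-mono g₃-mono
          (W₃.d-mono _ _ (extend d₃∘h ∙ ξ ◂ c.context.commute ∙ extend X₂.commute ∙
            w₂ ◂ g₁∘k₂ ⁻¹ ∙ extend (d₃∘g₃ ⁻¹)))
          meet
          λ x → locally-map (X₂.cover (d₃ ∘ x)) λ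
            { z (inj₁ (a , p)) → inj₁ (in-h (p ∙ assoc) (ξ∩W₃ (p ∙ assoc)))
            ; z (inj₂ (w , p)) → inj₂ (in-g₃ (p ∙ assoc) (W∩W₃ (p ∙ assoc))) }
          where
          in-h : ∀ {Z} {a : Z ⇒ c.X} {x : Z ⇒ W₃.apex} → ξ ∘ a ≈ d₃ ∘ x → a ∈ c.d → x ∈ h
          in-h p (u , q) = u , W₃.d-mono _ _ (extend d₃∘h ∙ ξ ◂ q ∙ p)
          in-g₃ : ∀ {Z} {w : Z ⇒ W.apex} {x : Z ⇒ W₃.apex} → w₂ ∘ w ≈ d₃ ∘ x → w ∈ g₁ → x ∈ g₃
          in-g₃ p (u , q) = u , W₃.d-mono _ _ (extend d₃∘g₃ ∙ w₂ ◂ q ∙ p)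
          meet : ∀ {Z} {x : Z ⇒ c.D} {y : Z ⇒ c′.D} → h ∘ x ≈ g₃ ∘ y →
                 Σ[ s ∈ Z ⇒ c.K ] c.πD ∘ s ≈ x × c′.k₂ ∘ s ≈ y
          meet p = finish (X₂.meet (extend (d₃∘h ⁻¹) ∙ d₃ ◂ p ∙ extend d₃∘g₃))
            where
            finish : ∀ {Z} {x : Z ⇒ c.D} {y : Z ⇒ c′.D} →
                     Σ[ s ∈ Z ⇒ c.V ] c.v ∘ s ≈ c.d ∘ x × f ∘ s ≈ g₁ ∘ y →
                     Σ[ s ∈ Z ⇒ c.K ] c.πD ∘ s ≈ x × c′.k₂ ∘ s ≈ y
            finish (s , q , r) =
              let t , u , u′ = pullback-∈ c.context (q ⁻¹)
              in t , u , g₁-mono _ _ (extend g₁∘k₂ ∙ f ◂ u′ ∙ r)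

        isResult : IsResult chain c′.result
        isResult = record
          { final      = W₃.implication
          ; d₃∘k₃      = W₃.d₃∘k₃
          ; e₃         = g₃ ∘ c′.πD
          ; eW         = g₁ ∘ c′.πD
          ; eV         = c′.πV
          ; d₃∘e₃      = extend d₃∘g₃
          ; w₁∘eW      = pullˡ w₁∘g₁ ∙ c′.context.commute
          ; limit      = limit
          ; outputs    = biPO-resp Equiv.refl h∘k₂ Equiv.refl Equiv.refl
                           (flip-biPO (paste (flip-biPO c.outputs) (flip-biPO W₃-outputs)))
          ; out-factor = pushˡ (q∘g₃ ⁻¹)
          ; inputs     = c′.inputs
          ; inp-factor = Equiv.refl }
          where
          module W₃′ = BiPO W₃-square
          q : W₃.apex ⇒ c′.Q
          q = W₃′.universal {h₁ = c′.qO ∘ c.qD} {h₂ = c′.qD} (assoc ∙ c′.outputs.commute)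
          q∘h : q ∘ h ≈ c′.qO ∘ c.qD
          q∘h = W₃′.universal∘i₁≈h₁
          q∘g₃ : q ∘ g₃ ≈ c′.qD
          q∘g₃ = W₃′.universal∘i₂≈h₂
          W₃-outputs : BiPO c.qD h c′.qO q
          W₃-outputs = cancel W₃-square c′.outputs c.outputs.j-mono (q∘h ⁻¹) q∘g₃
          limit : ∀ {Z} {x : Z ⇒ W₃.apex} {y : Z ⇒ W.apex} {z : Z ⇒ c′.V} →
                  d₃ ∘ x ≈ w₂ ∘ y → w₁ ∘ y ≈ c′.v ∘ z → y ∈ g₁ ∘ c′.πD
          limit {y = y} {z} p q = finish (W∩W₃ (p ⁻¹))
            where
            finish : y ∈ g₁ → y ∈ g₁ ∘ c′.πD
            finish (u , r) =
              let s , t , _ = pullback-∈ c′.context (pushˡ (w₁∘g₁ ⁻¹) ∙ w₁ ◂ r ∙ q)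
              in s , assoc ∙ g₁ ◂ t ∙ r

    -- Left bracketing: the chain determines both matches

    module LeftNestedInjective where
      open LeftNested

      module _ {p₃ p₂ p₁ : Rule} where
        inner-overlap : (c b : Composition p₃ p₂)
          {c′ : Composition (Composition.result c) p₁} {b′ : Composition (Composition.result b) p₁} →
          LeftNested.ToChain.chain c c′ ≈ᶜ LeftNested.ToChain.chain b b′ →
          ∀ {Z} {x : Z ⇒ Rule.I p₃} {y : Z ⇒ Rule.O p₂} →
          Composition.n₂ c ∘ x ≈ Composition.n₁ c ∘ y → Composition.n₂ b ∘ x ≈ Composition.n₁ b ∘ y
        inner-overlap c b {c′} {b′} φ {x = x} {y} p = ToChain.X₂.i-mono b b′ _ _
          (assoc ⁻¹ ∙ χ₂∘i₃ ⁻¹ ▸ x ∙ assoc ∙ χ₂.from ◂ (assoc ∙ ToChain.X₂.ξ c c′ ◂ p ∙ assoc ⁻¹) ∙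
            pullˡ χ₂∘o₂ ∙ assoc)
          where
          open _≈ᶜ_ φ

        -- The isomorphism respects `c.X` in `X₂`, therefore `c.V` in `W`, and therefore the two
        -- parts `I₂` and `c.V` of `c.R` in `X₁`.
        outer-overlap : (c : Composition p₃ p₂) (c′ b′ : Composition (Composition.result c) p₁) →
          LeftNested.ToChain.chain c c′ ≈ᶜ LeftNested.ToChain.chain c b′ →
          ∀ {Z} {x : Z ⇒ Composition.R c} {y : Z ⇒ Rule.O p₁} →
          Composition.n₂ c′ ∘ x ≈ Composition.n₁ c′ ∘ y →
          Composition.n₂ b′ ∘ x ≈ Composition.n₁ b′ ∘ y
        outer-overlap c c′ b′ φ {x = x} {y} p =
          χ₁∘n₂ ⁻¹ ▸ x ∙ assoc ∙ χ₁.from ◂ p ∙ pullˡ χ₁∘o₁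
          where
          open _≈ᶜ_ φ
          module c = Composition c
          χ₂∘ξ : χ₂.from ∘ ToChain.X₂.ξ c c′ ≈ ToChain.X₂.ξ c b′
          χ₂∘ξ = eq (c.cover id) λ z → λ
            { (inj₁ (a , q)) → through χ₂∘i₃ a (q ∙ identityˡ)
            ; (inj₂ (a , q)) → through χ₂∘o₂ a (q ∙ identityˡ) }
            where
            through : ∀ {Z D} {n : D ⇒ c.X} {z : Z ⇒ c.X} →
                      χ₂.from ∘ (ToChain.X₂.ξ c c′ ∘ n) ≈ ToChain.X₂.ξ c b′ ∘ n → (a : Z ⇒ D) → n ∘ a ≈ z →
                      (χ₂.from ∘ ToChain.X₂.ξ c c′) ∘ z ≈ ToChain.X₂.ξ c b′ ∘ z
            through r a q = _ ◂ q ⁻¹ ∙ pullˡ (assoc ∙ r) ∙ assoc ∙ _ ◂ q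
          ω∘f : ω.from ∘ ToChain.f c c′ ≈ ToChain.f c b′
          ω∘f = ToChain.X₂.j-mono c b′ _ _
            (extend (χ₂∘w₂ ⁻¹) ∙ χ₂.from ◂ ToChain.X₂.commute c c′ ⁻¹ ∙ pullˡ χ₂∘ξ ∙ ToChain.X₂.commute c b′)
          χ₁∘n₂ : χ₁.from ∘ Composition.n₂ c′ ≈ Composition.n₂ b′
          χ₁∘n₂ = pushout-unique c.inputs.isPushout
            (assoc ∙ χ₁∘i₂)
            (assoc ∙ χ₁.from ◂ ToChain.w₁∘f c c′ ⁻¹ ∙ extend χ₁∘w₁ ∙ ToChain.W.w₁ c b′ ◂ ω∘f ∙ ToChain.w₁∘f c b′)

    -- Left bracketing: every chain arises

    module LeftNestedSurjective where
      open LeftNested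

      module FromChain {p₃ p₂ p₁ : Rule} (t : Chain p₃ p₂ p₁) (c : Composition p₃ p₂)
                       (ρ : Embeds c (Chain.i₃ t) (Chain.o₂ t)) where
        open Embeds ρ renaming (ν to ξ; ν∘n₂ to ξ∘n₂; ν∘n₁ to ξ∘n₁; ν-mono to ξ-mono)
        private
          module p₂ = Rule p₂
          module c = Composition c
          module t = Chain t

        f : c.V ⇒ t.W
        f = proj₁ (complement-∈ ξ-mono ξ∘n₁ c.complement t.outcome)

        w₂∘f : t.w₂ ∘ f ≈ ξ ∘ c.v
        w₂∘f = proj₂ (complement-∈ ξ-mono ξ∘n₁ c.complement t.outcome)

        f-mono : Mono f
        f-mono = mono-factor w₂∘f (∘-mono ξ-mono c.complement.j-mono)

        ξ∩W : ∀ {Z} {x : Z ⇒ c.X} {y : Z ⇒ t.W} → ξ ∘ x ≈ t.w₂ ∘ y →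
              Σ[ s ∈ Z ⇒ c.V ] c.v ∘ s ≈ x × f ∘ s ≈ y
        ξ∩W p =
          let s , q = complement-∋ ξ-mono ξ∘n₁ c.complement t.outcome p
          in s , q , t.outcome.j-mono _ _ (extend w₂∘f ∙ ξ ◂ q ∙ p)

        f∘k₁ : f ∘ c.k₁ ≈ t.k₂
        f∘k₁ = t.outcome.j-mono _ _
          (extend w₂∘f ∙ ξ ◂ c.complement.commute ⁻¹ ∙ pullˡ ξ∘n₁ ∙ t.outcome.commute)

        n : c.R ⇒ t.X₁
        n = c.inputs.universal {h₁ = t.i₂} {h₂ = t.w₁ ∘ f}
          (t.w₁∘k₂ ⁻¹ ∙ t.w₁ ◂ f∘k₁ ⁻¹ ∙ assoc ⁻¹)

        n∘qI : n ∘ c.qI ≈ t.i₂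
        n∘qI = c.inputs.universal∘i₁≈h₁

        n∘qV : n ∘ c.qV ≈ t.w₁ ∘ f
        n∘qV = c.inputs.universal∘i₂≈h₂

        -- `W` is an implication and not a complement in `X₁`, so no pushout square of the chain has
        -- `n` as a leg. Injectivity is proved on the two parts of `c.R`: `I₂` meets `W` only in
        -- `K₂`, where they are glued.
        n-mono : Mono n
        n-mono = cover-mono c.inputs.cover
          (mono-resp (n∘qI ⁻¹) t.implication.m-mono)
          (mono-resp (n∘qV ⁻¹) (∘-mono t.implication.d-mono f-mono))
          λ p → meet (n∘qI ⁻¹ ▸ _ ∙ p ∙ n∘qV ▸ _ ∙ assoc)
          where
          via : ∀ {Z} {x : Z ⇒ p₂.I} {y : Z ⇒ c.V} → t.i₂ ∘ x ≈ t.w₁ ∘ (f ∘ y) →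
                x ∈ p₂.inp → c.qI ∘ x ≈ c.qV ∘ y
          via p (s , q) = c.qI ◂ q ⁻¹ ∙ extend c.inputs.commute ∙ c.qV ◂ f-mono _ _
            (t.implication.d-mono _ _
              (t.w₁ ◂ pullˡ f∘k₁ ∙ extend t.w₁∘k₂ ∙ t.i₂ ◂ q ∙ p))
          meet : ∀ {Z} {x : Z ⇒ p₂.I} {y : Z ⇒ c.V} → t.i₂ ∘ x ≈ t.w₁ ∘ (f ∘ y) →
                 c.qI ∘ x ≈ c.qV ∘ y
          meet p = via p (t.implication.elim (p ⁻¹))

        -- For the third clause of `Chain.cover`: a point of `W` whose image is in `I₃` lies in
        -- `c.X ∩ W`, that is in `c.V`, a part of `c.R`.
        cover : Cover n t.o₁
        cover x = locally-map (t.cover x) λ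
          { z (inj₁ (inj₁ p)) → inj₂ p
          ; z (inj₁ (inj₂ (a , p))) → inj₁ (c.qI ∘ a , pullˡ n∘qI ∙ p)
          ; z (inj₂ (w , p , a , q)) →
              let s , _ , r = ξ∩W (pullˡ ξ∘n₂ ∙ q)
              in inj₁ (c.qV ∘ s , extend n∘qV ∙ t.w₁ ◂ r ∙ p) }

        ξ-square : BiPO c.v f ξ t.w₂
        ξ-square = cover⇒biPO c.complement.j-mono f-mono ξ-mono t.outcome.j-mono (w₂∘f ⁻¹) ξ∩W
          λ x → locally-map (t.outcome.cover x) λ
            { z (inj₁ (a , p)) → inj₁ (c.n₁ ∘ a , pullˡ ξ∘n₁ ∙ p)
            ; z (inj₂ p) → inj₂ p }

        chain-≈ : (c′ : Composition c.result p₁) (ζ : Composition.X c′ ≅ t.X₁) →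
                  _≅_.from ζ ∘ Composition.n₂ c′ ≈ n → _≅_.from ζ ∘ Composition.n₁ c′ ≈ t.o₁ →
                  LeftNested.ToChain.chain c c′ ≈ᶜ t
        chain-≈ c′ ζ p q = record
          { χ₁ = ζ ; χ₂ = proj₁ δ ; ω = proj₁ φ
          ; χ₁∘o₁ = q
          ; χ₁∘i₂ = ζ∘i₂
          ; χ₂∘o₂ = pullˡ (proj₁ (proj₂ δ)) ∙ ξ∘n₁
          ; χ₂∘i₃ = pullˡ (proj₁ (proj₂ δ)) ∙ ξ∘n₂
          ; χ₁∘w₁ = proj₁ (proj₂ φ) ⁻¹
          ; χ₂∘w₂ = proj₂ (proj₂ δ) }
          where
          ζ∘i₂ : _≅_.from ζ ∘ ToChain.i₂ c c′ ≈ t.i₂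
          ζ∘i₂ = pullˡ p ∙ n∘qI
          φ = implication-iso ζ ζ∘i₂ (ToChain.W.w₁∘k₂ c c′) t.w₁∘k₂
            (ToChain.W.implication c c′) t.implication
          φ∘f : _≅_.from (proj₁ φ) ∘ ToChain.f c c′ ≈ f
          φ∘f = t.implication.d-mono _ _ (extend (proj₁ (proj₂ φ)) ∙ _ ◂ ToChain.w₁∘f c c′ ∙ pullˡ p ∙ n∘qV)
          δ = biPO-iso (ToChain.X₂.po c c′) ξ-square (proj₁ φ) φ∘f

    -- The product of rules and its laws

    module RuleProduct {c r} (family : ∀ p₂ p₁ → Family p₂ p₁) (R : CommutativeRing c r) where
      open FreeModule R Lin
      open FreeAlgebra R Lin
      open Module freeModule using (≈ᴹ-setoid; ≈ᴹ-refl; +ᴹ-cong; +ᴹ-commutativeMonoid)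
      open CommutativeMonoidSum +ᴹ-commutativeMonoid using (sum; sum-cong-≗)
      open SetoidReasoning ≈ᴹ-setoid

      module family p₂ p₁ = Family (family p₂ p₁)

      _·_ : Rule → Rule → Combination
      p₂ · p₁ = sum λ i → δ (family.resultAt p₂ p₁ i)

      module _ (q₂ q₁ : Rule) where
        private
          module L = Setoid Lin
          module B = Setoid (compositionSetoid q₂ q₁)

        composite-unique : (x y : Composition q₂ q₁) {s s′ : Rule} → x ≈ᵇ y →
          Composition.result x ≅ᴿ s → Composition.result y ≅ᴿ s′ → s ≅ᴿ s′
        composite-unique x y (χ , p , q) a b =
          L.trans (L.sym a) (L.trans (result-iso x y χ p q) b)

        open Enumerations R Lin (compositionSetoid q₂ q₁)
          (λ x s → Composition.result x ≅ᴿ s) composite-unique public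
          using () renaming (Item to CompositeItem; IsEnumeration to IsCompositeEnumeration;
            total to composite-total; enumeration-total to composite-enumeration-total;
            total-tabulate to composite-total-tabulate;
            tabulate-enumeration to tabulate-composites; [-]-enumeration to [-]-composites)

        module _ {p₂ p₁ : Rule} (φ₂ : p₂ ≅ᴿ q₂) (φ₁ : p₁ ≅ᴿ q₁) where
          private
            ψ₂ = L.sym φ₂
            ψ₁ = L.sym φ₁
            back : Composition p₂ p₁ → Composition q₂ q₁
            back = reindex ψ₂ ψ₁
            forth : Composition q₂ q₁ → Composition p₂ p₁
            forth = reindex φ₂ φ₁
            module P = Setoid (compositionSetoid p₂ p₁)

          -- Transporting the family of `p₂` and `p₁` along the isomorphisms enumerates the
          -- compositions of `q₂` and `q₁`. Reindexing leaves the resulting rule untouched, so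
          -- congruence of the product reduces to comparing two enumerations.
          compositeItem : Fin (family.size p₂ p₁) → CompositeItem
          compositeItem i = back (family.at p₂ p₁ i) , family.resultAt p₂ p₁ i , L.refl

          composite-enumeration : IsCompositeEnumeration (tabulate compositeItem)
          composite-enumeration = tabulate-composites compositeItem injective surjective
            where
            forth-back : ∀ x → forth (back x) ≈ᵇ x
            forth-back x = reindex-inverse ψ₂ ψ₁ φ₂ φ₁
              (_≅_.isoˡ (_≅ᴿ_.isoI φ₂)) (_≅_.isoˡ (_≅ᴿ_.isoO φ₁)) x
            back-forth : ∀ x → back (forth x) ≈ᵇ x
            back-forth x = reindex-inverse φ₂ φ₁ ψ₂ ψ₁
              (_≅_.isoʳ (_≅ᴿ_.isoI φ₂)) (_≅_.isoʳ (_≅ᴿ_.isoO φ₁)) x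
            reflect : ∀ x y → back x ≈ᵇ back y → x ≈ᵇ y
            reflect x y p = P.trans {x} {forth (back x)} {y}
              (P.sym {forth (back x)} {x} (forth-back x))
              (P.trans {forth (back x)} {forth (back y)} {y}
                (reindex-cong φ₂ φ₁ {back x} {back y} p) (forth-back y))
            injective : ∀ {i j} → back (family.at p₂ p₁ i) ≈ᵇ back (family.at p₂ p₁ j) → i ≡ j
            injective {i} {j} p = family.at-injective p₂ p₁
              (reflect (family.at p₂ p₁ i) (family.at p₂ p₁ j) p)
            surjective : ∀ z → ∃[ i ] z ≈ᵇ back (family.at p₂ p₁ i)
            surjective z = let i , p = family.locate p₂ p₁ (forth z) in
              i , B.sym {back (family.at p₂ p₁ i)} {z}
                (B.trans {back (family.at p₂ p₁ i)} {back (forth z)} {z}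
                  (reindex-cong ψ₂ ψ₁ {family.at p₂ p₁ i} {forth z} p) (back-forth z))

          composite-sum : composite-total (tabulate compositeItem) ∼ p₂ · p₁
          composite-sum = Setoid.reflexive ≈ᴹ-setoid (composite-total-tabulate compositeItem)

      ·-cong : ∀ {s s′ t t′} → s ≅ᴿ s′ → t ≅ᴿ t′ → s · t ∼ s′ · t′
      ·-cong {s} {s′} {t} {t′} φ ψ = begin
        s · t                                                ≈⟨ composite-sum s′ t′ φ ψ ⟨
        composite-total s′ t′ (tabulate (compositeItem s′ t′ φ ψ)) ≈⟨ composite-enumeration-total s′ t′
          (composite-enumeration s′ t′ φ ψ) (composite-enumeration s′ t′ L.refl L.refl) ⟩
        composite-total s′ t′ (tabulate (compositeItem s′ t′ L.refl L.refl)) ≈⟨ composite-sum s′ t′ L.refl L.refl ⟩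
        s′ · t′                                              ∎
        where module L = Setoid Lin

      singleton-product : ∀ {q₂ q₁ p} (x : Composition q₂ q₁) → Composition.result x ≅ᴿ p →
                          (∀ y → y ≈ᵇ x) → q₂ · q₁ ∼ δ p
      singleton-product {q₂} {q₁} {p} x φ unique = begin
        q₂ · q₁ ≈⟨ composite-sum q₂ q₁ L.refl L.refl ⟨
        composite-total q₂ q₁ (tabulate (compositeItem q₂ q₁ L.refl L.refl))
          ≈⟨ composite-enumeration-total q₂ q₁ (composite-enumeration q₂ q₁ L.refl L.refl)
               ([-]-composites q₂ q₁ (x , p , φ) unique) ⟩
        δ p ∎
        where module L = Setoid Lin

      linear-sum : ∀ f {n} (g : Fin n → Rule) →
                   linear f (sum λ i → δ (g i)) ∼ sum λ i → f (g i)
      linear-sum f {ℕ.zero}  g = []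
      linear-sum f {ℕ.suc n} g = begin
        linear f (δ (g zero) ++ sum λ i → δ (g (suc i)))
          ≈⟨ linear-++ f (δ (g zero)) (sum λ i → δ (g (suc i))) ⟩
        linear f (δ (g zero)) ++ linear f (sum λ i → δ (g (suc i)))
          ≈⟨ +ᴹ-cong (linear-δ f (g zero)) (linear-sum f λ i → g (suc i)) ⟩
        f (g zero) ++ sum (λ i → f (g (suc i))) ∎

      module _ (p₃ p₂ p₁ : Rule) where
        open Enumerations R Lin (chainSetoid p₃ p₂ p₁) IsResult chain-result-iso

        private
          double-sum : ∀ {n} {m : Fin n → ℕ} (item : ∀ i → Fin (m i) → Item) →
            total (concat (tabulate λ i → tabulate (item i))) ∼ sum λ i → sum λ j → δ (value (item i j))
          double-sum item = Setoid.reflexive ≈ᴹ-setoid (≡.trans (total-concat λ i → tabulate (item i))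
            (sum-cong-≗ λ i → total-tabulate (item i)))

        module _ (F : Family p₂ p₁) (G : ∀ i → Family p₃ (Family.resultAt F i)) where
          open Family
          open RightNested.ToChain using (chain; isResult)

          rightItem : ∀ i → Fin (size (G i)) → Item
          rightItem i j =
            chain (at F i) (at (G i) j) , resultAt (G i) j , isResult (at F i) (at (G i) j)

          right-enumeration : IsEnumeration (concat (tabulate λ i → tabulate (rightItem i)))
          right-enumeration = concat-enumeration rightItem outer inner surjective
            where
            outer : ∀ {i i′ j j′} → chain (at F i) (at (G i) j) ≈ᶜ chain (at F i′) (at (G i′) j′) → i ≡ i′
            outer {i} {i′} {j} {j′} φ = injective F
              (RightNestedInjective.inner-overlap (at F i) (at F i′) {at (G i) j} {at (G i′) j′} φ)
              (RightNestedInjective.inner-overlap (at F i′) (at F i) {at (G i′) j′} {at (G i) j}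
                (≈ᶜ-sym φ))
            inner : ∀ {i j j′} → chain (at F i) (at (G i) j) ≈ᶜ chain (at F i) (at (G i) j′) → j ≡ j′
            inner {i} {j} {j′} φ = injective (G i)
              (RightNestedInjective.outer-overlap (at F i) (at (G i) j) (at (G i) j′) φ)
              (RightNestedInjective.outer-overlap (at F i) (at (G i) j′) (at (G i) j) (≈ᶜ-sym φ))
            surjective : ∀ t → ∃[ i ] ∃[ j ] t ≈ᶜ chain (at F i) (at (G i) j)
            surjective t = first (embed F t.implication.m-mono t.complement)
              where
              module t = Chain t
              first : ∃[ i ] Embeds (at F i) t.i₂ t.o₁ →
                      ∃[ i ] ∃[ j ] t ≈ᶜ chain (at F i) (at (G i) j)
              first (i , ρ) = i , second (embed (G i) t.i₃-mono (complement t (at F i) ρ))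
                where
                open RightNestedSurjective.FromChain using (n; complement; cover; chain-≈)
                second : ∃[ j ] Embeds (at (G i) j) t.i₃ (n t (at F i) ρ) → ∃[ j ] t ≈ᶜ chain (at F i) (at (G i) j)
                second (j , σ) = j , ≈ᶜ-sym (chain-≈ t (at F i) ρ (at (G i) j)
                  (σ.ν-iso (cover t (at F i) ρ)) σ.ν∘n₂ σ.ν∘n₁)
                  where module σ = Embeds σ

        module _ (F : Family p₃ p₂) (G : ∀ i → Family (Family.resultAt F i) p₁) where
          open Family
          open LeftNested.ToChain using (chain; isResult)

          leftItem : ∀ i → Fin (size (G i)) → Item
          leftItem i j =
            chain (at F i) (at (G i) j) , resultAt (G i) j , isResult (at F i) (at (G i) j)

          left-enumeration : IsEnumeration (concat (tabulate λ i → tabulate (leftItem i)))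
          left-enumeration = concat-enumeration leftItem outer inner surjective
            where
            outer : ∀ {i i′ j j′} → chain (at F i) (at (G i) j) ≈ᶜ chain (at F i′) (at (G i′) j′) → i ≡ i′
            outer {i} {i′} {j} {j′} φ = injective F
              (LeftNestedInjective.inner-overlap (at F i) (at F i′) {at (G i) j} {at (G i′) j′} φ)
              (LeftNestedInjective.inner-overlap (at F i′) (at F i) {at (G i′) j′} {at (G i) j}
                (≈ᶜ-sym φ))
            inner : ∀ {i j j′} → chain (at F i) (at (G i) j) ≈ᶜ chain (at F i) (at (G i) j′) → j ≡ j′
            inner {i} {j} {j′} φ = injective (G i)
              (LeftNestedInjective.outer-overlap (at F i) (at (G i) j) (at (G i) j′) φ)
              (LeftNestedInjective.outer-overlap (at F i) (at (G i) j′) (at (G i) j) (≈ᶜ-sym φ))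
            surjective : ∀ t → ∃[ i ] ∃[ j ] t ≈ᶜ chain (at F i) (at (G i) j)
            surjective t = first (embed F t.i₃-mono t.outcome)
              where
              module t = Chain t
              first : ∃[ i ] Embeds (at F i) t.i₃ t.o₂ →
                      ∃[ i ] ∃[ j ] t ≈ᶜ chain (at F i) (at (G i) j)
              first (i , ρ) = i , second (embed (G i) (n-mono t (at F i) ρ) t.complement)
                where
                open LeftNestedSurjective.FromChain using (n; n-mono; cover; chain-≈)
                second : ∃[ j ] Embeds (at (G i) j) (n t (at F i) ρ) t.o₁ → ∃[ j ] t ≈ᶜ chain (at F i) (at (G i) j)
                second (j , σ) = j , ≈ᶜ-sym (chain-≈ t (at F i) ρ (at (G i) j)
                  (σ.ν-iso (cover t (at F i) ρ)) σ.ν∘n₂ σ.ν∘n₁)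
                  where module σ = Embeds σ

        ·-assoc : linear (_· p₁) (p₃ · p₂) ∼ linear (p₃ ·_) (p₂ · p₁)
        ·-assoc = begin
          linear (_· p₁) (p₃ · p₂)
            ≈⟨ linear-sum (_· p₁) (family.resultAt p₃ p₂) ⟩
          sum (λ i → family.resultAt p₃ p₂ i · p₁)
            ≈⟨ double-sum (leftItem F₃₂ F₁) ⟨
          total (concat (tabulate λ i → tabulate (leftItem F₃₂ F₁ i)))
            -- Both lists enumerate the chains of `p₃`, `p₂` and `p₁`, with results unique up to
            -- isomorphism.
            ≈⟨ enumeration-total (left-enumeration F₃₂ F₁) (right-enumeration F₂₁ F₃) ⟩
          total (concat (tabulate λ i → tabulate (rightItem F₂₁ F₃ i)))
            ≈⟨ double-sum (rightItem F₂₁ F₃) ⟩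
          sum (λ i → p₃ · family.resultAt p₂ p₁ i)
            ≈⟨ linear-sum (p₃ ·_) (family.resultAt p₂ p₁) ⟨
          linear (p₃ ·_) (p₂ · p₁) ∎
          where
          F₃₂ = family p₃ p₂
          F₂₁ = family p₂ p₁
          F₁ = λ i → family (family.resultAt p₃ p₂ i) p₁
          F₃ = λ i → family p₃ (family.resultAt p₂ p₁ i)

      module _ (initial : StrictInitial) where
        open Units initial

        ruleAlgebra : IsAssociativeUnitalAlgebra freeModule (bilinearExtension _·_)
                        (δ (emptyRule initial))
        ruleAlgebra = isAssociativeUnitalAlgebra _·_ ·-cong (emptyRule initial)
          (λ p → singleton-product (left p) (left-result p) λ y →
            Setoid.sym (compositionSetoid (emptyRule initial) p) {left p} {y} (left-unique p y))
          (λ p → singleton-product (right p) (right-result p) λ y →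
            Setoid.sym (compositionSetoid p (emptyRule initial)) {right p} {y} (right-unique p y))
          ·-assoc

mainTheorem3 : ∀ {o ℓ e c r} (C : Category o ℓ e)
    (adhesive : CategoryNotions.Adhesive C)
    (finitary : CategoryNotions.Finitary C)
    (initial : CategoryNotions.StrictInitial C)
    (fpcs : CategoryNotions.HasMonoFPCs C)
    (R : CommutativeRing c r) →
    (ExcludedMiddle (o ⊔ ℓ ⊔ e) →
    CategoryNotions.FiniteAutomorphisms C →
    Rules.FiniteMatches C adhesive) ×
    ((finite : Rules.FiniteMatches C adhesive) →
    IsAssociativeUnitalAlgebra
    (RuleAlgebra.ruleModule C R)
    (RuleAlgebra.product C R adhesive fpcs finite)
    (RuleAlgebra.R∅ C R initial))
mainTheorem3 C adhesive finitary initial fpcs R =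
  finiteMatches finitary ,
  -- With `matchFamily`, the product used here unfolds to `RuleAlgebra.product`, because the results
  -- in the family are the rules `composite` on the nose.
  λ finite → RuleProduct.ruleAlgebra fpcs (matchFamily fpcs finite) R initial
  where open SqPORewriting C adhesive
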